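{- The squarefree decomposition problem (SDP) is deterministically polynomial-time reducible to the modular tetration problem (MTP). That is, there is a deterministic algorithm which, given $N\in\mathbb{N}$ and access to an oracle solving MTP, computes the squarefree part of $N$ using a number of bit operations and oracle calls (on inputs of polynomial size) that is polynomial in $\log N$.
   Context: For $a\in\mathbb{N}$ define tetration by ${}^0a=1$ and ${}^{k}a=a^{({}^{k-1}a)}$ for $k\in\mathbb{N}$. The modular tetration problem (MTP): given $a,k,N\in\mathbb{N}$ (encoded in binary), compute ${}^k a \bmod N$. The squarefree part of $N\in\mathbb{N}$ is the smallest natural number $r$ such that $N/r$ is a perfect square. The squarefree decomposition problem (SDP): given $N$, compute its squarefree part. "Polynomial time" is measured in the bit length of the input. -}

module Defs where

open import Data.Nat using (ℕ; zero; suc; _+_; _*_; _∸_; _^_; _≤_; _≡ᵇ_)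
open import Data.Nat.DivMod using (_/_; _%_)
open import Data.Nat.Logarithm using (⌈log₂_⌉)
open import Data.Bool using (Bool; true; false; if_then_else_)
open import Data.List using (List; []; _∷_)
open import Data.Maybe using (Maybe; just; nothing)
open import Data.Product using (_×_; _,_; ∃-syntax)
open import Relation.Binary.PropositionalEquality using (_≡_)

tet : ℕ → ℕ → ℕ
tet a zero    = 1
tet a (suc k) = a ^ tet a k

mtp : ℕ → ℕ → ℕ → ℕ
mtp a k zero    = 0
mtp a k (suc n) = tet a k % suc n

IsSquareQuot : ℕ → ℕ → Set
IsSquareQuot N r = ∃[ m ] N ≡ r * (m * m)

IsSquarefreePart : ℕ → ℕ → Set
IsSquarefreePart N r =
  1 ≤ r × IsSquareQuot N r × (∀ r′ → 1 ≤ r′ → IsSquareQuot N r′ → r ≤ r′)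

bitlen : ℕ → ℕ
bitlen n = ⌈log₂ (suc n) ⌉

Reg = ℕ
Label = ℕ

data Instr : Set where
  const  : Reg → ℕ → Instr
  add    : Reg → Reg → Reg → Instr
  sub    : Reg → Reg → Reg → Instr
  mul    : Reg → Reg → Reg → Instr
  div    : Reg → Reg → Reg → Instr         -- r := s / t   (0 if t = 0)
  mod    : Reg → Reg → Reg → Instr         -- r := s % t   (0 if t = 0)
  jz     : Reg → Label → Instr
  jmp    : Label → Instr
  oracle : Reg → Reg → Reg → Reg → Instr
  halt   : Instr

Program : Set
Program = List Instr

record State : Set where
  constructor ⟨_,_⟩
  field
    pc   : Label
    regs : Reg → ℕ
open State public

nth : {A : Set} → List A → ℕ → Maybe A
nth []       _       = nothing
nth (x ∷ xs) zero    = just x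
nth (x ∷ xs) (suc i) = nth xs i

set : (Reg → ℕ) → Reg → ℕ → (Reg → ℕ)
set ρ r v i = if i ≡ᵇ r then v else ρ i

div0 : ℕ → ℕ → ℕ
div0 x zero    = 0
div0 x (suc d) = x / suc d

mod0 : ℕ → ℕ → ℕ
mod0 x zero    = 0
mod0 x (suc d) = x % suc d

-- one step: nothing if the machine has halted (halt instruction or pc
-- outside the program); otherwise the next state and the step's cost.
-- Every step costs at least 1; arithmetic costs are bit-operation counts
-- of schoolbook algorithms; an oracle call costs the bit size of its query.
step : Program → State → Maybe (State × ℕ)
step P ⟨ p , ρ ⟩ with nth P p
... | nothing = nothing
... | just halt = nothing
... | just (const r n) = just (⟨ suc p , set ρ r n ⟩ , suc (bitlen n))
... | just (add r s t) =
  just (⟨ suc p , set ρ r (ρ s + ρ t) ⟩ , suc (bitlen (ρ s) + bitlen (ρ t)))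
... | just (sub r s t) =
  just (⟨ suc p , set ρ r (ρ s ∸ ρ t) ⟩ , suc (bitlen (ρ s) + bitlen (ρ t)))
... | just (mul r s t) =
  just (⟨ suc p , set ρ r (ρ s * ρ t) ⟩ , suc (suc (bitlen (ρ s)) * suc (bitlen (ρ t))))
... | just (div r s t) =
  just (⟨ suc p , set ρ r (div0 (ρ s) (ρ t)) ⟩ , suc (suc (bitlen (ρ s)) * suc (bitlen (ρ t))))
... | just (mod r s t) =
  just (⟨ suc p , set ρ r (mod0 (ρ s) (ρ t)) ⟩ , suc (suc (bitlen (ρ s)) * suc (bitlen (ρ t))))
... | just (jz r l) = just (⟨ (if ρ r ≡ᵇ 0 then l else suc p) , ρ ⟩ , suc (bitlen (ρ r)))
... | just (jmp l) = just (⟨ l , ρ ⟩ , 1)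
... | just (oracle r a k n) =
  just (⟨ suc p , set ρ r (mtp (ρ a) (ρ k) (ρ n)) ⟩
       , suc (bitlen (ρ a) + bitlen (ρ k) + bitlen (ρ n)))

run : ℕ → Program → State → Maybe (State × ℕ)
run fuel P s with step P s
run fuel       P s | nothing = just (s , 0)
run zero       P s | just _  = nothing
run (suc fuel) P s | just (s′ , c) with run fuel P s′
... | nothing         = nothing
... | just (s″ , c′)  = just (s″ , c + c′)

init : ℕ → State
init N = ⟨ 0 , set (λ _ → 0) 0 N ⟩

-- For a base a prime to p, the differences δ a k of consecutive towers satisfy
-- δ a (k+1) = a ^ tet a k * (a ^ δ a k - 1). If a is even and k ≥ log₂ p, then δ a k is a multiple of
-- an exponent e < p with aᵉ ≡ 1 (mod p), so by lifting the exponent the p-adic valuation of δ a k grows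
-- by v = vₚ(aᵖ⁻¹ - 1) ≥ 1 with each storey. The oracle gives these differences modulo powers of N, and
-- comparing the gcds for two consecutive heights produces, without knowledge of p, a number divisible
-- by every p ∣ x and not by p² when v = 1; here x is N without its small prime factors.
-- If v ≥ 2 for all small bases, then all products of small numbers lie among the p - 1 solutions of
-- zᵖ⁻¹ ≡ 1 (mod p²), which contradicts Chebyshev's lower bound for the number of primes (an argument of
-- Lenstra). So the gcd of these numbers over polylogarithmically many bases is the radical of x, and
-- splitting off gcd (x, radical) repeatedly yields the squarefree part.
module Submission where

open import Defs
open import Data.Nat
open import Data.Nat.Properties
open import Data.Nat.DivMod
open import Data.Nat.Divisibility
open import Data.Nat.GCD hiding (module Bézout)
open import Data.Nat.Coprimality as Coprimality using (Coprime; coprime-divisor)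
open import Data.Nat.Primality
open import Data.Nat.Tactic.RingSolver using (solve-∀)
open import Data.Fin as Fin using (Fin)
import Data.Fin.Properties as Fin
open import Data.Product using (_×_; _,_; ∃-syntax; proj₁; proj₂)
open import Data.Sum using (_⊎_; inj₁; inj₂; [_,_]′)
open import Relation.Nullary using (¬_; Dec; yes; no; contradiction)
open import Relation.Nullary.Decidable using (decidable-stable)
open import Relation.Binary.PropositionalEquality using (_≡_; _≢_; refl; sym; trans; cong; cong₂; subst; subst₂; module ≡-Reasoning)
open import Data.Nat.Primality.Factorisation using (factorise; module PrimeFactorisation)
open import Data.Nat.Induction using (<-rec)
open import Data.List using ([]; _∷_; _++_; length)
open import Data.List.Properties using (length-++)
open import Data.List.Relation.Unary.All as All using ()
open import Data.Bool using (Bool; true; false; T; if_then_else_; _∧_; _∨_; not)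
open import Data.Maybe using (just; nothing)
open import Data.Unit using (⊤; tt)
open import Data.Nat.Logarithm

-- The oracle shows the towers only through a modulus, so the valuations to be compared may be cut
-- off. Hence the difference at the greater height is taken modulo G x, where G is the gcd found at
-- the smaller height: p ∣ x leaves room for one more factor p than G has, whether or not G itself
-- was cut off, and so p always shows up in the quotient. That p² does not show up when v = 1 needs
-- G to be intact at p; then the valuation of `δ a k` is at most k + 1, so a modulus divisible by
-- p^(k+1) is enough. Removing all primes up to a bound D makes every remaining p odd, prime to all
-- tested bases 2d with d ≤ D, and larger than the small numbers multiplied in the counting
-- argument. That argument is applied only to primes with p² ∣ N: the gcd starts at x, so it can
-- contain p² only if x does. Then p² ≤ N, and D polynomial in the bit length of N suffices. The
-- tested bases are even because the modulus must halve with each storey; if all of them are bad,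
-- then 2 is bad, and cancelling it makes every d ≤ D bad.

-- Congruence to 1, coprimality and periods of powers

infix 4 _≡1[mod_]

-- Stated without subtraction, and with the quotient u at hand for the binomial expansions. Zero is
-- never congruent to 1 in this sense, not even modulo 1.
_≡1[mod_] : ℕ → ℕ → Set
x ≡1[mod n ] = ∃[ u ] x ≡ suc (u * n)

1-mod-∣ : ∀ {n w} → n ∣ w → suc w ≡1[mod n ]
1-mod-∣ (divides u eq) = u , cong suc eq

∣-1-mod : ∀ {n w} → suc w ≡1[mod n ] → n ∣ w
∣-1-mod (u , eq) = divides u (suc-injective eq)

1-mod-* : ∀ {n x y} → x ≡1[mod n ] → y ≡1[mod n ] → x * y ≡1[mod n ]
1-mod-* {n} (u , refl) (v , refl) = u + v + u * n * v , lemma u v n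
  where
  lemma : ∀ u v n → suc (u * n) * suc (v * n) ≡ suc ((u + v + u * n * v) * n)
  lemma = solve-∀

1-mod-^ : ∀ {n x} k → x ≡1[mod n ] → x ^ k ≡1[mod n ]
1-mod-^ zero    _ = 0 , refl
1-mod-^ (suc k) h = 1-mod-* h (1-mod-^ k h)

1-mod-^-∣ : ∀ {n x e k} → x ^ e ≡1[mod n ] → e ∣ k → x ^ k ≡1[mod n ]
1-mod-^-∣ {n} {x} {e} h (divides q refl) =
  subst (_≡1[mod n ]) (trans (^-*-assoc x e q) (cong (x ^_) (*-comm e q))) (1-mod-^ q h)

coprime-^ʳ : ∀ {n a} k → Coprime n a → Coprime n (a ^ k)
coprime-^ʳ zero    c (_ , d∣1) = ∣1⇒≡1 d∣1
coprime-^ʳ {n} {a} (suc k) c {d} (d∣n , d∣aaᵏ) =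
  coprime-^ʳ k c (d∣n , coprime-divisor (λ (e∣d , e∣a) → c (∣-trans e∣d d∣n , e∣a)) d∣aaᵏ)

coprime-^ˡ : ∀ {n a} k → Coprime n a → Coprime (n ^ k) a
coprime-^ˡ k c = Coprimality.sym (coprime-^ʳ k (Coprimality.sym c))

coprime-∣-* : ∀ {m n k} → Coprime m n → m ∣ k → n ∣ k → m * n ∣ k
coprime-∣-* {m} {n} c (divides q refl) n∣qm =
  subst (_∣ q * m) (*-comm n m)
    (*-monoˡ-∣ m (coprime-divisor (Coprimality.sym c) (subst (n ∣_) (*-comm q m) n∣qm)))

prime∤⇒coprime : ∀ {p n} → Prime p → p ∤ n → Coprime p n
prime∤⇒coprime pr p∤n (d∣p , d∣n) with prime⇒irreducible pr d∣p
... | inj₁ d≡1  = d≡1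
... | inj₂ refl = contradiction d∣n p∤n

prime≥2 : ∀ {p} → Prime p → 2 ≤ p
prime≥2 {p} pr = nonTrivial⇒n>1 p {{prime⇒nonTrivial pr}}

n<m^n : ∀ {m} → 2 ≤ m → ∀ n → n < m ^ n
n<m^n     2≤m zero    = s≤s z≤n
n<m^n {m} 2≤m (suc n) = begin
  suc (suc n)   ≤⟨ s≤s (n<m^n 2≤m n) ⟩
  1 + m ^ n     ≤⟨ +-monoˡ-≤ (m ^ n) (≤-trans (s≤s z≤n) (n<m^n 2≤m n)) ⟩
  m ^ n + m ^ n ≡⟨ cong (m ^ n +_) (sym (+-identityʳ (m ^ n))) ⟩
  2 * m ^ n     ≤⟨ *-monoˡ-≤ (m ^ n) 2≤m ⟩
  m * m ^ n     ∎
  where open ≤-Reasoning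

^-mono-∣ : ∀ p {i j} → i ≤ j → p ^ i ∣ p ^ j
^-mono-∣ p {i} {j} i≤j =
  subst (p ^ i ∣_) (trans (sym (^-distribˡ-+-* p i (j ∸ i))) (cong (p ^_) (m+[n∸m]≡n i≤j))) (m∣m*n (p ^ (j ∸ i)))

-- A collision up to sign among 1, a, …, aʰ modulo n = 2h + 1: the nonzero residues fall
-- into h classes {r, n - r}.
even-period : ∀ {a} h → 1 ≤ h → Coprime (suc (h + h)) a →
              ∃[ e ] 1 ≤ e × e ≤ h × a ^ (e + e) ≡1[mod suc (h + h) ]
even-period {a} h@(suc h₀) 1≤h c =
  let i , j , i<j , eq = Fin.pigeonhole (n<1+n h) class in finish i j i<j eq
  where
  n = suc (h + h)

  res : Fin (suc h) → ℕ
  res i = a ^ Fin.toℕ i % n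

  res≢0 : ∀ i → res i ≢ 0
  res≢0 i r≡0 with coprime-^ʳ (Fin.toℕ i) c (∣-refl , m%n≡0⇒n∣m (a ^ Fin.toℕ i) n r≡0)
  ... | ()

  res<n : ∀ i → res i < n
  res<n i = m%n<n (a ^ Fin.toℕ i) n

  small : ∀ r → r ≢ 0 → r ≤ h → pred r < h
  small zero    r≢0 _   = contradiction refl r≢0
  small (suc r) _   r≤h = r≤h

  large : ∀ r → r < n → r ≰ h → n ∸ suc r < h
  large r r<n r≰h = begin-strict
    h + h ∸ r     ≤⟨ ∸-monoʳ-≤ (h + h) (≰⇒> r≰h) ⟩
    h + h ∸ suc h ≡⟨ cong (_∸ suc h) (+-suc h h₀) ⟩
    suc h + h₀ ∸ suc h ≡⟨ m+n∸m≡n (suc h) h₀ ⟩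
    h₀            <⟨ n<1+n h₀ ⟩
    h             ∎
    where open ≤-Reasoning

  -- Slot `pred r` for r ≤ h and slot n - r - 1 for r > h: so r and n - r share a slot.
  class : Fin (suc h) → Fin h
  class i with res i ≤? h
  ... | yes r≤h = Fin.fromℕ< (small (res i) (res≢0 i) r≤h)
  ... | no  r≰h = Fin.fromℕ< (large (res i) (res<n i) r≰h)

  fromℕ<-inj : ∀ {x y} (x<h : x < h) (y<h : y < h) → Fin.fromℕ< x<h ≡ Fin.fromℕ< y<h → x ≡ y
  fromℕ<-inj x<h y<h = Fin.fromℕ<-injective _ _ x<h y<h

  opposite : ∀ x y → x ≢ 0 → y < n → pred x ≡ n ∸ suc y → x + y ≡ n
  opposite zero    y x≢0 _   _  = contradiction refl x≢0
  opposite (suc x) y _   y<n eq = begin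
    suc (x + y)           ≡⟨ cong (λ z → suc (z + y)) eq ⟩
    suc (h + h ∸ y + y)   ≡⟨ cong suc (m∸n+n≡m (s≤s⁻¹ y<n)) ⟩
    n                     ∎
    where open ≡-Reasoning

  class-cases : ∀ i j → class i ≡ class j → res i ≡ res j ⊎ res i + res j ≡ n
  class-cases i j eq with res i ≤? h | res j ≤? h
  ... | yes p | yes q = inj₁ (pred-injective {{≢-nonZero (res≢0 i)}} {{≢-nonZero (res≢0 j)}} (fromℕ<-inj (small (res i) (res≢0 i) p) (small (res j) (res≢0 j) q) eq))
  ... | yes p | no  q = inj₂ (opposite _ _ (res≢0 i) (res<n j) (fromℕ<-inj (small (res i) (res≢0 i) p) (large (res j) (res<n j) q) eq))
  ... | no  p | yes q = inj₂ (trans (+-comm (res i) _)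
                          (opposite _ _ (res≢0 j) (res<n i) (sym (fromℕ<-inj (large (res i) (res<n i) p) (small (res j) (res≢0 j) q) eq))))
  ... | no  p | no  q = inj₁ (suc-injective (∸-cancelˡ-≡ {m = n} (res<n i) (res<n j)
                          (fromℕ<-inj (large (res i) (res<n i) p) (large (res j) (res<n j) q) eq)))

  -- Here x ≡ -1, and x² - 1 = (x - 1)(x + 1). This possible sign of aᵉ is why the exponent found is
  -- e + e.
  square-plus : ∀ {x} → n ∣ suc x → x * x ≡1[mod n ]
  square-plus {zero}  n∣1 with ∣1⇒≡1 n∣1
  ... | ()
  square-plus {suc x} n∣ = subst (_≡1[mod n ]) (lemma x) (1-mod-∣ (∣n⇒∣m*n x n∣))
    where
    lemma : ∀ x → suc (x * suc (suc x)) ≡ suc x * suc x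
    lemma = solve-∀

  conclude : ∀ i e → e ≢ 0 → e ≤ h → a ^ i % n ≡ a ^ (i + e) % n ⊎ a ^ i % n + a ^ (i + e) % n ≡ n →
             ∃[ e ] 1 ≤ e × e ≤ h × a ^ (e + e) ≡1[mod n ]
  conclude i e e≢0 e≤h cases = e , n≢0⇒n>0 e≢0 , e≤h , subst (_≡1[mod n ]) (sym (^-distribˡ-+-* a e e)) (sq cases)
    where
    A = a ^ i
    B = a ^ e
    cA : Coprime n A
    cA = coprime-^ʳ i c
    rw : a ^ (i + e) ≡ A * B
    rw = ^-distribˡ-+-* a i e
    sq : A % n ≡ a ^ (i + e) % n ⊎ A % n + a ^ (i + e) % n ≡ n → B * B ≡1[mod n ]
    sq (inj₁ eq) with B in B≡
    ... | zero  = contradiction (coprime-^ʳ e c (∣-refl , subst (n ∣_) (sym B≡) (n ∣0))) λ ()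
    ... | suc b = 1-mod-* 1b 1b
      where
      1b : suc b ≡1[mod n ]
      1b = 1-mod-∣ (coprime-divisor cA (%≡⇒∣ {A} (trans eq (cong (_% n) (trans rw (trans (cong (A *_) B≡) (*-suc A b)))))))
        where
        %≡⇒∣ : ∀ {x y} → x % n ≡ (x + y) % n → n ∣ y
        %≡⇒∣ {x} {y} eq = ∣m+n∣m⇒∣n {m = x / n * n} n∣sum (n∣m*n (x / n))
          where
          n∣sum : n ∣ x / n * n + y
          n∣sum = divides ((x + y) / n) (+-cancelˡ-≡ (x % n) _ _ (begin
            x % n + (x / n * n + y)        ≡⟨ sym (+-assoc (x % n) _ y) ⟩
            x % n + x / n * n + y          ≡⟨ cong (_+ y) (sym (m≡m%n+[m/n]*n x n)) ⟩
            x + y                          ≡⟨ m≡m%n+[m/n]*n (x + y) n ⟩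
            (x + y) % n + (x + y) / n * n  ≡⟨ cong (_+ (x + y) / n * n) (sym eq) ⟩
            x % n + (x + y) / n * n        ∎))
            where open ≡-Reasoning
    sq (inj₂ eq) = square-plus (coprime-divisor cA (divides (suc (A / n + A * B / n)) (begin
      A * suc B                                           ≡⟨ *-suc A B ⟩
      A + A * B                                           ≡⟨ cong₂ _+_ (m≡m%n+[m/n]*n A n) (m≡m%n+[m/n]*n (A * B) n) ⟩
      A % n + A / n * n + (A * B % n + A * B / n * n)     ≡⟨ rearrange (A % n) (A / n) (A * B % n) (A * B / n) n ⟩
      A % n + A * B % n + (A / n + A * B / n) * n         ≡⟨ cong (_+ (A / n + A * B / n) * n) (trans (cong (λ z → A % n + z % n) (sym rw)) eq) ⟩
      n + (A / n + A * B / n) * n                         ∎)))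
      where
      open ≡-Reasoning
      rearrange : ∀ r q s t m → r + q * m + (s + t * m) ≡ r + s + (q + t) * m
      rearrange = solve-∀

  finish : ∀ i j → i Fin.< j → class i ≡ class j →
           ∃[ e ] 1 ≤ e × e ≤ h × a ^ (e + e) ≡1[mod n ]
  finish i j i<j eq = conclude (Fin.toℕ i) e (m>n⇒m∸n≢0 i<j)
    (≤-trans (m∸n≤m (Fin.toℕ j) (Fin.toℕ i)) (s≤s⁻¹ (Fin.toℕ<n j)))
    (subst (λ z → a ^ Fin.toℕ i % n ≡ a ^ z % n ⊎ a ^ Fin.toℕ i % n + a ^ z % n ≡ n)
       (sym (m+[n∸m]≡n (<⇒≤ i<j))) (class-cases i j eq))
    where e = Fin.toℕ j ∸ Fin.toℕ i

-- Every common factor with a that is removed from e at least halves it, hence aʲ absorbs them all.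
coprime-part : ∀ a j e → 1 ≤ e → e < 2 ^ suc j →
               ∃[ e₁ ] Coprime e₁ a × 1 ≤ e₁ × e₁ ≤ e × e ∣ e₁ * a ^ j
coprime-part a zero (suc zero) 1≤e e< = 1 , Coprimality.1-coprimeTo a , ≤-refl , ≤-refl , 1∣ _
coprime-part a zero (suc (suc e)) 1≤e (s≤s (s≤s ()))
coprime-part a (suc j) e 1≤e e< with gcd e a in g≡
... | zero = contradiction (gcd[m,n]≡0⇒m≡0 g≡) (m<n⇒n≢0 1≤e)
... | suc zero = e , Coprimality.gcd≡1⇒coprime g≡ , 1≤e , ≤-refl , m∣m*n (a ^ suc j)
... | suc (suc g) with subst (_∣ e) g≡ (gcd[m,n]∣m e a)
... | divides q refl with coprime-part a j q 1≤q q<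
  where
  1≤q : 1 ≤ q
  1≤q = n≢0⇒n>0 λ { refl → contradiction 1≤e λ () }
  q< : q < 2 ^ suc j
  q< = *-cancelʳ-< 2 q (2 ^ suc j) (≤-<-trans (*-monoʳ-≤ q (s≤s (s≤s z≤n))) (subst (q * suc (suc g) <_) (*-comm 2 (2 ^ suc j)) e<))
... | e₁ , c , 1≤e₁ , e₁≤q , q∣ = e₁ , c , 1≤e₁ , ≤-trans e₁≤q (m≤m*n q _) ,
      subst (q * suc (suc g) ∣_) (lemma e₁ (a ^ j) a)
        (*-pres-∣ q∣ (subst (_∣ a) g≡ (gcd[m,n]∣n (q * suc (suc g)) a)))
  where
  lemma : ∀ x y z → x * y * z ≡ x * (z * y)
  lemma = solve-∀

-- Differences of consecutive towers

δ : ℕ → ℕ → ℕ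
δ a k = tet a (suc k) ∸ tet a k

k<tet : ∀ {a} → 2 ≤ a → ∀ k → k < tet a k
k<tet     2≤a zero    = s≤s z≤n
k<tet {a} 2≤a (suc k) = ≤-<-trans (k<tet 2≤a k) (n<m^n 2≤a (tet a k))

module Tower (a : ℕ) (2≤a : 2 ≤ a) where
  private instance
    a≢0 : NonZero a
    a≢0 = >-nonZero (<⇒≤ 2≤a)

  tet-mono : ∀ k → tet a k ≤ tet a (suc k)
  tet-mono zero    = subst (1 ≤_) (sym (*-identityʳ a)) (<⇒≤ 2≤a)
  tet-mono (suc k) = ^-monoʳ-≤ a (tet-mono k)

  tet-δ : ∀ k → tet a k + δ a k ≡ tet a (suc k)
  tet-δ k = m+[n∸m]≡n (tet-mono k)

  δ-suc : ∀ k → ∃[ w ] a ^ δ a k ≡ suc w × δ a (suc k) ≡ a ^ tet a k * w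
  δ-suc k with a ^ δ a k in eq
  ... | zero  = contradiction (m^n≡0⇒m≡0 a (δ a k) eq) (m<n⇒n≢0 (<⇒≤ 2≤a))
  ... | suc w = w , refl , (begin
    a ^ tet a (suc k) ∸ a ^ tet a k               ≡⟨ cong (λ z → a ^ z ∸ a ^ tet a k) (sym (tet-δ k)) ⟩
    a ^ (tet a k + δ a k) ∸ a ^ tet a k           ≡⟨ cong (_∸ a ^ tet a k) (^-distribˡ-+-* a (tet a k) (δ a k)) ⟩
    a ^ tet a k * a ^ δ a k ∸ a ^ tet a k         ≡⟨ cong (λ z → a ^ tet a k * z ∸ a ^ tet a k) eq ⟩
    a ^ tet a k * suc w ∸ a ^ tet a k             ≡⟨ cong (_∸ a ^ tet a k) (*-suc (a ^ tet a k) w) ⟩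
    a ^ tet a k + a ^ tet a k * w ∸ a ^ tet a k   ≡⟨ m+n∸m≡n (a ^ tet a k) _ ⟩
    a ^ tet a k * w                               ∎)
    where open ≡-Reasoning

  ∣δ-suc : ∀ {n} k → a ^ δ a k ≡1[mod n ] → n ∣ δ a (suc k)
  ∣δ-suc {n} k one with w , eq , eq′ ← δ-suc k =
    subst (n ∣_) (sym eq′) (∣n⇒∣m*n (a ^ tet a k) (∣-1-mod (subst (_≡1[mod n ]) eq one)))

  ∣δ-suc⁻¹ : ∀ {n} k → Coprime n a → n ∣ δ a (suc k) → a ^ δ a k ≡1[mod n ]
  ∣δ-suc⁻¹ {n} k c n∣ with w , eq , eq′ ← δ-suc k =
    subst (_≡1[mod n ]) (sym eq)
      (1-mod-∣ (coprime-divisor (coprime-^ʳ (tet a k) c) (subst (n ∣_) eq′ n∣)))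

  -- Both towers are powers of a whose exponents are again towers, hence at least k.
  ^∣δ : ∀ k → a ^ k ∣ δ a k
  ^∣δ zero    = 1∣ _
  ^∣δ (suc k) = ∣m+n∣m⇒∣n {m = tet a (suc k)} (subst (a ^ suc k ∣_) (sym (tet-δ (suc k))) (^-mono-∣ a (<⇒≤ (k<tet 2≤a (suc k)))))
                  (^-mono-∣ a (k<tet 2≤a k))

  module Even (2∣a : 2 ∣ a) where

    odd-coprime : ∀ {n} → Coprime n a → ∃[ h ] n ≡ suc (h + h)
    odd-coprime {n} c with n % 2 in eq | m≡m%n+[m/n]*n n 2 | m%n<n n 2
    ... | 0 | _ | _ with c (m%n≡0⇒n∣m n 2 eq , 2∣a)
    ...   | ()
    odd-coprime {n} c | 1 | e | _ = n / 2 , trans e (cong suc (lemma (n / 2)))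
      where
      lemma : ∀ h → h * 2 ≡ h + h
      lemma = solve-∀
    odd-coprime {n} c | suc (suc _) | _ | s≤s (s≤s ())

    -- Towers are eventually constant modulo any n; the point is that height log₂ n is enough, which
    -- keeps the heights in the oracle queries small.
    Stable : ℕ → Set
    Stable j = ∀ n k → 1 ≤ n → n < 2 ^ j → Coprime n a → j ≤ k → n ∣ δ a k

    -- The factors that e shares with a are absorbed by a^(j-1), and one more a pays for the factor
    -- 2; `^∣δ` supplies aʲ. The part of e coprime to a comes from stability.
    double∣δ : ∀ j e k → Stable j → 1 ≤ e → e < 2 ^ j → j ≤ k → e + e ∣ δ a k
    double∣δ zero    (suc e) k st 1≤e (s≤s ()) j≤k
    double∣δ (suc j) e k st 1≤e e< j≤k with e₁ , c , 1≤e₁ , e₁≤e , e∣ ← coprime-part a j e 1≤e e< =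
      ∣-trans (subst₂ _∣_ (lemma₁ e) (lemma₂ e₁ a (a ^ j)) (*-pres-∣ 2∣a e∣))
        (coprime-∣-* (coprime-^ʳ (suc j) c) (st e₁ k 1≤e₁ (≤-<-trans e₁≤e e<) c j≤k)
          (∣-trans (^-mono-∣ a j≤k) (^∣δ k)))
      where
      lemma₁ : ∀ e → 2 * e ≡ e + e
      lemma₁ = solve-∀
      lemma₂ : ∀ x y z → y * (x * z) ≡ x * (y * z)
      lemma₂ = solve-∀

    half< : ∀ {h j} → suc (h + h) < 2 ^ suc j → h < 2 ^ j
    half< {h} {j} lt = *-cancelˡ-< 2 h (2 ^ j) (<-trans (subst (_< suc (h + h)) (lemma h) ≤-refl) lt)
      where
      lemma : ∀ h → h + h ≡ 2 * h
      lemma = solve-∀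

    -- The exponent 2e found by even-period has e < n / 2, and its factor 2 comes for free because a
    -- is even; so the modulus halves with each storey of the tower.
    stable : ∀ j → Stable j
    stable zero    (suc n) k 1≤n (s≤s ()) c j≤k
    stable (suc j) n (suc k) 1≤n n< c (s≤s j≤k) with odd-coprime c
    ... | zero , refl = 1∣ _
    ... | h@(suc _) , refl with e , 1≤e , e≤h , one ← even-period h (s≤s z≤n) c =
      ∣δ-suc k (1-mod-^-∣ {k = δ a k} one (double∣δ j e k (stable j) 1≤e (≤-<-trans e≤h (half< {j = j} n<)) j≤k))

-- Primes dividing tower differences

binomial₁ : ∀ w n → ∃[ r ] suc w ^ n ≡ suc (n * w + w * w * r)
binomial₁ w zero    = 0 , cong suc (sym (*-zeroʳ (w * w)))
binomial₁ w (suc n) with r , eq ← binomial₁ w n =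
  n + r + w * r , trans (cong (suc w *_) eq) (lemma w n r)
  where
  lemma : ∀ w n r → suc w * suc (n * w + w * w * r) ≡ suc (suc n * w + w * w * (n + r + w * r))
  lemma = solve-∀

-- This is n choose 2, the quadratic coefficient of `binomial₂`; for odd n it is divisible by n.
triangle : ℕ → ℕ
triangle zero    = 0
triangle (suc n) = triangle n + n

triangle-odd : ∀ h → triangle (suc (h + h)) ≡ suc (h + h) * h
triangle-odd zero    = refl
triangle-odd (suc h) = begin
  triangle (suc h + suc h) + (suc h + suc h)         ≡⟨ cong (λ z → triangle z + z) (cong suc (+-suc h h)) ⟩
  triangle (suc (h + h)) + suc (h + h) + suc (suc (h + h)) ≡⟨ cong (λ z → z + suc (h + h) + suc (suc (h + h))) (triangle-odd h) ⟩
  suc (h + h) * h + suc (h + h) + suc (suc (h + h))  ≡⟨ lemma h ⟩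
  suc (suc h + suc h) * suc h                        ∎
  where
  open ≡-Reasoning
  lemma : ∀ h → suc (h + h) * h + suc (h + h) + suc (suc (h + h)) ≡ suc (suc h + suc h) * suc h
  lemma = solve-∀

binomial₂ : ∀ w n → ∃[ r ] suc w ^ n ≡ suc (n * w + triangle n * (w * w) + w * w * w * r)
binomial₂ w zero    = 0 , cong suc (sym (*-zeroʳ (w * w * w)))
binomial₂ w (suc n) with r , eq ← binomial₂ w n =
  triangle n + r + w * r , trans (cong (suc w *_) eq) (lemma w n (triangle n) r)
  where
  lemma : ∀ w n t r → suc w * suc (n * w + t * (w * w) + w * w * w * r) ≡
                      suc (suc n * w + (t + n) * (w * w) + w * w * w * (t + r + w * r))
  lemma = solve-∀

binomial-at : ∀ y w n → ∃[ r ] (y + w) ^ suc n ≡ y ^ suc n + (suc n * y ^ n * w + w * w * r)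
binomial-at y w zero    = 0 , lemma y w
  where
  lemma : ∀ y w → (y + w) * 1 ≡ y * 1 + (1 * 1 * w + w * w * 0)
  lemma = solve-∀
binomial-at y w (suc n) with r , eq ← binomial-at y w n =
  suc n * y ^ n + (y + w) * r , trans (cong ((y + w) *_) eq) (lemma y w n (y ^ n) r)
  where
  lemma : ∀ y w n Y r → (y + w) * (y * Y + (suc n * Y * w + w * w * r)) ≡
          y * (y * Y) + (suc (suc n) * (y * Y) * w + w * w * (suc n * Y + (y + w) * r))
  lemma = solve-∀

1-mod-difference : ∀ {n x y} → x ≡1[mod n ] → x + y ≡1[mod n ] → n ∣ y
1-mod-difference {n} (u , refl) (v , eq) =
  ∣m+n∣m⇒∣n {m = u * n} (divides v (suc-injective eq)) (n∣m*n u)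

∣! : ∀ {m n} → 1 ≤ m → m ≤ n → m ∣ n !
∣! {suc m} _ m≤n = ∣-trans (m∣m*n (m !)) (m≤n⇒m!∣n! m≤n)

valuation : ∀ {p n} → 2 ≤ p → 1 ≤ n → ∃[ j ] p ^ j ∣ n × p ^ suc j ∤ n
valuation {p} {n} 2≤p 1≤n = search n (>⇒∤ {{>-nonZero 1≤n}} (n<m^n 2≤p n))
  where
  search : ∀ m → p ^ m ∤ n → ∃[ j ] p ^ j ∣ n × p ^ suc j ∤ n
  search zero    ∤n = contradiction (1∣ n) ∤n
  search (suc m) ∤n with p ^ m ∣? n
  ... | yes pᵐ∣n = m , pᵐ∣n , ∤n
  ... | no  pᵐ∤n = search m pᵐ∤n

-- With x = 1 + w the linear term p w gains a factor p, and w² is divisible by p^(2i+2) already.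
1-mod-lift : ∀ {p x} i → x ≡1[mod p ^ suc i ] → x ^ p ≡1[mod p ^ suc (suc i) ]
1-mod-lift {p} i (u , refl) with r , eq ← binomial₁ (u * p ^ suc i) p =
  u + u * u * p ^ i * r , trans eq (cong suc (lemma p u (p ^ i) r))
  where
  lemma : ∀ p u P r → p * (u * (p * P)) + u * (p * P) * (u * (p * P)) * r ≡ (u + u * u * P * r) * (p * (p * P))
  lemma = solve-∀

1-mod-^-prime-power : ∀ {p x} j → x ≡1[mod p ] → x ^ (p ^ j) ≡1[mod p ^ suc j ]
1-mod-^-prime-power {p} {x} zero    h = subst₂ _≡1[mod_] (sym (^-identityʳ x)) (sym (*-identityʳ p)) h
1-mod-^-prime-power {p} {x} (suc j) h =
  subst (_≡1[mod p ^ suc (suc j) ]) (trans (^-*-assoc x (p ^ j) p) (cong (x ^_) (*-comm (p ^ j) p)))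
    (1-mod-lift {p} j (1-mod-^-prime-power j h))

1-mod-^-swap : ∀ {n} x i j → x ^ i ≡1[mod n ] → (x ^ j) ^ i ≡1[mod n ]
1-mod-^-swap {n} x i j h = subst (_≡1[mod n ]) (sym (^-*-assoc x j i)) (1-mod-^-∣ {e = i} {k = j * i} h (n∣m*n j))

-- a ∈ W p says that p is a Wieferich prime to base a: since p ∤ (p - 1)!, the exponent
-- (p - 1)! may replace p - 1.
W : ℕ → ℕ → Set
W p a = a ^ (pred p !) ≡1[mod p * p ]

^-distribʳ-* : ∀ n x y → (x * y) ^ n ≡ x ^ n * y ^ n
^-distribʳ-* zero    x y = refl
^-distribʳ-* (suc n) x y = trans (cong (x * y *_) (^-distribʳ-* n x y)) (lemma x y (x ^ n) (y ^ n))
  where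
  lemma : ∀ x y X Y → x * y * (X * Y) ≡ x * X * (y * Y)
  lemma = solve-∀

W-* : ∀ {p a b} → W p a → W p b → W p (a * b)
W-* {p} {a} {b} wa wb = subst (_≡1[mod p * p ]) (sym (^-distribʳ-* (pred p !) a b)) (1-mod-* wa wb)

1-mod? : ∀ n x → Dec (x ≡1[mod n ])
1-mod? n zero    = no λ ()
1-mod? n (suc w) with n ∣? w
... | yes n∣w = yes (1-mod-∣ n∣w)
... | no  n∤w = no (λ h → n∤w (∣-1-mod h))

module OddPrime {p : ℕ} (pr : Prime p) {h : ℕ} (p≡ : p ≡ suc (h + h)) where

  2≤p : 2 ≤ p
  2≤p = prime≥2 pr

  private instance
    p≢0 : NonZero p
    p≢0 = prime⇒nonZero pr

  1≤h : 1 ≤ h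
  1≤h = n≢0⇒n>0 λ { refl → <⇒≱ 2≤p (≤-reflexive p≡) }

  1<p : pred p < p
  1<p = ≤-reflexive (suc-pred p)

  p∤p-1! : ∀ {n} → n < p → p ∤ n !
  p∤p-1! {zero}  n<p p∣ = <⇒≢ 2≤p (sym (∣1⇒≡1 p∣))
  p∤p-1! {suc n} n<p p∣ with euclidsLemma (suc n) (n !) pr p∣
  ... | inj₁ p∣n = >⇒∤ n<p p∣n
  ... | inj₂ p∣! = p∤p-1! (<-trans (n<1+n n) n<p) p∣!

  -- This takes the place of Fermat's little theorem. Since 2e < p, the exponent is coprime to p and
  -- divides (p - 1)!, and these two facts carry the rest.
  period : ∀ {a} → Coprime p a → ∃[ e ] 1 ≤ e × e + e < p × a ^ (e + e) ≡1[mod p ]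
  period {a} c with e , 1≤e , e≤h , one ← even-period h 1≤h (subst (λ z → Coprime z a) p≡ c) =
    e , 1≤e , subst (e + e <_) (sym p≡) (s≤s (+-mono-≤ e≤h e≤h)) , subst (a ^ (e + e) ≡1[mod_]) (sym p≡) one

  ^-factorial : ∀ {a} → Coprime p a → a ^ (pred p !) ≡1[mod p ]
  ^-factorial c with e , 1≤e , e< , one ← period c =
    1-mod-^-∣ {e = e + e} {k = pred p !} one (∣! (≤-trans 1≤e (m≤m+n e e)) (<⇒≤pred e<))

  -- Induction on j: modulo one more p the expansion reads n u ≡ 0, so p ∣ n. Then the base is
  -- replaced by its p-th power, which raises i by one and keeps p ∤ u, and n by n / p.
  lifting-the-exponent : ∀ j i u n → p ∤ u → suc (u * p ^ suc i) ^ n ≡1[mod p ^ (suc i + j) ] → p ^ j ∣ n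
  lifting-the-exponent zero    i u n p∤u h = 1∣ n
  lifting-the-exponent (suc j) i u n p∤u one = conclude p∣n
    where
    P = p ^ i
    w = u * (p * P)
    p∣n : p ∣ n
    p∣n with r , eq ← binomial₁ w n
        with euclidsLemma n u pr (∣m+n∣m⇒∣n {m = u * w * r} (subst (p ∣_) (+-comm (n * u) (u * w * r)) step₂) step₃)
      where
      step₁ : p ^ suc i * p ^ suc j ∣ p ^ suc i * (n * u + u * w * r)
      step₁ = subst₂ _∣_ (^-distribˡ-+-* p (suc i) (suc j)) (lemma n u (p * P) r)
                (∣-1-mod (subst (_≡1[mod p ^ (suc i + suc j) ]) eq one))
        where
        lemma : ∀ n u Q r → n * (u * Q) + u * Q * (u * Q) * r ≡ Q * (n * u + u * (u * Q) * r)
        lemma = solve-∀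
      step₂ : p ∣ n * u + u * w * r
      step₂ = ∣-trans (m∣m*n (p ^ j)) (*-cancelˡ-∣ (p ^ suc i) {{m^n≢0 p (suc i)}} step₁)
      step₃ : p ∣ u * w * r
      step₃ = ∣m⇒∣m*n r (∣n⇒∣m*n u (∣n⇒∣m*n u (m∣m*n P)))
    ... | inj₁ p∣n = p∣n
    ... | inj₂ p∣u = contradiction p∣u p∤u

    conclude : p ∣ n → p ^ suc j ∣ n
    conclude (divides q refl) with r , eq ← binomial₂ w p =
      subst (_∣ q * p) (*-comm (p ^ j) p) (*-monoˡ-∣ p (lifting-the-exponent j (suc i) u′ q p∤u′ one′))
      where
      rearrange : ∀ p h u P r → p * (u * (p * P)) + p * h * (u * (p * P) * (u * (p * P))) + u * (p * P) * (u * (p * P)) * (u * (p * P)) * r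
             ≡ (u + p * (u * (h * (u * P)) + u * u * u * r * P * P)) * (p * (p * P))
      rearrange = solve-∀
      -- u′ ≡ u modulo p. For i = 0 the square w² is divisible only by p^(i+2), so the quadratic
      -- term needs the extra p of its coefficient p (p - 1) / 2 = p h; this is where p is odd.
      u′ = u + p * (u * (h * (u * P)) + u * u * u * r * P * P)
      p∤u′ : p ∤ u′
      p∤u′ p∣u′ = p∤u (∣m+n∣m⇒∣n {m = p * (u * (h * (u * P)) + u * u * u * r * P * P)} (subst (p ∣_) (+-comm u _) p∣u′) (m∣m*n _))
      zᵖ : suc w ^ p ≡ suc (u′ * p ^ suc (suc i))
      zᵖ = trans eq (cong suc (trans (cong (λ t → p * w + t * (w * w) + w * w * w * r) (trans (cong triangle p≡) (trans (triangle-odd h) (cong (_* h) (sym p≡))))) (rearrange p h u P r)))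
      one′ : suc (u′ * p ^ suc (suc i)) ^ q ≡1[mod p ^ (suc (suc i) + j) ]
      one′ = subst₂ _≡1[mod_] (trans (cong (suc w ^_) (*-comm q p)) (trans (sym (^-*-assoc (suc w) p q)) (cong (_^ q) zᵖ)))
               (cong (p ^_) (+-suc (suc i) j)) one

  -- Uniqueness in Hensel's lemma for z^((p-1)!) - 1: its derivative at y is not divisible by p. So
  -- each nonzero residue modulo p has at most one lift modulo p² in `W p`.
  W-unique : ∀ {y u} → W p y → W p (y + u * p) → p ∤ y → p ∣ u
  W-unique {y} {u} wy wx p∤y with pred p ! in eq!
  ... | zero  = contradiction (subst (p ∣_) (sym eq!) (p ∣0)) (p∤p-1! 1<p)
  ... | suc n with r , eq ← binomial-at y (u * p) n
    with euclidsLemma (suc n * y ^ n) u pr (cancel-p r (1-mod-difference wy (subst (_≡1[mod p * p ]) eq wx)))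
    where
    cancel-p : ∀ r → p * p ∣ suc n * y ^ n * (u * p) + u * p * (u * p) * r → p ∣ suc n * y ^ n * u
    cancel-p r d = *-cancelʳ-∣ p (∣m+n∣m⇒∣n {m = u * u * r * (p * p)} (subst (p * p ∣_) (lemma (suc n * y ^ n) u p r) d) (n∣m*n (u * u * r)))
      where
      lemma : ∀ k u p r → k * (u * p) + u * p * (u * p) * r ≡ u * u * r * (p * p) + k * u * p
      lemma = solve-∀
  ... | inj₂ p∣u = p∣u
  ... | inj₁ p∣ny with euclidsLemma (suc n) (y ^ n) pr p∣ny
  ...   | inj₁ p∣n = contradiction (subst (p ∣_) (sym eq!) p∣n) (p∤p-1! 1<p)
  ...   | inj₂ p∣yⁿ = contradiction p∣yⁿ (λ d → <⇒≢ 2≤p (sym (coprime-^ʳ n (prime∤⇒coprime pr p∤y) (∣-refl , d))))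

  module Base {a : ℕ} (2≤a : 2 ≤ a) (2∣a : 2 ∣ a) (c : Coprime p a) where
    open Tower a 2≤a
    open Even 2∣a

    -- By repeated lifting, 2e pⁱ is a period of a modulo pⁱ⁺¹. Its factors are coprime as 2e < p,
    -- so it divides `δ a k` once each of them does.
    δ-gain : ∀ {j k} i → p < 2 ^ suc j → j ≤ k → p ^ i ∣ δ a k → p ^ suc i ∣ δ a (suc k)
    δ-gain {j} {k} i p< j≤k d with e , 1≤e , e<p , one ← period c =
      ∣δ-suc k (1-mod-^-∣ {k = δ a k}
        (subst (_≡1[mod p ^ suc i ]) (^-*-assoc a (e + e) (p ^ i)) (1-mod-^-prime-power i one))
        (coprime-∣-* (Coprimality.sym (coprime-^ˡ i (Coprimality.prime⇒coprime pr {{>-nonZero (≤-trans 1≤e (m≤m+n e e))}} e<p)))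
          (double∣δ j e k (stable j) 1≤e e<2ʲ j≤k) d))
      where
      e<2ʲ : e < 2 ^ j
      e<2ʲ = *-cancelˡ-< 2 e (2 ^ j) (≤-<-trans (≤-reflexive (cong (e +_) (+-identityʳ e))) (<-trans e<p p<))

    module NonWieferich (a∉W : ¬ W p a) where

      -- The power a^((p-1)!) is 1 + u p, and a ∉ W says exactly that p ∤ u; so lifting the exponent
      -- applies to it with i = 0.
      δ-loss : ∀ k j → p ^ suc j ∣ δ a (suc k) → p ^ j ∣ δ a k
      δ-loss k j d with u , eq ← ^-factorial c =
        lifting-the-exponent j 0 u (δ a k) p∤u
          (subst (λ z → z ^ δ a k ≡1[mod p ^ suc j ]) (trans eq (cong (λ z → suc (u * z)) (sym (*-identityʳ p))))
            (1-mod-^-swap a (δ a k) (pred p !) (∣δ-suc⁻¹ k (coprime-^ˡ (suc j) c) d)))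
        where
        p∤u : p ∤ u
        p∤u (divides v refl) = a∉W (v , trans eq (cong suc (*-assoc v p p)))

      -- At height 0 the difference is a - 1, and p² ∣ a - 1 would put a into W; each storey adds at
      -- most one p. This fixes how many factors p the modulus M must have.
      δ-bound : ∀ k → p ^ suc (suc k) ∤ δ a k
      δ-bound zero    d = a∉W (1-mod-^ (pred p !) (subst₂ _≡1[mod_] a≡ (cong (p *_) (*-identityʳ p)) (1-mod-∣ d)))
        where
        a≡ : suc (δ a 0) ≡ a
        a≡ = trans (tet-δ 0) (*-identityʳ a)
      δ-bound (suc k) d = δ-bound k (δ-loss k (suc (suc k)) d)

    -- The numbers computed for one base, characterised by equations. Dividing H′ by F = gcd (H′, G)
    -- makes the division exact by construction.
    module Ratio {x M k G H′ F H j : ℕ} (p∣x : p ∣ x) (p< : p < 2 ^ suc j) (j≤k : j ≤ k)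
                    (1≤G : 1 ≤ G) (1≤F : 1 ≤ F) (G≡ : G ≡ gcd (δ a k) M)
                    (H′≡ : H′ ≡ gcd (δ a (suc k)) (G * x))
                    (F≡ : F ≡ gcd H′ G) (H*F≡ : H * F ≡ H′) where

      -- If pⁱ exactly divides G, then pⁱ⁺¹ divides H′, because both the difference and the modulus
      -- G x gain a factor. As F divides G, it cannot take all of pⁱ⁺¹, so some p stays in H.
      ratio-∣ : p ∣ H
      ratio-∣ with p ∣? H
      ... | yes p∣H = p∣H
      ... | no  p∤H with i , d , nd ← valuation 2≤p 1≤G = contradiction pⁱ⁺¹∣G nd
        where
        dδ : p ^ suc i ∣ δ a (suc k)
        dδ = δ-gain i p< j≤k (∣-trans d (subst (_∣ δ a k) (sym G≡) (gcd[m,n]∣m (δ a k) M)))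
        dH′ : p ^ suc i ∣ H * F
        dH′ = subst (p ^ suc i ∣_) (sym (trans H*F≡ H′≡))
                (gcd-greatest dδ (subst (_∣ G * x) (*-comm (p ^ i) p) (*-pres-∣ d p∣x)))
        pⁱ⁺¹∣G : p ^ suc i ∣ G
        pⁱ⁺¹∣G = ∣-trans (coprime-divisor (coprime-^ˡ (suc i) (prime∤⇒coprime pr p∤H)) dH′)
                   (subst (_∣ G) (sym F≡) (gcd[m,n]∣n H′ G))

      -- If pⁱ exactly divides F and p² divides H, then pⁱ⁺² divides H′, so pⁱ⁺¹ divides `δ a k`. By
      -- `δ-bound` that power still divides M, hence G, hence F.
      ratio-squarefree : ¬ W p a → p ^ suc k ∣ M → p * p ∤ H
      ratio-squarefree a∉W pᵏ⁺¹∣M p²∣H with i , d , nd ← valuation 2≤p 1≤F =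
        contradiction (subst (p ^ suc i ∣_) (sym F≡)
          (gcd-greatest (∣-trans (^-mono-∣ p (n≤1+n (suc i))) dH′) dG)) nd
        where
        open NonWieferich a∉W
        dH′ : p ^ suc (suc i) ∣ H′
        dH′ = subst₂ _∣_ (*-assoc p p (p ^ i)) H*F≡ (*-pres-∣ p²∣H d)
        dδ : p ^ suc i ∣ δ a k
        dδ = δ-loss k (suc i) (∣-trans dH′ (subst (_∣ δ a (suc k)) (sym H′≡) (gcd[m,n]∣m (δ a (suc k)) (G * x))))
        i≤k : i ≤ k
        i≤k with i ≤? k
        ... | yes i≤k = i≤k
        ... | no  i≰k = contradiction (∣-trans (^-mono-∣ p (s≤s (≰⇒> i≰k))) dδ) (δ-bound k)
        dG : p ^ suc i ∣ G
        dG = subst (p ^ suc i ∣_) (sym G≡) (gcd-greatest dδ (∣-trans (^-mono-∣ p (s≤s i≤k)) pᵏ⁺¹∣M))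

-- A prime is not Wieferich to all small bases

-- pascal k j is the binomial coefficient k + j over k.
pascal : ℕ → ℕ → ℕ
pascal zero    j       = 1
pascal (suc k) zero    = 1
pascal (suc k) (suc j) = pascal k (suc j) + pascal (suc k) j

pascal-pos : ∀ k j → 1 ≤ pascal k j
pascal-pos zero    j       = ≤-refl
pascal-pos (suc k) zero    = ≤-refl
pascal-pos (suc k) (suc j) = ≤-trans (pascal-pos k (suc j)) (m≤m+n _ _)

pascal-zero : ∀ k → pascal k 0 ≡ 1
pascal-zero zero    = refl
pascal-zero (suc k) = refl

pascal-absorb : ∀ k j → suc k * pascal (suc k) j ≡ suc (k + j) * pascal k j ×
                        suc j * pascal k (suc j) ≡ suc (k + j) * pascal k j
pascal-absorb k j = absorbˡ k j , absorbʳ k j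
  where
  open ≡-Reasoning
  absorbˡ : ∀ k j → suc k * pascal (suc k) j ≡ suc (k + j) * pascal k j
  absorbʳ : ∀ k j → suc j * pascal k (suc j) ≡ suc (k + j) * pascal k j
  absorbˡ k zero = cong₂ (λ x y → suc x * y) (sym (+-identityʳ k)) (sym (pascal-zero k))
  absorbˡ k (suc j) = begin
    suc k * (pascal k (suc j) + pascal (suc k) j)             ≡⟨ *-distribˡ-+ (suc k) (pascal k (suc j)) _ ⟩
    suc k * pascal k (suc j) + suc k * pascal (suc k) j       ≡⟨ cong (suc k * pascal k (suc j) +_) (trans (absorbˡ k j) (sym (absorbʳ k j))) ⟩
    suc k * pascal k (suc j) + suc j * pascal k (suc j)       ≡⟨ sym (*-distribʳ-+ (pascal k (suc j)) (suc k) (suc j)) ⟩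
    suc (k + suc j) * pascal k (suc j)                        ∎
  absorbʳ zero    j = refl
  absorbʳ (suc k) j = begin
    suc j * (pascal k (suc j) + pascal (suc k) j)             ≡⟨ *-distribˡ-+ (suc j) (pascal k (suc j)) _ ⟩
    suc j * pascal k (suc j) + suc j * pascal (suc k) j       ≡⟨ cong (_+ suc j * pascal (suc k) j) (trans (absorbʳ k j) (sym (absorbˡ k j))) ⟩
    suc k * pascal (suc k) j + suc j * pascal (suc k) j       ≡⟨ sym (*-distribʳ-+ (pascal (suc k) j) (suc k) (suc j)) ⟩
    suc (k + suc j) * pascal (suc k) j                        ≡⟨ cong (λ z → suc z * pascal (suc k) j) (+-suc k j) ⟩
    suc (suc k + j) * pascal (suc k) j                        ∎

pascal-central : ∀ n → 2 ^ n ≤ pascal n n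
pascal-central zero    = ≤-refl
pascal-central (suc n) = ≤-trans (*-monoʳ-≤ 2 (pascal-central n))
  (subst (_≤ pascal n (suc n) + pascal (suc n) n) (cong (pascal n n +_) (sym (+-identityʳ _))) (+-mono-≤ (mono n n) (mono′ n n)))
  where
  mono : ∀ k j → pascal k j ≤ pascal k (suc j)
  mono zero    j = ≤-refl
  mono (suc k) j = m≤n+m _ _
  mono′ : ∀ k j → pascal k j ≤ pascal (suc k) j
  mono′ k zero    = ≤-reflexive (pascal-zero k)
  mono′ k (suc j) = m≤m+n _ _

-- Leibniz's harmonic triangle: 1 / L(k+1, j) = 1 / L(k, j) - 1 / L(k, j+1) for
-- L(k, j) = (k + j + 1) pascal k j.
leibniz-∣ : ∀ {n M} → (∀ i → 1 ≤ i → i ≤ n → i ∣ M) → ∀ k j → k + j < n → suc (k + j) * pascal k j ∣ M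
leibniz-∣ {M = M} all zero j lt = subst (_∣ M) (sym (*-identityʳ (suc j))) (all (suc j) (s≤s z≤n) lt)
leibniz-∣ {n} {M} all (suc k) j lt
  with divides x M≡x ← leibniz-∣ all k j (<-trans (n<1+n _) lt)
     | s+1∣ ← leibniz-∣ all k (suc j) (subst (_< n) (sym (+-suc k j)) lt) = subst (suc s * R ∣_) (sym M≡R) (*-monoˡ-∣ R dvd)
  where
  open ≡-Reasoning
  s = suc (k + j)
  P = pascal k j
  Q = pascal k (suc j)
  R = pascal (suc k) j
  M≡R : M ≡ x * suc k * R
  M≡R = begin
    M                ≡⟨ M≡x ⟩
    x * (s * P)      ≡⟨ cong (x *_) (sym (proj₁ (pascal-absorb k j))) ⟩
    x * (suc k * R)  ≡⟨ sym (*-assoc x (suc k) R) ⟩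
    x * suc k * R    ∎
  M≡Q : M ≡ x * suc j * Q
  M≡Q = begin
    M                ≡⟨ M≡x ⟩
    x * (s * P)      ≡⟨ cong (x *_) (sym (proj₂ (pascal-absorb k j))) ⟩
    x * (suc j * Q)  ≡⟨ sym (*-assoc x (suc j) Q) ⟩
    x * suc j * Q    ∎
  s+1∣xj : suc s ∣ x * suc j
  s+1∣xj = *-cancelʳ-∣ Q {{>-nonZero (pascal-pos k (suc j))}} (subst₂ _∣_ (cong (λ z → suc z * Q) (+-suc k j)) M≡Q s+1∣)
  -- The harmonic relation after clearing denominators: with M = x s P, the quotient M / R is x (k +
  -- 1) and M / Q is x (j + 1).
  sum : x * suc s ≡ x * suc j + x * suc k
  sum = lemma x k j
    where
    lemma : ∀ x k j → x * suc (suc (k + j)) ≡ x * suc j + x * suc k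
    lemma = solve-∀
  dvd : suc s ∣ x * suc k
  dvd = ∣m+n∣m⇒∣n (subst (suc s ∣_) sum (n∣m*n x)) s+1∣xj

floor-log : ∀ q n → 2 ≤ q → 1 ≤ n → ∃[ e ] q ^ e ≤ n × n < q ^ suc e
floor-log q (suc zero)    2≤q _ = 0 , ≤-refl , subst (1 <_) (sym (*-identityʳ q)) 2≤q
floor-log q (suc (suc n)) 2≤q _ with e , qᵉ≤ , <qᵉ⁺¹ ← floor-log q (suc n) 2≤q (s≤s z≤n) with suc (suc n) <? q ^ suc e
... | yes lt = e , m≤n⇒m≤1+n qᵉ≤ , lt
... | no  ge = suc e , ≮⇒≥ ge , ≤-<-trans <qᵉ⁺¹ (≤-<-trans (≤-reflexive (sym (*-identityˡ _))) (*-monoˡ-< (q ^ suc e) {{>-nonZero (≤-trans (s≤s z≤n) <qᵉ⁺¹)}} 2≤q))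

^-cancelʳ-≤ : ∀ q {i j} → 2 ≤ q → q ^ i < q ^ suc j → i ≤ j
^-cancelʳ-≤ q {i} {j} 2≤q lt with i ≤? j
... | yes i≤j = i≤j
... | no  i≰j = contradiction lt (≤⇒≯ (^-monoʳ-≤ q {{>-nonZero (<⇒≤ 2≤q)}} (≰⇒> i≰j)))

prime-factor : ∀ {n} → 2 ≤ n → ∃[ p ] Prime p × p ∣ n
prime-factor {n} 2≤n with factorise n {{>-nonZero (<⇒≤ 2≤n)}}
... | record { factors = []     ; isFactorisation = refl } = contradiction 2≤n λ { (s≤s ()) }
... | record { factors = p ∷ ps ; isFactorisation = refl ; factorsPrime = pr All.∷ _ } = p , pr , m∣m*n _

-- In `primesUpTo`, `lcm` is the product over the primes q ≤ n of the greatest power of q up to N;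
-- for n = N it is the least common multiple of 1, ..., N. N stays fixed while n recurses, and the
-- bound N on every factor turns the size of `lcm` into a count of primes.
record PrimesUpTo (N n : ℕ) : Set where
  field
    count     : ℕ
    nthPrime  : ℕ → ℕ
    isPrime   : ∀ {i} → i < count → Prime (nthPrime i)
    bounded   : ∀ {i} → i < count → nthPrime i ≤ n
    injective : ∀ {i j} → i < count → j < count → nthPrime i ≡ nthPrime j → i ≡ j
    lcm       : ℕ
    lcm-pos   : 1 ≤ lcm
    lcm-bound : lcm ≤ N ^ count
    lcm-∣     : ∀ {q e} → Prime q → q ≤ n → q ^ e ≤ N → q ^ e ∣ lcm

primesUpTo : ∀ N n → n ≤ N → PrimesUpTo N n
primesUpTo N zero n≤N = record
  { count = 0 ; nthPrime = λ _ → 0 ; isPrime = λ () ; bounded = λ () ; injective = λ ()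
  ; lcm = 1 ; lcm-pos = ≤-refl ; lcm-bound = ≤-refl
  ; lcm-∣ = λ pr q≤0 _ → contradiction (≤-trans (prime≥2 pr) q≤0) λ () }
primesUpTo N (suc n) n<N with primesUpTo N n (<⇒≤ n<N) | prime? (suc n)
... | ps | no ¬pr = record
  { count = count ; nthPrime = nthPrime ; isPrime = isPrime ; bounded = λ i< → m≤n⇒m≤1+n (bounded i<)
  ; injective = injective ; lcm = lcm ; lcm-pos = lcm-pos ; lcm-bound = lcm-bound
  ; lcm-∣ = λ {q} {e} pr q≤ → lcm-∣ {q} {e} pr (s≤s⁻¹ (≤∧≢⇒< q≤ λ { refl → ¬pr pr })) }
  where open PrimesUpTo ps
... | ps | yes pr with e , qᵉ≤N , N<qᵉ⁺¹ ← floor-log (suc n) N (prime≥2 pr) (≤-trans (s≤s z≤n) n<N) = record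
  { count = suc count ; nthPrime = f ; isPrime = f-prime ; bounded = f-bounded ; injective = f-injective
  ; lcm = suc n ^ e * lcm ; lcm-pos = *-mono-≤ (m^n>0 (suc n) e) lcm-pos
  ; lcm-bound = *-mono-≤ qᵉ≤N lcm-bound ; lcm-∣ = λ {q} {e} → dvd {q} {e} }
  where
  open PrimesUpTo ps
  f : ℕ → ℕ
  f zero    = suc n
  f (suc i) = nthPrime i
  f-prime : ∀ {i} → i < suc count → Prime (f i)
  f-prime {zero}  _        = pr
  f-prime {suc i} (s≤s i<) = isPrime i<
  f-bounded : ∀ {i} → i < suc count → f i ≤ suc n
  f-bounded {zero}  _        = ≤-refl
  f-bounded {suc i} (s≤s i<) = m≤n⇒m≤1+n (bounded i<)
  f-injective : ∀ {i j} → i < suc count → j < suc count → f i ≡ f j → i ≡ j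
  f-injective {zero}  {zero}  _        _        _  = refl
  f-injective {zero}  {suc j} _        (s≤s j<) eq = contradiction (bounded j<) (<⇒≱ (≤-reflexive eq))
  f-injective {suc i} {zero}  (s≤s i<) _        eq = contradiction (bounded i<) (<⇒≱ (≤-reflexive (sym eq)))
  f-injective {suc i} {suc j} (s≤s i<) (s≤s j<) eq = cong suc (injective i< j< eq)
  dvd : ∀ {q e′} → Prime q → q ≤ suc n → q ^ e′ ≤ N → q ^ e′ ∣ suc n ^ e * lcm
  dvd {q} {e′} prq q≤ le with q ≟ suc n
  ... | yes refl = ∣m⇒∣m*n lcm (^-mono-∣ q (^-cancelʳ-≤ q {e′} {e} (prime≥2 pr) (≤-<-trans le N<qᵉ⁺¹)))
  ... | no  q≢   = ∣n⇒∣m*n (suc n ^ e) (lcm-∣ {e = e′} prq (s≤s⁻¹ (≤∧≢⇒< q≤ q≢)) le)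

module _ {N : ℕ} (ps : PrimesUpTo N N) where
  open PrimesUpTo ps

  ∣lcm : ∀ i → 1 ≤ i → i ≤ N → i ∣ lcm
  ∣lcm = <-rec _ go
    where
    go : ∀ i → (∀ {j} → j < i → 1 ≤ j → j ≤ N → j ∣ lcm) → 1 ≤ i → i ≤ N → i ∣ lcm
    go (suc zero)      rec _ _ = 1∣ lcm
    go i@(suc (suc _)) rec 1≤i i≤N
      with q , pr , q∣i ← prime-factor {i} (s≤s (s≤s z≤n))
      with e , d@(divides t i≡) , nd ← valuation (prime≥2 pr) 1≤i
      = subst (_∣ lcm) (trans (*-comm (q ^ e) t) (sym i≡))
          (coprime-∣-* (coprime-^ˡ e (prime∤⇒coprime pr q∤t))
             (lcm-∣ {e = e} pr (≤-trans (∣⇒≤ q∣i) i≤N) (≤-trans (∣⇒≤ d) i≤N))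
             (rec t<i 1≤t (≤-trans (<⇒≤ t<i) i≤N)))
      where
      q∤t : q ∤ t
      q∤t q∣t = nd (subst (q ^ suc e ∣_) (sym i≡) (*-monoˡ-∣ (q ^ e) q∣t))
      1≤t : 1 ≤ t
      1≤t = n≢0⇒n>0 λ { refl → q∤t (q ∣0) }
      1<qᵉ : 1 < q ^ e
      1<qᵉ = ≤∧≢⇒< (m^n>0 q {{>-nonZero (<⇒≤ (prime≥2 pr))}} e)
               λ 1≡qᵉ → nd (subst (_∣ i) (trans (sym (*-identityʳ q)) (cong (q *_) 1≡qᵉ)) q∣i)
      t<i : t < i
      t<i = subst (t <_) (sym i≡) (subst (_< t * q ^ e) (*-identityʳ t) (*-monoʳ-< t {{>-nonZero 1≤t}} 1<qᵉ))

-- Nair's method: the harmonic triangle entry (2n + 1) times the central binomial coefficient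
-- divides the least common multiple of 1, ..., 2n + 2.
chebyshev : ∀ {n} → 1 ≤ n → (ps : PrimesUpTo (2 * suc n) (2 * suc n)) → 2 ^ suc n ≤ (2 * suc n) ^ PrimesUpTo.count ps
chebyshev {n} 1≤n ps = begin
  2 * 2 ^ n                    ≤⟨ *-mono-≤ (s≤s (≤-trans 1≤n (m≤m+n n n))) (pascal-central n) ⟩
  suc (n + n) * pascal n n     ≤⟨ ∣⇒≤ {{>-nonZero lcm-pos}} (leibniz-∣ (∣lcm ps) n n lt) ⟩
  lcm                          ≤⟨ lcm-bound ⟩
  (2 * suc n) ^ count          ∎
  where
  open PrimesUpTo ps
  open ≤-Reasoning
  lt : n + n < 2 * suc n
  lt = s≤s (+-monoʳ-≤ n (≤-trans (n≤1+n n) (m≤m+n (suc n) 0)))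

1-mod-cancel : ∀ {n x y} → x ≡1[mod n ] → x * y ≡1[mod n ] → y ≡1[mod n ]
1-mod-cancel {n} {x} {zero}  _        (v , eq) = contradiction (trans (sym (*-zeroʳ x)) eq) λ ()
1-mod-cancel {n} {x} {suc y} (u , refl) (v , eq) =
  1-mod-∣ (∣m+n∣m⇒∣n {m = u * suc y * n} (divides v (trans (lemma u n y) (suc-injective eq))) (n∣m*n (u * suc y)))
  where
  lemma : ∀ u n y → u * suc y * n + y ≡ y + u * n * suc y
  lemma = solve-∀

-- With a = 2 this passes from the even bases that are tested to all bases.
W-cancel : ∀ {p a b} → W p a → W p (a * b) → W p b
W-cancel {p} {a} {b} wa wab = 1-mod-cancel wa (subst (_≡1[mod p * p ]) (^-distribʳ-* (pred p !) a b) wab)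

-- Products of k primes, the i-th chosen among the i-th block of m primes by the i-th
-- base m digit of c.
module Selection (f : ℕ → ℕ) (m : ℕ) {{_ : NonZero m}} where

  select : ℕ → ℕ → ℕ
  select zero    c = 1
  select (suc k) c = f (k * m + c % m) * select k (c / m)

  index< : ∀ k c → k * m + c % m < suc k * m
  index< k c = subst (k * m + c % m <_) (+-comm (k * m) m) (+-monoʳ-< (k * m) (m%n<n c m))

  select-elim : (P : ℕ → Set) → P 1 → (∀ {x y} → P x → P y → P (x * y)) →
                ∀ k c → (∀ {i} → i < k * m → P (f i)) → P (select k c)
  select-elim P P1 P* zero    c Pf = P1
  select-elim P P1 P* (suc k) c Pf = P* (Pf (index< k c)) (select-elim P P1 P* k (c / m) λ i< → Pf (≤-trans i< (m≤n+m (k * m) m)))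

  select-≤ : ∀ {B} k c → (∀ {i} → i < k * m → f i ≤ B) → select k c ≤ B ^ k
  select-≤ zero    c f≤ = ≤-refl
  select-≤ (suc k) c f≤ = *-mono-≤ (f≤ (index< k c)) (select-≤ k (c / m) λ i< → f≤ (≤-trans i< (m≤n+m (k * m) m)))

  select-injective : ∀ k c c′ → (∀ {i} → i < k * m → Prime (f i)) →
                     (∀ {i j} → i < k * m → j < k * m → f i ≡ f j → i ≡ j) →
                     c < m ^ k → c′ < m ^ k → select k c ≡ select k c′ → c ≡ c′
  select-injective zero    zero zero _ _ _ _ _ = refl
  select-injective zero    (suc c) _ _ _ (s≤s ()) _ _
  select-injective zero    zero (suc c′) _ _ _ (s≤s ()) _
  select-injective (suc k) c c′ pr inj c< c′< eq = begin
    c                    ≡⟨ m≡m%n+[m/n]*n c m ⟩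
    c % m + c / m * m    ≡⟨ cong₂ (λ x y → x + y * m) digit rest ⟩
    c′ % m + c′ / m * m  ≡⟨ sym (m≡m%n+[m/n]*n c′ m) ⟩
    c′                   ∎
    where
    open ≡-Reasoning
    weaken : ∀ {i} → i < k * m → i < suc k * m
    weaken i< = ≤-trans i< (m≤n+m (k * m) m)
    i = k * m + c % m
    i′ = k * m + c′ % m
    q = f i
    prq = pr (index< k c)
    -- The other factors are primes from lower blocks, all different from q. Applied to c′, this
    -- forces q to be the factor of the other product from the same block.
    q∤rest : ∀ k′ c → k′ ≤ k → q ∤ select k′ c
    q∤rest zero     c _    q∣ = <⇒≢ (prime≥2 prq) (sym (∣1⇒≡1 q∣))
    q∤rest (suc k′) c k′<k q∣ with euclidsLemma (f (k′ * m + c % m)) _ prq q∣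
    ... | inj₂ q∣rest = q∤rest k′ (c / m) (<⇒≤ k′<k) q∣rest
    ... | inj₁ q∣f = <⇒≢ (<-≤-trans j< (m≤m+n (k * m) _)) (sym (inj (index< k _) (weaken j<) q≡))
      where
      j< : k′ * m + c % m < k * m
      j< = <-≤-trans (index< k′ c) (*-monoˡ-≤ m k′<k)
      q≡ : q ≡ f (k′ * m + c % m)
      q≡ with prime⇒irreducible (pr (weaken j<)) q∣f
      ... | inj₁ q≡1 = contradiction (sym q≡1) (<⇒≢ (prime≥2 prq))
      ... | inj₂ eq  = eq
    fi≡ : f i ≡ f i′
    fi≡ with euclidsLemma (f i′) _ prq (subst (q ∣_) eq (m∣m*n _))
    ... | inj₂ q∣rest = contradiction q∣rest (q∤rest k (c′ / m) ≤-refl)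
    ... | inj₁ q∣f with prime⇒irreducible (pr (index< k c′)) q∣f
    ...   | inj₁ q≡1 = contradiction (sym q≡1) (<⇒≢ (prime≥2 prq))
    ...   | inj₂ eq′ = eq′
    digit : c % m ≡ c′ % m
    digit = +-cancelˡ-≡ (k * m) _ _ (inj (index< k c) (index< k c′) fi≡)
    rest : c / m ≡ c′ / m
    rest = select-injective k (c / m) (c′ / m) (λ i< → pr (weaken i<)) (λ i< j< → inj (weaken i<) (weaken j<))
             (m<n*o⇒m/o<n (subst (c <_) (*-comm m (m ^ k)) c<)) (m<n*o⇒m/o<n (subst (c′ <_) (*-comm m (m ^ k)) c′<))
             (*-cancelˡ-≡ _ _ q {{prime⇒nonZero prq}} (trans eq (cong (_* select k (c′ / m)) (sym fi≡))))

square-cancel-≤ : ∀ {m n} → m * m ≤ n * n → m ≤ n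
square-cancel-≤ {m} {n} le with m ≤? n
... | yes m≤n = m≤n
... | no  m≰n = contradiction le (<⇒≱ (*-mono-< (≰⇒> m≰n) (≰⇒> m≰n)))

-- All products of at most k small numbers lie in W p; as those below p² are pairwise
-- incongruent modulo p, there are fewer than p of them.
W-few-products : ∀ {p h B k m} → Prime p → p ≡ suc (h + h) → (f : ℕ → ℕ) →
                 (∀ {i} → i < k * m → Prime (f i)) → (∀ {i} → i < k * m → f i ≤ B) →
                 (∀ {i j} → i < k * m → j < k * m → f i ≡ f j → i ≡ j) →
                 B < p → B ^ k < p * p → (∀ d → 1 ≤ d → d ≤ B → W p d) → p ≰ m ^ k
W-few-products {k = zero}  {m = zero}  pr p≡ f _ _ _ _ _ _ p≤1 = <⇒≱ (prime≥2 pr) p≤1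
W-few-products {k = suc k} {m = zero}  pr p≡ f _ _ _ _ _ _ p≤0 = <⇒≱ (<⇒≤ (prime≥2 pr)) p≤0
W-few-products {zero} {m = suc m′} pr = contradiction pr ¬prime[0]
W-few-products {p@(suc p₀)} {h} {B} {k} {m@(suc _)} pr p≡ f f-prime f≤B f-inj B<p Bᵏ<p² all-W p≤mᵏ =
  let i , j , i<j , eq = Fin.pigeonhole (n<1+n p₀) class in
  <⇒≢ i<j (select-injective k (Fin.toℕ i) (Fin.toℕ j) f-prime f-inj (toℕ<mᵏ i) (toℕ<mᵏ j) (class-inj i j eq))
  where
  open OddPrime pr {h} p≡ hiding (2≤p)
  open Selection f m

  S : ℕ → ℕ
  S c = select k c

  toℕ<mᵏ : (i : Fin p) → Fin.toℕ i < m ^ k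
  toℕ<mᵏ i = <-≤-trans (Fin.toℕ<n i) p≤mᵏ

  1≤f : ∀ {i} → i < k * m → 1 ≤ f i
  1≤f i< = <⇒≤ (prime≥2 (f-prime i<))

  S-W : ∀ c → W p (S c)
  S-W c = select-elim (W p) (1-mod-^ (pred p !) (0 , refl)) (λ {x} {y} → W-* {p} {x} {y}) k c λ i< → all-W _ (1≤f i<) (f≤B i<)

  S-coprime : ∀ c → p ∤ S c
  S-coprime c = select-elim (p ∤_) (λ p∣1 → <⇒≢ (prime≥2 pr) (sym (∣1⇒≡1 p∣1)))
    (λ p∤x p∤y p∣xy → [ p∤x , p∤y ]′ (euclidsLemma _ _ pr p∣xy)) k c
    λ i< → >⇒∤ {{>-nonZero (1≤f i<)}} (≤-<-trans (f≤B i<) B<p)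

  S< : ∀ c → S c < p * p
  S< c = ≤-<-trans (select-≤ k c f≤B) Bᵏ<p²

  residue : ℕ → ℕ
  residue c = S c % p

  residue≢0 : ∀ c → residue c ≢ 0
  residue≢0 c r≡0 = S-coprime c (m%n≡0⇒n∣m (S c) p r≡0)

  pred-residue< : ∀ c → pred (residue c) < p₀
  pred-residue< c with residue c in eq | m%n<n (S c) p
  ... | zero  | _      = contradiction eq (residue≢0 c)
  ... | suc r | s≤s r< = r<

  class : Fin p → Fin p₀
  class i = Fin.fromℕ< (pred-residue< (Fin.toℕ i))

  -- The difference of x and y is u p; by `W-unique` p divides u, and a nonzero multiple of p² would
  -- exceed y.
  lift : ∀ x y → x ≤ y → W p x → W p y → p ∤ x → y < p * p → x % p ≡ y % p → x ≡ y
  lift x y x≤y wx wy p∤x y< eq = go (proj₁ congruent) (proj₂ congruent)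
    where
    congruent : ∃[ u ] y ≡ x + u * p
    congruent = y / p ∸ x / p , (begin
      y                                          ≡⟨ m≡m%n+[m/n]*n y p ⟩
      y % p + y / p * p                          ≡⟨ cong₂ (λ r q → r + q * p) (sym eq) (sym (m+[n∸m]≡n (/-monoˡ-≤ p x≤y))) ⟩
      x % p + (x / p + (y / p ∸ x / p)) * p      ≡⟨ lemma (x % p) (x / p) (y / p ∸ x / p) p ⟩
      x % p + x / p * p + (y / p ∸ x / p) * p    ≡⟨ cong (_+ (y / p ∸ x / p) * p) (sym (m≡m%n+[m/n]*n x p)) ⟩
      x + (y / p ∸ x / p) * p                    ∎)
      where
      open ≡-Reasoning
      lemma : ∀ r q u n → r + (q + u) * n ≡ r + q * n + u * n
      lemma = solve-∀
    go : ∀ u → y ≡ x + u * p → x ≡ y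
    go u y≡ with W-unique {x} {u} wx (subst (W p) y≡ wy) p∤x
    ... | divides zero    refl = sym (trans y≡ (+-identityʳ x))
    ... | divides (suc v) refl = contradiction y< (≤⇒≯ (begin
      p * p                  ≤⟨ *-monoˡ-≤ p (m≤m+n p (v * p)) ⟩
      suc v * p * p          ≤⟨ m≤n+m _ x ⟩
      x + suc v * p * p      ≡⟨ sym y≡ ⟩
      y                      ∎))
      where open ≤-Reasoning

  class-inj : ∀ i j → class i ≡ class j → S (Fin.toℕ i) ≡ S (Fin.toℕ j)
  class-inj i j eq = by-order (≤-total (S c) (S c′))
    where
    c  = Fin.toℕ i
    c′ = Fin.toℕ j
    same : residue c ≡ residue c′
    same = pred-injective {{≢-nonZero (residue≢0 c)}} {{≢-nonZero (residue≢0 c′)}} (Fin.fromℕ<-injective _ _ (pred-residue< c) (pred-residue< c′) eq)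
    by-order : S c ≤ S c′ ⊎ S c′ ≤ S c → S c ≡ S c′
    by-order (inj₁ le) = lift _ _ le (S-W c) (S-W c′) (S-coprime c) (S< c′) same
    by-order (inj₂ le) = sym (lift _ _ le (S-W c′) (S-W c) (S-coprime c′) (S< c) (sym same))

-- Take B = 2^(4s), k greatest with Bᵏ < p², and blocks of m = 2^(3s) primes. Chebyshev gives at
-- least B / (8s) primes up to B, enough for k blocks since 4sk < ℓ and 2ℓ ≤ 2ˢ. Since B < p, k ≥ 2;
-- hence 6k ≥ 4(k + 1), so m^(2k) ≥ B^(k+1) ≥ p², that is, mᵏ ≥ p.
not-all-W : ∀ {p h ℓ s} → Prime p → p ≡ suc (h + h) → p * p < 2 ^ ℓ → 1 ≤ s → 2 * ℓ ≤ 2 ^ s →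
            2 ^ (4 * s) < p → ¬ (∀ d → 1 ≤ d → d ≤ 2 ^ (4 * s) → W p d)
not-all-W {p} {h} {ℓ} {s@(suc s₀)} pr p≡ p²<2^ℓ 1≤s 2ℓ≤ B<p all-W =
  W-few-products {p} {h} {B} {k} {m} pr p≡ nthPrime (λ i< → isPrime (≤-trans i< km≤)) (λ i< → bounded (≤-trans i< km≤))
    (λ i< j< → injective (≤-trans i< km≤) (≤-trans j< km≤)) B<p Bᵏ<p² all-W p≤mᵏ
  where
  open ≤-Reasoning
  B = 2 ^ (4 * s)
  -- Half of B, written so that `2 * half` and B agree by computation.
  half = 2 ^ (s₀ + 3 * s)
  m = 2 ^ (3 * s)

  2≤p = prime≥2 pr

  2≤B : 2 ≤ B
  2≤B = *-monoʳ-≤ 2 (m^n>0 2 (s₀ + 3 * s))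

  2≤half : 2 ≤ half
  2≤half = subst (λ z → 2 ≤ 2 ^ z) (sym (+-suc s₀ (s₀ + 2 * s))) (*-monoʳ-≤ 2 (m^n>0 2 (s₀ + (s₀ + 2 * s))))

  ps : PrimesUpTo B B
  ps = primesUpTo B B ≤-refl
  open PrimesUpTo ps

  cheb : half ≤ 4 * s * count
  cheb = ^-cancel (subst (2 ^ half ≤_) (^-*-assoc 2 (4 * s) count) (lemma half 2≤half ps))
    where
    lemma : ∀ m → 2 ≤ m → (ps : PrimesUpTo (2 * m) (2 * m)) → 2 ^ m ≤ (2 * m) ^ PrimesUpTo.count ps
    lemma (suc m) (s≤s 1≤m) ps = chebyshev 1≤m ps
    ^-cancel : ∀ {i j} → 2 ^ i ≤ 2 ^ j → i ≤ j
    ^-cancel {i} {j} le = ^-cancelʳ-≤ 2 ≤-refl (≤-<-trans le (^-monoʳ-< 2 ≤-refl (n<1+n j)))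

  log : ∃[ k ] B ^ k ≤ pred (p * p) × pred (p * p) < B ^ suc k
  log = floor-log B (pred (p * p)) 2≤B (pred-mono-≤ (≤-trans 2≤p (m≤m*n p p {{prime⇒nonZero pr}})))
  k = proj₁ log

  p²≢0 : NonZero (p * p)
  p²≢0 = m*n≢0 p p {{prime⇒nonZero pr}} {{prime⇒nonZero pr}}

  Bᵏ<p² : B ^ k < p * p
  Bᵏ<p² = subst (B ^ k <_) (suc-pred (p * p) {{p²≢0}}) (s≤s (proj₁ (proj₂ log)))

  p²≤Bᵏ⁺¹ : p * p ≤ B ^ suc k
  p²≤Bᵏ⁺¹ = subst (_≤ B ^ suc k) (suc-pred (p * p) {{p²≢0}}) (proj₂ (proj₂ log))

  2≤k : 2 ≤ k
  2≤k with 2 ≤? k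
  ... | yes 2≤k = 2≤k
  ... | no  2≰k = contradiction p²≤Bᵏ⁺¹ (<⇒≱ (begin-strict
    B ^ suc k   ≤⟨ ^-monoʳ-≤ B {{>-nonZero (<⇒≤ 2≤B)}} (≰⇒> 2≰k) ⟩
    B ^ 2       ≡⟨ cong (B *_) (*-identityʳ B) ⟩
    B * B       <⟨ *-mono-< B<p B<p ⟩
    p * p       ∎))

  p≤mᵏ : p ≤ m ^ k
  p≤mᵏ = square-cancel-≤ (begin
    p * p                              ≤⟨ p²≤Bᵏ⁺¹ ⟩
    B ^ suc k                          ≡⟨ ^-*-assoc 2 (4 * s) (suc k) ⟩
    2 ^ (4 * s * suc k)                ≤⟨ ^-monoʳ-≤ 2 exps ⟩
    2 ^ (3 * s * k + 3 * s * k)        ≡⟨ ^-distribˡ-+-* 2 (3 * s * k) (3 * s * k) ⟩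
    2 ^ (3 * s * k) * 2 ^ (3 * s * k)  ≡⟨ cong (λ z → z * z) (sym (^-*-assoc 2 (3 * s) k)) ⟩
    m ^ k * m ^ k                      ∎)
    where
    e₁ : ∀ s k → 4 * s * suc k ≡ 4 * s * k + 2 * s * 2
    e₁ = solve-∀
    e₂ : ∀ s k → 4 * s * k + 2 * s * k ≡ 3 * s * k + 3 * s * k
    e₂ = solve-∀
    exps : 4 * s * suc k ≤ 3 * s * k + 3 * s * k
    exps = begin
      4 * s * suc k           ≡⟨ e₁ s k ⟩
      4 * s * k + 2 * s * 2   ≤⟨ +-monoʳ-≤ (4 * s * k) (*-monoʳ-≤ (2 * s) 2≤k) ⟩
      4 * s * k + 2 * s * k   ≡⟨ e₂ s k ⟩
      3 * s * k + 3 * s * k   ∎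

  4sk<ℓ : 4 * s * k < ℓ
  4sk<ℓ with 4 * s * k <? ℓ
  ... | yes lt = lt
  ... | no  ge = contradiction (<-trans Bᵏ<p² p²<2^ℓ)
                   (≤⇒≯ (subst (2 ^ ℓ ≤_) (sym (^-*-assoc 2 (4 * s) k)) (^-monoʳ-≤ 2 (≮⇒≥ ge))))

  km≤ : k * m ≤ count
  km≤ = *-cancelˡ-≤ (4 * s) (begin
    4 * s * (k * m)  ≡⟨ sym (*-assoc (4 * s) k m) ⟩
    4 * s * k * m    ≤⟨ *-monoˡ-≤ m (<⇒≤ 4sk<ℓ) ⟩
    ℓ * m            ≤⟨ ℓm≤half ⟩
    half             ≤⟨ cheb ⟩
    4 * s * count    ∎)
    where
    ℓm≤half : ℓ * m ≤ half
    ℓm≤half = *-cancelˡ-≤ 2 (begin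
      2 * (ℓ * m)      ≡⟨ sym (*-assoc 2 ℓ m) ⟩
      2 * ℓ * m        ≤⟨ *-monoˡ-≤ m 2ℓ≤ ⟩
      2 ^ s * m        ≡⟨ sym (^-distribˡ-+-* 2 s (3 * s)) ⟩
      2 * half         ∎)

-- A structured language compiled to the register machine

bitlen-half : ∀ n → bitlen (suc n) ≡ suc (bitlen (suc n / 2))
bitlen-half n = begin
  ⌈log₂ 2 + n ⌉                     ≡⟨⟩
  suc (⌈log₂ 2 + n ⌉ ∸ 1)           ≡⟨ cong suc (sym (⌈log₂⌈n/2⌉⌉≡⌈log₂n⌉∸1 (2 + n))) ⟩
  suc ⌈log₂ ⌈ 2 + n /2⌉ ⌉           ≡⟨ cong (λ z → suc ⌈log₂ suc z ⌉) (half (suc n)) ⟩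
  suc (bitlen (suc n / 2))          ∎
  where
  open ≡-Reasoning
  half : ∀ n → ⌊ n /2⌋ ≡ n / 2
  half zero          = refl
  half (suc zero)    = refl
  half (suc (suc n)) = trans (cong suc (half n)) (sym (+-distrib-/-∣ˡ {2} n {2} ∣-refl))

bitlen≡0 : ∀ n → bitlen n ≡ 0 → n ≡ 0
bitlen≡0 zero    _  = refl
bitlen≡0 (suc n) eq = contradiction (trans (sym (bitlen-half n)) eq) λ ()

bitlen≡suc : ∀ n {k} → bitlen n ≡ suc k → ∃[ v ] n ≡ suc v
bitlen≡suc (suc v) _ = v , refl

-- The step of every loop: halving the counter shortens it by exactly one bit, so a loop makes as
-- many rounds as its counter has bits.
bitlen-halve : ∀ v {w n} → w ≡ v / 2 → bitlen v ≡ suc n → bitlen w ≡ n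
bitlen-halve v w≡ len with u , refl ← bitlen≡suc v len =
  trans (cong bitlen w≡) (suc-injective (trans (sym (bitlen-half u)) len))

n<2^bitlen : ∀ n → n < 2 ^ bitlen n
n<2^bitlen = <-rec _ go
  where
  go : ∀ n → (∀ {m} → m < n → m < 2 ^ bitlen m) → n < 2 ^ bitlen n
  go zero    rec = s≤s z≤n
  go (suc n) rec = subst (λ b → suc n < 2 ^ b) (sym (bitlen-half n)) (begin-strict
    suc n                              ≡⟨ m≡m%n+[m/n]*n (suc n) 2 ⟩
    suc n % 2 + suc n / 2 * 2          <⟨ +-monoˡ-< (suc n / 2 * 2) (m%n<n (suc n) 2) ⟩
    2 + suc n / 2 * 2                  ≤⟨ *-monoˡ-≤ 2 (rec (m/n<m (suc n) 2 ≤-refl)) ⟩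
    2 ^ bitlen (suc n / 2) * 2         ≡⟨ *-comm (2 ^ bitlen (suc n / 2)) 2 ⟩
    2 ^ suc (bitlen (suc n / 2))       ∎)
    where open ≤-Reasoning

bitlen-upper : ∀ {n k} → n < 2 ^ k → bitlen n ≤ k
bitlen-upper {n} {k} lt = subst (bitlen n ≤_) (⌈log₂2^n⌉≡n k) (⌈log₂⌉-mono-≤ lt)

bitlen-lower : ∀ {n k} → 2 ^ k ≤ n → k < bitlen n
bitlen-lower {n} {k} le with k <? bitlen n
... | yes lt = lt
... | no  ge = contradiction (<-≤-trans (n<2^bitlen n) (^-monoʳ-≤ 2 (≮⇒≥ ge))) (≤⇒≯ le)

Regs : Set
Regs = Reg → ℕ

data Expr : Set where
  num             : ℕ → Expr
  _⊕_ _⊖_ _⊗_ _⊘_ _⊛_ : Reg → Reg → Expr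
  tower           : Reg → Reg → Reg → Expr

infix 6 _⊕_ _⊖_ _⊗_ _⊘_ _⊛_

-- loop r c runs c once for every bit of r, halving r before each run.
data Cmd : Set where
  _≔_  : Reg → Expr → Cmd
  _⨾_  : Cmd → Cmd → Cmd
  loop : Reg → Cmd → Cmd

infix  5 _≔_
infixr 4 _⨾_

⟦_⟧ : Expr → Regs → ℕ
⟦ num n ⟧       ρ = n
⟦ s ⊕ t ⟧       ρ = ρ s + ρ t
⟦ s ⊖ t ⟧       ρ = ρ s ∸ ρ t
⟦ s ⊗ t ⟧       ρ = ρ s * ρ t
⟦ s ⊘ t ⟧       ρ = div0 (ρ s) (ρ t)
⟦ s ⊛ t ⟧       ρ = mod0 (ρ s) (ρ t)
⟦ tower a k n ⟧ ρ = mtp (ρ a) (ρ k) (ρ n)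

two : Reg
two = 1

-- The effect of the loop header, spelled out as the two compiled instructions perform it, including
-- the case that reads registers after `two` is set.
enter : Reg → Regs → Regs
enter r ρ = set (set ρ two 2) r (div0 (set ρ two 2 r) (set ρ two 2 two))

repeat : (Regs → Regs) → ℕ → Regs → Regs
repeat f zero    ρ = ρ
repeat f (suc n) ρ = repeat f n (f ρ)

exec : Cmd → Regs → Regs
exec (r ≔ e)    ρ = set ρ r (⟦ e ⟧ ρ)
exec (c ⨾ d)    ρ = exec d (exec c ρ)
exec (loop r c) ρ = repeat (λ ρ → exec c (enter r ρ)) (bitlen (ρ r)) ρ

instr : Reg → Expr → Instr
instr r (num n)       = const r n
instr r (s ⊕ t)       = add r s t
instr r (s ⊖ t)       = sub r s t
instr r (s ⊗ t)       = mul r s t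
instr r (s ⊘ t)       = div r s t
instr r (s ⊛ t)       = mod r s t
instr r (tower a k n) = oracle r a k n

size : Cmd → ℕ
size (r ≔ e)    = 1
size (c ⨾ d)    = size c + size d
size (loop r c) = 4 + size c

compile : Cmd → Label → Program
compile (r ≔ e)    o = instr r e ∷ []
compile (c ⨾ d)    o = compile c o ++ compile d (o + size c)
compile (loop r c) o = jz r (o + (4 + size c)) ∷ const two 2 ∷ div r r two ∷ (compile c (3 + o) ++ jmp o ∷ [])

writes : Cmd → Reg → Bool
writes (r ≔ e)    i = i ≡ᵇ r
writes (c ⨾ d)    i = writes c i ∨ writes d i
writes (loop r c) i = (i ≡ᵇ two) ∨ (i ≡ᵇ r) ∨ writes c i

-- `exec` fixes the number of rounds on entry, whereas compiled code tests the counter in each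
-- round; they agree when the body leaves the counter alone. Constants below 4 fit every width S ≥
-- 2. Being Boolean, the condition is checked for the concrete program by `refl`.
wellFormed : Cmd → Bool
wellFormed (r ≔ num n) = n <ᵇ 4
wellFormed (r ≔ _)     = true
wellFormed (c ⨾ d)     = wellFormed c ∧ wellFormed d
wellFormed (loop r c)  = not (r ≡ᵇ two) ∧ not (writes c r) ∧ wellFormed c

∧-split : ∀ {a b} → a ∧ b ≡ true → a ≡ true × b ≡ true
∧-split {true} {true} _ = refl , refl

∨-split : ∀ {a b} → a ∨ b ≡ false → a ≡ false × b ≡ false
∨-split {false} {false} _ = refl , refl

not-false : ∀ {a} → not a ≡ true → a ≡ false
not-false {false} _ = refl

set-≢ : ∀ ρ r v {i} → (i ≡ᵇ r) ≡ false → set ρ r v i ≡ ρ i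
set-≢ ρ r v h rewrite h = refl

≡ᵇ-refl : ∀ n → (n ≡ᵇ n) ≡ true
≡ᵇ-refl zero    = refl
≡ᵇ-refl (suc n) = ≡ᵇ-refl n

set-≡ : ∀ ρ r v → set ρ r v r ≡ v
set-≡ ρ r v rewrite ≡ᵇ-refl r = refl

repeat-preserves : ∀ {f : Regs → Regs} {i} → (∀ ρ → f ρ i ≡ ρ i) → ∀ n ρ → repeat f n ρ i ≡ ρ i
repeat-preserves h zero    ρ = refl
repeat-preserves h (suc n) ρ = trans (repeat-preserves h n _) (h ρ)

enter-≢ : ∀ r ρ {i} → (i ≡ᵇ two) ≡ false → (i ≡ᵇ r) ≡ false → enter r ρ i ≡ ρ i
enter-≢ r ρ {i} i≢two i≢r = trans (set-≢ (set ρ two 2) r _ {i} i≢r) (set-≢ ρ two 2 {i} i≢two)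

-- Since `writes` computes, its premise for concrete commands and registers is just `refl`.
frame : ∀ c ρ {i} → writes c i ≡ false → exec c ρ i ≡ ρ i
frame (r ≔ e)    ρ {i} h = set-≢ ρ r (⟦ e ⟧ ρ) {i} h
frame (c ⨾ d)    ρ {i} h with hc , hd ← ∨-split {writes c i} h = trans (frame d (exec c ρ) hd) (frame c ρ hc)
frame (loop r c) ρ {i} h with h₁ , h₂ ← ∨-split {i ≡ᵇ two} h with h₂ , h₃ ← ∨-split {i ≡ᵇ r} h₂ =
  repeat-preserves (λ ρ → trans (frame c (enter r ρ) h₃) (enter-≢ r ρ {i} h₁ h₂)) (bitlen (ρ r)) ρ

-- Execution without fuel, which composes by concatenation; the fuel is recovered at the end from
-- the number of steps.
data Steps (P : Program) : State → State → ℕ → Set where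
  done : ∀ {s} → Steps P s s 0
  next : ∀ {s s′ s″ c c′} → step P s ≡ just (s′ , c) → Steps P s′ s″ c′ → Steps P s s″ (c + c′)

Steps-trans : ∀ {P s s′ s″ c c′} → Steps P s s′ c → Steps P s′ s″ c′ → Steps P s s″ (c + c′)
Steps-trans done t = t
Steps-trans {P} {s} {s″ = s″} (next {c = c₁} {c₂} eq u) t =
  subst (Steps P s s″) (sym (+-assoc c₁ c₂ _)) (next eq (Steps-trans u t))

run-halted : ∀ P s → step P s ≡ nothing → run 0 P s ≡ just (s , 0)
run-halted P s eq rewrite eq = refl

run-next : ∀ P s {s′ s″ c c′} t → step P s ≡ just (s′ , c) → run t P s′ ≡ just (s″ , c′) →
           run (suc t) P s ≡ just (s″ , c + c′)
run-next P s t eq run≡ rewrite eq | run≡ = refl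

Steps-run : ∀ {P s s′ c} → Steps P s s′ c → step P s′ ≡ nothing → ∃[ t ] run t P s ≡ just (s′ , c)
Steps-run {P} {s} done halted = 0 , run-halted P s halted
Steps-run {P} {s} (next eq u) halted with t , run≡ ← Steps-run u halted = suc t , run-next P s t eq run≡

CodeAt : Program → Label → Program → Set
CodeAt P o []      = ⊤
CodeAt P o (x ∷ C) = nth P o ≡ just x × CodeAt P (suc o) C

CodeAt-++ : ∀ {P} o C D → CodeAt P o (C ++ D) → CodeAt P o C × CodeAt P (o + length C) D
CodeAt-++ {P} o []      D at = tt , subst (λ o → CodeAt P o D) (sym (+-identityʳ o)) at
CodeAt-++ {P} o (x ∷ C) D (h , at) with atC , atD ← CodeAt-++ (suc o) C D at =
  (h , atC) , subst (λ o → CodeAt P o D) (sym (+-suc o (length C))) atD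

CodeAt-self : ∀ P → CodeAt P 0 P
CodeAt-self = go []
  where
  snoc : ∀ (B : Program) x C → (B ++ x ∷ []) ++ C ≡ B ++ x ∷ C
  snoc []      x C = refl
  snoc (y ∷ B) x C = cong (y ∷_) (snoc B x C)
  nth-++ : ∀ (B : Program) x C → nth (B ++ x ∷ C) (length B) ≡ just x
  nth-++ []      x C = refl
  nth-++ (y ∷ B) x C = nth-++ B x C
  length-snoc : ∀ (B : Program) x → length (B ++ x ∷ []) ≡ suc (length B)
  length-snoc []      x = refl
  length-snoc (y ∷ B) x = cong suc (length-snoc B x)
  go : ∀ B C → CodeAt (B ++ C) (length B) C
  go B []      = tt
  go B (x ∷ C) = nth-++ B x C , subst₂ (λ P o → CodeAt P o C) (snoc B x C) (length-snoc B x) (go (B ++ x ∷ []) C)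

nth-length : ∀ (P : Program) → nth P (length P) ≡ nothing
nth-length []      = refl
nth-length (x ∷ P) = nth-length P

step-past-end : ∀ P o ρ → nth P o ≡ nothing → step P ⟨ o , ρ ⟩ ≡ nothing
step-past-end P o ρ eq rewrite eq = refl

length-compile : ∀ c o → length (compile c o) ≡ size c
length-compile (r ≔ e)    o = refl
length-compile (c ⨾ d)    o = trans (length-++ (compile c o)) (cong₂ _+_ (length-compile c o) (length-compile d _))
length-compile (loop r c) o = cong (3 +_) (trans (length-++ (compile c (3 + o)))
  (trans (cong (_+ 1) (length-compile c (3 + o))) (+-comm (size c) 1)))

-- Cost of a run all of whose values have at most S bits

unit : ℕ → ℕ
unit S = suc (3 * (suc S * suc S))

bound : ℕ → Cmd → ℕ
bound S (r ≔ e)    = unit S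
bound S (c ⨾ d)    = bound S c + bound S d
-- At most S rounds, as the counter has at most S bits. Each pays for test, constant, division and
-- jump; the last unit is the final test.
bound S (loop r c) = S * (4 * unit S + bound S c) + unit S

module Bounded (S : ℕ) (2≤S : 2 ≤ S) where

  AllFit : Regs → Set
  AllFit ρ = ∀ i → ρ i < 2 ^ S

  -- The other operations cannot produce values longer than those already present.
  FitsExpr : Expr → Regs → Set
  FitsExpr (s ⊕ t) ρ = ρ s + ρ t < 2 ^ S
  FitsExpr (s ⊗ t) ρ = ρ s * ρ t < 2 ^ S
  FitsExpr _       ρ = ⊤

  Fits : Cmd → Regs → Set
  FitsRepeat : Reg → Cmd → ℕ → Regs → Set
  Fits (r ≔ e)    ρ = FitsExpr e ρ
  Fits (c ⨾ d)    ρ = Fits c ρ × Fits d (exec c ρ)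
  Fits (loop r c) ρ = FitsRepeat r c (bitlen (ρ r)) ρ
  FitsRepeat r c zero    ρ = ⊤
  FitsRepeat r c (suc n) ρ = Fits c (enter r ρ) × FitsRepeat r c n (exec c (enter r ρ))

  AllFit-set : ∀ {ρ v} r → AllFit ρ → v < 2 ^ S → AllFit (set ρ r v)
  AllFit-set r fit v< i with i ≡ᵇ r
  ... | true  = v<
  ... | false = fit i

  small : ∀ {n} → (n <ᵇ 4) ≡ true → n < 2 ^ S
  small {n} h = <-≤-trans (<ᵇ⇒< n 4 (subst T (sym h) tt)) (^-monoʳ-≤ 2 2≤S)

  0<2^S : 0 < 2 ^ S
  0<2^S = small {0} refl

  div0-≤ : ∀ x y → div0 x y ≤ x
  div0-≤ x zero    = z≤n
  div0-≤ x (suc y) = m/n≤m x (suc y)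

  mod0-< : ∀ {x y n} → 0 < n → y < n → mod0 x y < n
  mod0-< {x} {zero}  0<n _  = 0<n
  mod0-< {x} {suc y} _   y< = <-trans (m%n<n x (suc y)) y<

  mtp-< : ∀ a k {m n} → 0 < n → m < n → mtp a k m < n
  mtp-< a k {zero}  0<n _  = 0<n
  mtp-< a k {suc m} _   m< = <-trans (m%n<n (tet a k) (suc m)) m<

  value-< : ∀ r e {ρ} → wellFormed (r ≔ e) ≡ true → AllFit ρ → FitsExpr e ρ → ⟦ e ⟧ ρ < 2 ^ S
  value-< r (num n)       wf fit _  = small wf
  value-< r (s ⊕ t)       wf fit v< = v<
  value-< r (s ⊖ t) {ρ}   wf fit _  = ≤-<-trans (m∸n≤m (ρ s) (ρ t)) (fit s)
  value-< r (s ⊗ t)       wf fit v< = v<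
  value-< r (s ⊘ t) {ρ}   wf fit _  = ≤-<-trans (div0-≤ (ρ s) (ρ t)) (fit s)
  value-< r (s ⊛ t) {ρ}   wf fit _  = mod0-< {ρ s} 0<2^S (fit t)
  value-< r (tower a k n) {ρ} wf fit _ = mtp-< (ρ a) (ρ k) 0<2^S (fit n)

  bits : ∀ {ρ} → AllFit ρ → ∀ i → bitlen (ρ i) ≤ S
  bits fit i = bitlen-upper (fit i)

  3S≤ : S + S + S ≤ 3 * (suc S * suc S)
  3S≤ = ≤-trans (≤-reflexive (lemma S)) (*-monoʳ-≤ 3 (≤-trans (n≤1+n S) (m≤m*n (suc S) (suc S))))
    where
    lemma : ∀ s → s + s + s ≡ 3 * s
    lemma = solve-∀

  price₁ : ∀ {x} → x ≤ S → suc x ≤ unit S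
  price₁ x≤ = s≤s (≤-trans x≤ (≤-trans (≤-trans (m≤m+n S S) (m≤m+n (S + S) S)) 3S≤))

  price₂ : ∀ {x y} → x ≤ S → y ≤ S → suc (x + y) ≤ unit S
  price₂ x≤ y≤ = s≤s (≤-trans (+-mono-≤ x≤ y≤) (≤-trans (m≤m+n (S + S) S) 3S≤))

  price₃ : ∀ {x y z} → x ≤ S → y ≤ S → z ≤ S → suc (x + y + z) ≤ unit S
  price₃ x≤ y≤ z≤ = s≤s (≤-trans (+-mono-≤ (+-mono-≤ x≤ y≤) z≤) 3S≤)

  price* : ∀ {x y} → x ≤ S → y ≤ S → suc (suc x * suc y) ≤ unit S
  price* x≤ y≤ = s≤s (≤-trans (*-mono-≤ (s≤s x≤) (s≤s y≤)) (m≤n*m _ 3))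

  step-expr : ∀ P o r e {ρ} → nth P o ≡ just (instr r e) → wellFormed (r ≔ e) ≡ true → AllFit ρ →
              ∃[ κ ] step P ⟨ o , ρ ⟩ ≡ just (⟨ suc o , set ρ r (⟦ e ⟧ ρ) ⟩ , κ) × κ ≤ unit S
  step-expr P o r (num n)       at wf fit rewrite at = _ , refl , price₁ (bitlen-upper {n} (small {n} wf))
  step-expr P o r (s ⊕ t)       at wf fit rewrite at = _ , refl , price₂ (bits fit s) (bits fit t)
  step-expr P o r (s ⊖ t)       at wf fit rewrite at = _ , refl , price₂ (bits fit s) (bits fit t)
  step-expr P o r (s ⊗ t)       at wf fit rewrite at = _ , refl , price* (bits fit s) (bits fit t)
  step-expr P o r (s ⊘ t)       at wf fit rewrite at = _ , refl , price* (bits fit s) (bits fit t)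
  step-expr P o r (s ⊛ t)       at wf fit rewrite at = _ , refl , price* (bits fit s) (bits fit t)
  step-expr P o r (tower a k n) at wf fit rewrite at = _ , refl , price₃ (bits fit a) (bits fit k) (bits fit n)

  step-jz-0 : ∀ P o r l {ρ} → nth P o ≡ just (jz r l) → ρ r ≡ 0 → AllFit ρ →
              ∃[ κ ] step P ⟨ o , ρ ⟩ ≡ just (⟨ l , ρ ⟩ , κ) × κ ≤ unit S
  step-jz-0 P o r l at ρr≡0 fit rewrite at | ρr≡0 = _ , refl , price₁ {0} z≤n

  step-jz-suc : ∀ P o r l {ρ v} → nth P o ≡ just (jz r l) → ρ r ≡ suc v → AllFit ρ →
                ∃[ κ ] step P ⟨ o , ρ ⟩ ≡ just (⟨ suc o , ρ ⟩ , κ) × κ ≤ unit S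
  step-jz-suc P o r l {ρ} at ρr≡ fit with bits fit r
  ... | small rewrite at | ρr≡ = _ , refl , price₁ small

  step-jmp : ∀ P o l {ρ} → nth P o ≡ just (jmp l) → step P ⟨ o , ρ ⟩ ≡ just (⟨ l , ρ ⟩ , 1)
  step-jmp P o l at rewrite at = refl

  Runs : Program → State → Label → Regs → ℕ → Set
  Runs P s o ρ b = (∃[ κ ] Steps P s ⟨ o , ρ ⟩ κ × κ ≤ b) × AllFit ρ

  -- Behaviour, cost and width are proved together: the price of an instruction is bounded only
  -- while all registers fit in S bits.
  compile-correct : ∀ {P} c o ρ → CodeAt P o (compile c o) → wellFormed c ≡ true → AllFit ρ → Fits c ρ →
                    Runs P ⟨ o , ρ ⟩ (o + size c) (exec c ρ) (bound S c)
  compile-correct {P} (r ≔ e) o ρ (at , _) wf fit fits with κ , eq , κ≤ ← step-expr P o r e at wf fit =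
    (κ + 0 , subst (λ p → Steps P ⟨ o , ρ ⟩ ⟨ p , exec (r ≔ e) ρ ⟩ (κ + 0)) (sym (+-comm o 1)) (next eq done)
           , subst (_≤ unit S) (sym (+-identityʳ κ)) κ≤)
    , AllFit-set r fit (value-< r e wf fit fits)
  compile-correct {P} (c ⨾ d) o ρ at wf fit (fits-c , fits-d)
    with at-c , at-d ← CodeAt-++ o (compile c o) _ at
    with wf-c , wf-d ← ∧-split wf
    with (κ , st , κ≤) , fit′ ← compile-correct c o ρ at-c wf-c fit fits-c
    with (κ′ , st′ , κ′≤) , fit″ ← compile-correct d (o + size c) (exec c ρ)
           (subst (λ n → CodeAt P (o + n) (compile d (o + size c))) (length-compile c o) at-d) wf-d fit′ fits-d =
    (κ + κ′ , subst (λ p → Steps P ⟨ o , ρ ⟩ ⟨ p , exec d (exec c ρ) ⟩ (κ + κ′)) (+-assoc o (size c) (size d)) (Steps-trans st st′)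
            , +-mono-≤ κ≤ κ′≤)
    , fit″
  compile-correct {P} (loop r c) o ρ₀ (at₀ , at₁ , at₂ , at₃) wf fit₀ fits₀
    with CodeAt-++ (3 + o) (compile c (3 + o)) _ at₃ | ∧-split wf
  ... | at-c , at-jmp , _ | r≢two , wf′ with r∉c , wf-c ← ∧-split wf′ =
    let (κ , st , κ≤) , fit = iter (bitlen (ρ₀ r)) ρ₀ refl fit₀ fits₀ in
    (κ , st , ≤-trans κ≤ (+-monoˡ-≤ (unit S) (*-monoˡ-≤ (4 * unit S + bound S c) (bits fit₀ r)))) , fit
    where
    body : Regs → Regs
    body ρ = exec c (enter r ρ)

    halved : ∀ ρ → body ρ r ≡ ρ r / 2
    halved ρ = trans (frame c (enter r ρ) (not-false r∉c))
      (trans (set-≡ (set ρ two 2) r _) (cong (λ v → div0 v 2) (set-≢ ρ two 2 {r} (not-false r≢two))))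

    enter-fit : ∀ {ρ} → AllFit ρ → AllFit (set ρ two 2) × AllFit (enter r ρ)
    enter-fit fit = fit₁ , AllFit-set r fit₁ (≤-<-trans (div0-≤ _ 2) (fit₁ r))
      where fit₁ = AllFit-set two fit (small {2} refl)

    iter : ∀ n ρ → bitlen (ρ r) ≡ n → AllFit ρ → FitsRepeat r c n ρ →
           Runs P ⟨ o , ρ ⟩ (o + (4 + size c)) (repeat body n ρ) (n * (4 * unit S + bound S c) + unit S)
    iter zero ρ len≡ fit fits with κ , eq , κ≤ ← step-jz-0 P o r (o + (4 + size c)) at₀ (bitlen≡0 (ρ r) len≡) fit =
      (κ + 0 , next eq done , subst (_≤ unit S) (sym (+-identityʳ κ)) κ≤) , fit
    iter (suc n) ρ len≡ fit (fits , fits′)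
      with v , ρr≡ ← bitlen≡suc (ρ r) len≡
      with κ₀ , eq₀ , κ₀≤ ← step-jz-suc P o r (o + (4 + size c)) at₀ ρr≡ fit
      with κ₁ , eq₁ , κ₁≤ ← step-expr P (suc o) two (num 2) at₁ refl fit
      with κ₂ , eq₂ , κ₂≤ ← step-expr P (suc (suc o)) r (r ⊘ two) at₂ refl (proj₁ (enter-fit fit))
      with (κ₃ , st₃ , κ₃≤) , fit₃ ← compile-correct c (3 + o) (enter r ρ) at-c wf-c (proj₂ (enter-fit fit)) fits
      with (κ₅ , st₅ , κ₅≤) , fit₅ ← iter n (body ρ)
             (bitlen-halve (ρ r) (halved ρ) len≡) fit₃ fits′ =
      (_ , next eq₀ (next eq₁ (next eq₂ (Steps-trans st₃ (next eq₄ st₅)))) , total) , fit₅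
      where
      eq₄ : step P ⟨ 3 + o + size c , body ρ ⟩ ≡ just (⟨ o , body ρ ⟩ , 1)
      eq₄ = step-jmp P (3 + o + size c) o (subst (λ n → nth P (3 + o + n) ≡ just (jmp o)) (length-compile c (3 + o)) at-jmp)
      rearrange : ∀ u b x → u + (u + (u + (b + (u + x)))) ≡ 4 * u + b + x
      rearrange = solve-∀
      total : κ₀ + (κ₁ + (κ₂ + (κ₃ + (1 + κ₅)))) ≤ 4 * unit S + bound S c + n * (4 * unit S + bound S c) + unit S
      total = ≤-trans
        (+-mono-≤ κ₀≤ (+-mono-≤ κ₁≤ (+-mono-≤ κ₂≤ (+-mono-≤ κ₃≤ (+-mono-≤ {1} {unit S} (s≤s z≤n) κ₅≤)))))
        (≤-reflexive (trans (rearrange (unit S) (bound S c) _) (sym (+-assoc (4 * unit S + bound S c) _ (unit S)))))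

  -- A program logic for bounded runs

  infix 3 _⊨_⟶_

  -- A Hoare triple whose precondition is a single initial state, and which also asserts that no sum
  -- or product on the way exceeds S bits.
  record _⊨_⟶_ (ρ : Regs) (c : Cmd) (Q : Regs → Set) : Set where
    constructor runs
    field
      fits : Fits c ρ
      post : Q (exec c ρ)

  -- Sequencing in continuation style: the rest is verified for an abstract state, known only
  -- through R and the registers that c does not write.
  call : ∀ {c d ρ R Q} → ρ ⊨ c ⟶ R →
         (∀ ρ′ → R ρ′ → (∀ i → writes c i ≡ false → ρ′ i ≡ ρ i) → ρ′ ⊨ d ⟶ Q) → ρ ⊨ c ⨾ d ⟶ Q
  call {c} {d} {ρ} (runs f r) k with runs g q ← k (exec c ρ) r (λ i → frame c ρ) = runs (f , g) q

  assign : ∀ r e {ρ} → FitsExpr e ρ → ρ ⊨ r ≔ e ⟶ λ ρ′ → ρ′ r ≡ ⟦ e ⟧ ρ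
  assign r e {ρ} f = runs f (set-≡ ρ r (⟦ e ⟧ ρ))

  conclude : ∀ {c ρ R Q} → ρ ⊨ c ⟶ R →
             (∀ ρ′ → R ρ′ → (∀ i → writes c i ≡ false → ρ′ i ≡ ρ i) → Q ρ′) → ρ ⊨ c ⟶ Q
  conclude {c} {ρ} (runs f r) k = runs f (k (exec c ρ) r (λ i → frame c ρ))

  -- The invariant is indexed by the rounds still to go, which lets it carry both the bit length of
  -- the counter and a complementary count upwards.
  ⊨-loop : ∀ {r c ρ} (I : ℕ → Regs → Set) → (∀ n ρ → I (suc n) ρ → enter r ρ ⊨ c ⟶ I n) →
           I (bitlen (ρ r)) ρ → ρ ⊨ loop r c ⟶ I 0
  ⊨-loop {r} {c} {ρ} I body i = let f , q = go (bitlen (ρ r)) ρ i in runs f q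
    where
    go : ∀ n ρ → I n ρ → FitsRepeat r c n ρ × I 0 (repeat (λ ρ → exec c (enter r ρ)) n ρ)
    go zero    ρ i = tt , i
    go (suc n) ρ i with runs f i′ ← body n ρ i with fs , i″ ← go n _ i′ = (f , fs) , i″

  realize : ∀ {N} {Q : ℕ → Set} c → wellFormed c ≡ true → N < 2 ^ S → regs (init N) ⊨ c ⟶ (λ ρ′ → Q (ρ′ 0)) →
            ∃[ t ] ∃[ s ] ∃[ cost ] (run t (compile c 0) (init N) ≡ just (s , cost) × cost ≤ bound S c × Q (regs s 0))
  realize {N} c wf N< (runs fits post)
    with (κ , steps , κ≤) , _ ← compile-correct c 0 (regs (init N)) (CodeAt-self (compile c 0)) wf
                                  (AllFit-set 0 (λ _ → 0<2^S) N<) fits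
    -- Compiled code contains no halt instruction; it stops by running past its last instruction.
    with t , run≡ ← Steps-run steps (step-past-end (compile c 0) (size c) _
                      (subst (λ o → nth (compile c 0) o ≡ nothing) (length-compile c 0) (nth-length (compile c 0)))) =
    t , _ , κ , run≡ , κ≤ , post

-- Polynomial bounds

Poly : (ℕ → ℕ) → Set
Poly f = ∃[ c ] (∀ n → f n ≤ c * suc n ^ c)

poly-weaken : ∀ {f} a b → (∀ n → f n ≤ a * suc n ^ b) → Poly f
poly-weaken a b h = a + b , λ n → ≤-trans (h n) (*-mono-≤ (m≤m+n a b) (^-monoʳ-≤ (suc n) (m≤n+m b a)))

poly-const : ∀ k → Poly (λ _ → k)
poly-const k = poly-weaken k 0 λ n → ≤-reflexive (sym (*-identityʳ k))

poly-id : Poly (λ n → n)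
poly-id = poly-weaken 1 1 λ n → ≤-trans (n≤1+n n) (≤-reflexive (sym (trans (+-identityʳ _) (*-identityʳ (suc n)))))

poly-+ : ∀ {f g} → Poly f → Poly g → Poly (λ n → f n + g n)
poly-+ (c , hf) (d , hg) = poly-weaken (c + d) (c + d) λ n →
  ≤-trans (+-mono-≤ (hf n) (hg n)) (≤-trans
    (+-mono-≤ (*-monoʳ-≤ c (^-monoʳ-≤ (suc n) (m≤m+n c d))) (*-monoʳ-≤ d (^-monoʳ-≤ (suc n) (m≤n+m d c))))
    (≤-reflexive (sym (*-distribʳ-+ (suc n ^ (c + d)) c d))))

poly-* : ∀ {f g} → Poly f → Poly g → Poly (λ n → f n * g n)
poly-* (c , hf) (d , hg) = poly-weaken (c * d) (c + d) λ n →
  ≤-trans (*-mono-≤ (hf n) (hg n)) (≤-reflexive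
    (trans (lemma c d (suc n ^ c) (suc n ^ d)) (cong (c * d *_) (sym (^-distribˡ-+-* (suc n) c d)))))
  where
  lemma : ∀ c d x y → c * x * (d * y) ≡ c * d * (x * y)
  lemma = solve-∀

poly-∘ : ∀ {f g} → Poly f → Poly g → Poly (λ n → f (g n))
poly-∘ {f} {g} (c , hf) (d , hg) = poly-weaken (c * suc d ^ c) (d * c) λ n → begin
  f (g n)                              ≤⟨ hf (g n) ⟩
  c * suc (g n) ^ c                    ≤⟨ *-monoʳ-≤ c (^-monoˡ-≤ c (+-mono-≤ (m^n>0 (suc n) d) (hg n))) ⟩
  c * (suc d * suc n ^ d) ^ c          ≡⟨ cong (c *_) (^-distribʳ-* c (suc d) (suc n ^ d)) ⟩
  c * (suc d ^ c * (suc n ^ d) ^ c)    ≡⟨ sym (*-assoc c _ _) ⟩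
  c * suc d ^ c * (suc n ^ d) ^ c      ≡⟨ cong (c * suc d ^ c *_) (^-*-assoc (suc n) d c) ⟩
  c * suc d ^ c * suc n ^ (d * c)      ∎
  where open ≤-Reasoning

poly-unit : Poly unit
poly-unit = poly-+ (poly-const 1) (poly-* (poly-const 3) (poly-* suc-poly suc-poly))
  where suc-poly = poly-+ (poly-const 1) poly-id

poly-bound : ∀ c → Poly (λ S → bound S c)
poly-bound (r ≔ e)    = poly-unit
poly-bound (c ⨾ d)    = poly-+ (poly-bound c) (poly-bound d)
poly-bound (loop r c) =
  poly-+ (poly-* poly-id (poly-+ (poly-* (poly-const 4) poly-unit) (poly-bound c))) poly-unit

-- The reduction

rN rZero rA rB rCount rFlag rKeep rRem rX rM rZ rK rRest rPart rQ rD rT rLoop rInner rH rBase rG rLow rMid rHigh rV rMod : Reg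
rN     = 0
rZero  = 2
rA     = 3
rB     = 4
rCount = 5
rFlag  = 6
rKeep  = 7
rRem   = 8
rX     = 9
rM     = 10
rZ     = 11
rK     = 12
rRest  = 13
rPart  = 14
rQ     = 15
rD     = 16
rT     = 17
rLoop  = 18
rInner = 19
rH     = 20
rBase  = 21
rG     = 22
rLow   = 23
rHigh  = 24
rV     = 25
rMod   = 26
rMid   = 27

-- A copy is a subtraction of 0. The register `rZero` is scratch: `increment` loads 1 into it.
move : Reg → Reg → Cmd
move d s = rZero ≔ num 0 ⨾ d ≔ s ⊖ rZero

increment : Reg → Cmd
increment d = rZero ≔ num 1 ⨾ d ≔ d ⊕ rZero

-- One step (a, b) ↦ (b, a mod b) of Euclid's algorithm, without a branch: b + a (1 - b) is a
-- if b = 0 and b otherwise.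
euclidStep : Cmd
euclidStep = rFlag ≔ num 1 ⨾ rFlag ≔ rFlag ⊖ rB ⨾ rKeep ≔ rA ⊗ rFlag ⨾ rRem ≔ rA ⊛ rB ⨾
             rA ≔ rB ⊕ rKeep ⨾ move rB rRem

euclid : Cmd
euclid = move rCount rB ⨾ loop rCount (euclidStep ⨾ euclidStep)

gcdInto : Reg → Reg → Cmd
gcdInto s t = move rA s ⨾ move rB t ⨾ euclid

-- The factors common to the extracted t and the part r of N found so far become squares, hence
-- are dropped from both.
extract : Cmd
extract = gcdInto rRest rQ ⨾ (move rT rA ⨾ rRest ≔ rRest ⊘ rT) ⨾ gcdInto rPart rT ⨾
          (move rH rA ⨾ rT ≔ rT ⊘ rH ⨾ rPart ≔ rPart ⊘ rH) ⨾ rPart ≔ rPart ⊗ rT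

extractAll : Cmd
extractAll = move rInner rN ⨾ loop rInner extract

-- Splitting off squarefree factors, and Euclid's algorithm

Squarefree : ℕ → Set
Squarefree n = ∀ p → Prime p → p * p ∤ n

-- The invariant of the whole reduction: x is still to be decomposed, and r is the squarefree part
-- of N / x. At x = 1 the answer is r.
record Split (N x r : ℕ) : Set where
  constructor split
  field
    root  : ℕ
    eq    : N ≡ r * x * (root * root)
    sqf   : Squarefree r
    pos-x : 1 ≤ x
    pos-r : 1 ≤ r

div0-exact : ∀ {x t} → 1 ≤ t → t ∣ x → div0 x t * t ≡ x
div0-exact {x} {suc t} _ t∣x = m/n*n≡m t∣x

gcd-pos : ∀ {x q} → 1 ≤ x → 1 ≤ gcd x q
gcd-pos {x} {q} 1≤x = n≢0⇒n>0 λ g≡0 → contradiction (gcd[m,n]≡0⇒m≡0 {x} {q} g≡0) (m<n⇒n≢0 1≤x)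

factor-pos : ∀ {x y n} → 1 ≤ n → x * y ≡ n → 1 ≤ x
factor-pos {zero}  1≤n refl = 1≤n
factor-pos {suc x} _   _    = s≤s z≤n

squarefree-∣ : ∀ {m n} → m ∣ n → Squarefree n → Squarefree m
squarefree-∣ m∣n sq p pr d = sq p pr (∣-trans d m∣n)

coprime-prime² : ∀ {p n} → Prime p → p ∤ n → Coprime (p * p) n
coprime-prime² {p} {n} pr p∤n = subst (λ z → Coprime z n) (cong (p *_) (*-identityʳ p)) (coprime-^ˡ 2 (prime∤⇒coprime pr p∤n))

squarefree-* : ∀ {m n} → Coprime m n → Squarefree m → Squarefree n → Squarefree (m * n)
squarefree-* {m} {n} c sm sn p pr p²∣ with p ∣? m
... | yes p∣m = sm p pr (coprime-divisor (coprime-prime² pr p∤n) (subst (p * p ∣_) (*-comm m n) p²∣))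
  where
  p∤n : p ∤ n
  p∤n p∣n = <⇒≢ (prime≥2 pr) (sym (c (p∣m , p∣n)))
... | no  p∤m = sn p pr (coprime-divisor (coprime-prime² pr p∤m) p²∣)

cofactors-coprime : ∀ {r t r′ t′} → 1 ≤ r → r′ * gcd r t ≡ r → t′ * gcd r t ≡ t → Coprime r′ t′
cofactors-coprime {r} {t} {r′} {t′} 1≤r r≡ t≡ {d} (d∣r′ , d∣t′) =
  ∣1⇒≡1 (*-cancelʳ-∣ g {{>-nonZero (gcd-pos {r} {t} 1≤r)}}
    (subst (d * g ∣_) (sym (*-identityˡ g)) (gcd-greatest (subst (d * g ∣_) r≡ (*-monoˡ-∣ g d∣r′)) (subst (d * g ∣_) t≡ (*-monoˡ-∣ g d∣t′)))))
  where g = gcd r t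

module Extract {N x r : ℕ} (sp : Split N x r) (q : ℕ) (sq : Squarefree (gcd x q)) where
  open Split sp
  t h x′ t′ r′ : ℕ
  t  = gcd x q
  h  = gcd r t
  x′ = div0 x t
  t′ = div0 t h
  r′ = div0 r h

  1≤t : 1 ≤ t
  1≤t = gcd-pos {x} {q} pos-x
  1≤h : 1 ≤ h
  1≤h = gcd-pos {r} {t} pos-r
  x≡ : x′ * t ≡ x
  x≡ = div0-exact 1≤t (gcd[m,n]∣m x q)
  t≡ : t′ * h ≡ t
  t≡ = div0-exact 1≤h (gcd[m,n]∣n r t)
  r≡ : r′ * h ≡ r
  r≡ = div0-exact 1≤h (gcd[m,n]∣m r t)

  x′∣x : x′ ∣ x
  x′∣x = subst (x′ ∣_) x≡ (m∣m*n t)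

  extracted : Split N x′ (r′ * t′)
  extracted = record
    { root  = h * root
    ; eq    = begin
        N                                               ≡⟨ eq ⟩
        r * x * (root * root)                           ≡⟨ cong₂ (λ a b → a * b * (root * root)) (sym r≡) (trans (sym x≡) (cong (x′ *_) (sym t≡))) ⟩
        r′ * h * (x′ * (t′ * h)) * (root * root)        ≡⟨ lemma r′ h x′ t′ root ⟩
        r′ * t′ * x′ * (h * root * (h * root))          ∎
    ; sqf   = squarefree-* (cofactors-coprime pos-r r≡ t≡)
                (squarefree-∣ (subst (r′ ∣_) r≡ (m∣m*n h)) sqf) (squarefree-∣ (subst (t′ ∣_) t≡ (m∣m*n h)) sq)
    ; pos-x = factor-pos {x′} {t} pos-x x≡
    ; pos-r = *-mono-≤ (factor-pos {r′} {h} pos-r r≡) (factor-pos {t′} {h} 1≤t t≡)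
    }
    where
    open ≡-Reasoning
    lemma : ∀ r h x t m → r * h * (x * (t * h)) * (m * m) ≡ r * t * x * (h * m * (h * m))
    lemma = solve-∀

split-≤ : ∀ {N x r} → 1 ≤ N → Split N x r → x ≤ N × r ≤ N
split-≤ {N} {x} {r} 1≤N sp = ∣⇒≤ {{>-nonZero 1≤N}} (subst (x ∣_) (sym eq) (∣m⇒∣m*n (root * root) (n∣m*n r)))
                           , ∣⇒≤ {{>-nonZero 1≤N}} (subst (r ∣_) (sym eq) (∣m⇒∣m*n (root * root) (m∣m*n x)))
  where open Split sp

split-∣ : ∀ {N x r} → Split N x r → x ∣ N
split-∣ {N} {x} {r} sp = subst (x ∣_) (sym eq) (∣m⇒∣m*n (root * root) (n∣m*n r))
  where open Split sp

euclid-gcd : ∀ a b → gcd (b + a * (1 ∸ b)) (mod0 a b) ≡ gcd a b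
euclid-gcd a zero    = cong (λ z → gcd z 0) (*-identityʳ a)
euclid-gcd a b@(suc b′) = trans (cong (λ z → gcd z (a % b)) (trans (cong (b +_) (trans (cong (a *_) (0∸n≡0 b′)) (*-zeroʳ a))) (+-identityʳ b)))
  (∣-antisym
    (gcd-greatest (∣n∣m%n⇒∣m {m = a} (gcd[m,n]∣m b (a % b)) (gcd[m,n]∣n b (a % b))) (gcd[m,n]∣m b (a % b)))
    (gcd-greatest (gcd[m,n]∣n a b) (%-presˡ-∣ (gcd[m,n]∣m a b) (gcd[m,n]∣n a b))))

euclid-first : ∀ a b → b + a * (1 ∸ b) ≡ a ⊎ b + a * (1 ∸ b) ≡ b
euclid-first a zero    = inj₁ (*-identityʳ a)
euclid-first a (suc b) = inj₂ (trans (cong (suc b +_) (trans (cong (a *_) (0∸n≡0 b)) (*-zeroʳ a))) (+-identityʳ (suc b)))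

-- For c = a mod b with 0 < c < b, the remainder b mod c is below c, and c fits into b at least once
-- besides it. So two steps take one bit off b, and a loop over the bits of b suffices.
euclid-halves : ∀ a b → mod0 (b + a * (1 ∸ b)) (mod0 a b) ≤ b / 2
euclid-halves a zero = z≤n
euclid-halves a b@(suc b′) with a % b | m%n<n a b
... | zero    | _  = z≤n
... | c@(suc _) | c<b = subst (λ z → z % c ≤ b / 2) (sym b≡) (m*n≤o⇒m≤o/n (b % c) 2 b twice)
  where
  b≡ : b + a * (0 ∸ b′) ≡ b
  b≡ = trans (cong (b +_) (trans (cong (a *_) (0∸n≡0 b′)) (*-zeroʳ a))) (+-identityʳ b)
  open ≤-Reasoning
  m*n≤o⇒m≤o/n : ∀ m n o .{{_ : NonZero n}} → m * n ≤ o → m ≤ o / n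
  m*n≤o⇒m≤o/n m n o le = subst (_≤ o / n) (m*n/n≡m m n) (/-monoˡ-≤ n le)
  twice : b % c * 2 ≤ b
  twice = begin
    b % c * 2          ≡⟨ trans (*-comm (b % c) 2) (cong (b % c +_) (+-identityʳ _)) ⟩
    b % c + b % c      ≤⟨ +-monoʳ-≤ (b % c) (<⇒≤ (m%n<n b c)) ⟩
    b % c + c          ≤⟨ +-monoʳ-≤ (b % c) (m≤n*m c (b / c) {{>-nonZero (m≥n⇒m/n>0 (<⇒≤ c<b))}}) ⟩
    b % c + b / c * c  ≡⟨ sym (m≡m%n+[m/n]*n b c) ⟩
    b                  ∎

module Subroutines (S : ℕ) (2≤S : 2 ≤ S) where
  open Bounded S 2≤S

  first< : ∀ {a b} → a < 2 ^ S → b < 2 ^ S → b + a * (1 ∸ b) < 2 ^ S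
  first< {a} {b} a< b< with euclid-first a b
  ... | inj₁ eq = subst (_< 2 ^ S) (sym eq) a<
  ... | inj₂ eq = subst (_< 2 ^ S) (sym eq) b<

  euclidStep-spec : ∀ {ρ} → ρ rA < 2 ^ S → ρ rB < 2 ^ S →
    ρ ⊨ euclidStep ⟶ λ ρ′ → ρ′ rA ≡ ρ rB + ρ rA * (1 ∸ ρ rB) × ρ′ rB ≡ mod0 (ρ rA) (ρ rB)
  euclidStep-spec {ρ} A< B< = runs (tt , tt , ≤-<-trans (keep (ρ rA) (ρ rB)) A< , tt , first< A< B< , tt , tt) (refl , refl)
    where
    keep : ∀ a b → a * (1 ∸ b) ≤ a
    keep a b = ≤-trans (*-monoʳ-≤ a (m∸n≤m 1 b)) (≤-reflexive (*-identityʳ a))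

  Euclid : ℕ → ℕ → Regs → Set
  Euclid g n ρ = bitlen (ρ rCount) ≡ n × ρ rB ≤ ρ rCount × ρ rA < 2 ^ S × ρ rB < 2 ^ S × gcd (ρ rA) (ρ rB) ≡ g

  euclid-body : ∀ g n ρ → Euclid g (suc n) ρ → enter rCount ρ ⊨ euclidStep ⨾ euclidStep ⟶ Euclid g n
  euclid-body g n ρ (len , B≤ , A< , B< , gcd≡) =
    call (euclidStep-spec A< B<) λ ρ₁ (A₁ , B₁) frame₁ →
    let A₁< = subst (_< 2 ^ S) (sym A₁) (first< A< B<)
        B₁< = subst (_< 2 ^ S) (sym B₁) (mod0-< {ρ rA} 0<2^S B<)
    in conclude (euclidStep-spec A₁< B₁<) λ ρ₂ (A₂ , B₂) frame₂ →
    let count≡ : ρ₂ rCount ≡ ρ rCount / 2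
        count≡ = trans (frame₂ rCount refl) (frame₁ rCount refl)
        B₂≡ : ρ₂ rB ≡ mod0 (ρ rB + ρ rA * (1 ∸ ρ rB)) (mod0 (ρ rA) (ρ rB))
        B₂≡ = trans B₂ (cong₂ mod0 A₁ B₁)
    in bitlen-halve (ρ rCount) count≡ len
     , subst₂ _≤_ (sym B₂≡) (sym count≡) (≤-trans (euclid-halves (ρ rA) (ρ rB)) (/-monoˡ-≤ 2 B≤))
     , subst (_< 2 ^ S) (sym A₂) (first< A₁< B₁<)
     , subst (_< 2 ^ S) (sym B₂) (mod0-< {ρ₁ rA} 0<2^S B₁<)
     , trans (cong₂ gcd A₂ B₂) (trans (euclid-gcd (ρ₁ rA) (ρ₁ rB)) (trans (cong₂ gcd A₁ B₁) (trans (euclid-gcd (ρ rA) (ρ rB)) gcd≡)))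

  euclid-spec : ∀ {ρ} → ρ rA < 2 ^ S → ρ rB < 2 ^ S → ρ ⊨ euclid ⟶ λ ρ′ → ρ′ rA ≡ gcd (ρ rA) (ρ rB)
  euclid-spec {ρ} A< B< = call {R = λ ρ′ → ρ′ rCount ≡ ρ rB} (runs (tt , tt) refl) λ ρ₁ count≡ frame₁ →
    conclude (⊨-loop (Euclid (gcd (ρ rA) (ρ rB))) (euclid-body (gcd (ρ rA) (ρ rB)))
      ( refl , ≤-reflexive (trans (frame₁ rB refl) (sym count≡))
      , subst (_< 2 ^ S) (sym (frame₁ rA refl)) A< , subst (_< 2 ^ S) (sym (frame₁ rB refl)) B<
      , cong₂ gcd (frame₁ rA refl) (frame₁ rB refl)))
    λ ρ₂ (len , B≤ , _ , _ , gcd≡) _ →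
    let B≡0 = n≤0⇒n≡0 (≤-trans B≤ (≤-reflexive (bitlen≡0 (ρ₂ rCount) len)))
    in trans (sym (gcd-identityʳ (ρ₂ rA))) (trans (cong (gcd (ρ₂ rA)) (sym B≡0)) gcd≡)

  move-spec : ∀ d s {ρ} → (s ≡ᵇ rZero) ≡ false → ρ ⊨ move d s ⟶ λ ρ′ → ρ′ d ≡ ρ s
  move-spec d s {ρ} s≢ = runs (tt , tt) (trans (set-≡ (set ρ rZero 0) d _) (set-≢ ρ rZero 0 {s} s≢))

  gcdInto-spec : ∀ s t {ρ} → (s ≡ᵇ rZero) ≡ false → (t ≡ᵇ rZero) ≡ false → (t ≡ᵇ rA) ≡ false →
                 ρ s < 2 ^ S → ρ t < 2 ^ S → ρ ⊨ gcdInto s t ⟶ λ ρ′ → ρ′ rA ≡ gcd (ρ s) (ρ t)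
  gcdInto-spec s t {ρ} s≢ t≢ t≢A s< t< =
    call (move-spec rA s s≢) λ ρ₁ A≡ frame₁ →
    call (move-spec rB t t≢) λ ρ₂ B≡ frame₂ →
    let A≡′ = trans (frame₂ rA refl) A≡
        B≡′ = trans B≡ (frame₁ t (∨-false t≢ t≢A))
    in conclude (euclid-spec (subst (_< 2 ^ S) (sym A≡′) s<) (subst (_< 2 ^ S) (sym B≡′) t<)) λ ρ₃ eq _ →
    trans eq (cong₂ gcd A≡′ B≡′)
    where
    ∨-false : ∀ {a b} → a ≡ false → b ≡ false → a ∨ b ≡ false
    ∨-false refl refl = refl

  gcd-< : ∀ {x q n} → 1 ≤ x → x < n → gcd x q < n
  gcd-< {x} {q} 1≤x x<n = ≤-<-trans (∣⇒≤ {{>-nonZero 1≤x}} (gcd[m,n]∣m x q)) x<n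

  extract-spec : ∀ {N x r q ρ} → 1 ≤ N → N < 2 ^ S → (sp : Split N x r) → (sq : Squarefree (gcd x q)) →
    ρ rRest ≡ x → ρ rPart ≡ r → ρ rQ ≡ q → q < 2 ^ S →
    ρ ⊨ extract ⟶ λ ρ′ → ρ′ rRest ≡ Extract.x′ sp q sq × ρ′ rPart ≡ Extract.r′ sp q sq * Extract.t′ sp q sq
  extract-spec {N} {x} {r} {q} {ρ} 1≤N N< sp sq refl refl refl q< =
    call (gcdInto-spec rRest rQ refl refl refl x< q<) λ ρ₁ A₁ frame₁ →
    call {R = λ ρ′ → ρ′ rT ≡ ρ₁ rA × ρ′ rRest ≡ div0 (ρ₁ rRest) (ρ₁ rA)} (runs ((tt , tt) , tt) (refl , refl)) λ ρ₂ (T₂ , rest₂) frame₂ →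
    let T₂≡ = trans T₂ A₁
        part₂ = trans (frame₂ rPart refl) (frame₁ rPart refl)
        rest₂≡ = trans rest₂ (cong₂ div0 (frame₁ rRest refl) A₁)
    in
    call (gcdInto-spec rPart rT refl refl refl (subst (_< 2 ^ S) (sym part₂) r<) (subst (_< 2 ^ S) (sym T₂≡) (gcd-< {x} {q} pos-x x<)))
      λ ρ₃ A₃ frame₃ →
    let A₃≡ = trans A₃ (cong₂ gcd part₂ T₂≡) in
    call {R = λ ρ′ → ρ′ rT ≡ div0 (ρ₃ rT) (ρ₃ rA) × ρ′ rPart ≡ div0 (ρ₃ rPart) (ρ₃ rA)} (runs ((tt , tt) , tt , tt) (refl , refl))
      λ ρ₄ (T₄ , part₄) frame₄ →
    let T₄≡ = trans T₄ (cong₂ div0 (trans (frame₃ rT refl) T₂≡) A₃≡)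
        part₄≡ = trans part₄ (cong₂ div0 (trans (frame₃ rPart refl) part₂) A₃≡)
    in conclude (assign rPart (rPart ⊗ rT) (subst (_< 2 ^ S) (sym (cong₂ _*_ part₄≡ T₄≡)) r′<)) λ ρ₅ part₅ frame₅ →
      trans (frame₅ rRest refl) (trans (frame₄ rRest refl) (trans (frame₃ rRest refl) rest₂≡))
    , trans part₅ (cong₂ _*_ part₄≡ T₄≡)
    where
    open Extract sp q sq
    open Split sp
    x< = ≤-<-trans (proj₁ (split-≤ 1≤N sp)) N<
    r< = ≤-<-trans (proj₂ (split-≤ 1≤N sp)) N<
    r′< = ≤-<-trans (proj₂ (split-≤ 1≤N extracted)) N<

  -- A round either meets gcd 1, which persists, or divides the rest by at least 2. With no rounds
  -- left the second alternative would make the rest 0, so the gcd is 1. That the rest divides x₀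
  -- keeps each extracted gcd squarefree.
  record Extracting (N x₀ q n : ℕ) (ρ : Regs) : Set where
    constructor extracting
    field
      len  : bitlen (ρ rInner) ≡ n
      sp   : Split N (ρ rRest) (ρ rPart)
      rest∣  : ρ rRest ∣ x₀
      q≡   : ρ rQ ≡ q
      stop : gcd (ρ rRest) q ≡ 1 ⊎ ρ rRest < 2 ^ n

  extractAll-spec : ∀ {N x r q ρ} → 1 ≤ N → N < 2 ^ S → Split N x r → Squarefree (gcd x q) →
    ρ rN ≡ N → ρ rRest ≡ x → ρ rPart ≡ r → ρ rQ ≡ q → q < 2 ^ S →
    ρ ⊨ extractAll ⟶ λ ρ′ → Split N (ρ′ rRest) (ρ′ rPart) × ρ′ rRest ∣ x × gcd (ρ′ rRest) q ≡ 1
  extractAll-spec {N} {x} {r} {q} {ρ} 1≤N N< sp₀ sq refl refl refl refl q< =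
    call (move-spec rInner rN refl) λ ρ₁ inner≡ frame₁ →
    conclude (⊨-loop (Extracting N x q) body (record
      { len = refl
      ; sp = subst₂ (Split N) (sym (frame₁ rRest refl)) (sym (frame₁ rPart refl)) sp₀
      ; rest∣ = subst (_∣ x) (sym (frame₁ rRest refl)) ∣-refl
      ; q≡ = frame₁ rQ refl
      ; stop = inj₂ (subst₂ (λ a b → a < 2 ^ bitlen b) (sym (frame₁ rRest refl)) (sym inner≡)
                 (≤-<-trans (proj₁ (split-≤ 1≤N sp₀)) (n<2^bitlen N))) }))
    λ ρ₂ (extracting _ sp rest∣ _ stop) _ → sp , rest∣ , finish sp stop
    where
    finish : ∀ {x r} → Split N x r → gcd x q ≡ 1 ⊎ x < 1 → gcd x q ≡ 1
    finish sp (inj₁ g≡1) = g≡1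
    finish sp (inj₂ x<1) = contradiction x<1 (≤⇒≯ (Split.pos-x sp))

    progress : ∀ {x r n} (sp : Split N x r) (sq : Squarefree (gcd x q)) → gcd x q ≡ 1 ⊎ x < 2 ^ suc n →
               gcd (Extract.x′ sp q sq) q ≡ 1 ⊎ Extract.x′ sp q sq < 2 ^ n
    progress {x} {r} {n} sp sq d with gcd x q in g≡ | div0-exact {x} {gcd x q} (Extract.1≤t sp q sq) (gcd[m,n]∣m x q) | Extract.1≤t sp q sq
    ... | suc zero | _ | _ = inj₁ (subst (λ z → gcd z q ≡ 1) (sym (n/1≡n x)) g≡)
    progress {x} {r} {n} sp sq (inj₂ x<) | suc (suc t) | eq | _ = inj₂ (*-cancelʳ-< 2 _ (2 ^ n)
      (≤-<-trans (≤-trans (*-monoʳ-≤ (x / suc (suc t)) (s≤s (s≤s z≤n))) (≤-reflexive eq)) (subst (x <_) (*-comm 2 (2 ^ n)) x<)))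

    body : ∀ n ρ → Extracting N x q (suc n) ρ → enter rInner ρ ⊨ extract ⟶ Extracting N x q n
    body n ρ (extracting len sp rest∣ q≡ stop) =
      conclude (extract-spec 1≤N N< sp sq′ refl refl q≡ q<) λ ρ′ (rest′ , part′) frame′ → record
        { len = bitlen-halve (ρ rInner) (frame′ rInner refl) len
        ; sp = subst₂ (Split N) (sym rest′) (sym part′) (Extract.extracted sp q sq′)
        ; rest∣ = subst (_∣ x) (sym rest′) (∣-trans (Extract.x′∣x sp q sq′) rest∣)
        ; q≡ = trans (frame′ rQ refl) q≡
        ; stop = subst (λ z → gcd z q ≡ 1 ⊎ z < 2 ^ n) (sym rest′) (progress {n = n} sp sq′ stop) }
      where
      sq′ : Squarefree (gcd (ρ rRest) q)
      sq′ = squarefree-∣ (gcd-greatest (∣-trans (gcd[m,n]∣m (ρ rRest) q) rest∣) (gcd[m,n]∣n (ρ rRest) q)) sq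

-- Removing small primes and collecting the radical

sieve : Cmd
sieve = (rD ≔ num 0 ⨾ move rLoop rZ) ⨾ loop rLoop (increment rD ⨾ move rQ rD ⨾ extractAll)

-- The modulus is added because the subtraction of the reduced towers would be truncated.
gapGcd : Reg → Reg → Cmd
gapGcd lo hi = (rHigh ≔ tower rBase hi rMod ⨾ rLow ≔ tower rBase lo rMod ⨾ rHigh ≔ rHigh ⊕ rMod ⨾ rHigh ≔ rHigh ⊖ rLow) ⨾
               gcdInto rHigh rMod

-- One round for the base 2d: G from heights K and K + 1 modulo M, H′ from heights K + 1 and K + 2
-- modulo G x, then q becomes gcd (q, H′ / gcd (H′, G)).
collectBase : Cmd
collectBase = increment rD ⨾ (rBase ≔ rD ⊕ rD ⨾ move rMod rM) ⨾ gapGcd rK rMid ⨾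
              (move rG rA ⨾ rMod ≔ rG ⊗ rRest) ⨾ gapGcd rMid rV ⨾ move rH rA ⨾ gcdInto rH rG ⨾
              rH ≔ rH ⊘ rA ⨾ gcdInto rQ rH ⨾ move rQ rA

-- Starting the gcd at x itself keeps q a divisor of x, so p² ∣ q implies p² ∣ N.
collect : Cmd
collect = (move rQ rRest ⨾ rD ≔ num 0 ⨾ move rLoop rZ) ⨾ loop rLoop collectBase

gap-gcd : ∀ {a k m} → 2 ≤ a → 1 ≤ m → gcd (mtp a (suc k) m + m ∸ mtp a k m) m ≡ gcd (δ a k) m
gap-gcd {a} {k} {m@(suc _)} 2≤a _ = ∣-antisym
  (gcd-greatest (to (gcd[m,n]∣n gap m) (gcd[m,n]∣m gap m)) (gcd[m,n]∣n gap m))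
  (gcd-greatest (from (gcd[m,n]∣n (δ a k) m) (gcd[m,n]∣m (δ a k) m)) (gcd[m,n]∣n (δ a k) m))
  where
  u v : ℕ
  u = tet a (suc k)
  v = tet a k
  gap : ℕ
  gap = u % m + m ∸ v % m
  balance : gap + v % m ≡ u % m + m
  balance = m∸n+n≡m (≤-trans (<⇒≤ (m%n<n v m)) (m≤n+m m (u % m)))
  identity : gap + (v + u / m * m) ≡ δ a k + (v + (m + v / m * m))
  identity = begin
    gap + (v + u / m * m)                             ≡⟨ cong (λ z → gap + (z + u / m * m)) (m≡m%n+[m/n]*n v m) ⟩
    gap + (v % m + v / m * m + u / m * m)             ≡⟨ regroup gap (v % m) (v / m * m) (u / m * m) ⟩
    gap + v % m + (v / m * m + u / m * m)             ≡⟨ cong (_+ (v / m * m + u / m * m)) balance ⟩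
    u % m + m + (v / m * m + u / m * m)               ≡⟨ regroup′ (u % m) m (v / m * m) (u / m * m) ⟩
    u % m + u / m * m + (m + v / m * m)               ≡⟨ cong (_+ (m + v / m * m)) (sym (m≡m%n+[m/n]*n u m)) ⟩
    u + (m + v / m * m)                               ≡⟨ cong (_+ (m + v / m * m)) (sym (Tower.tet-δ a 2≤a k)) ⟩
    v + δ a k + (m + v / m * m)                       ≡⟨ regroup″ v (δ a k) (m + v / m * m) ⟩
    δ a k + (v + (m + v / m * m))                     ∎
    where
    open ≡-Reasoning
    regroup : ∀ g r x y → g + (r + x + y) ≡ g + r + (x + y)
    regroup = solve-∀
    regroup′ : ∀ r m x y → r + m + (x + y) ≡ r + y + (m + x)
    regroup′ = solve-∀
    regroup″ : ∀ v d x → v + d + x ≡ d + (v + x)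
    regroup″ = solve-∀
  shift : gap + u / m * m ≡ δ a k + (m + v / m * m)
  shift = +-cancelˡ-≡ v _ _ (trans (swap v gap (u / m * m)) (trans identity (swap′ v (δ a k) (m + v / m * m))))
    where
    swap : ∀ v g x → v + (g + x) ≡ g + (v + x)
    swap = solve-∀
    swap′ : ∀ v d x → d + (v + x) ≡ v + (d + x)
    swap′ = solve-∀
  to : ∀ {d} → d ∣ m → d ∣ gap → d ∣ δ a k
  to {d} d∣m d∣gap = ∣m+n∣m⇒∣n (subst (d ∣_) (trans shift (+-comm (δ a k) _)) (∣m∣n⇒∣m+n d∣gap (∣n⇒∣m*n (u / m) d∣m)))
    (∣m∣n⇒∣m+n d∣m (∣n⇒∣m*n (v / m) d∣m))
  from : ∀ {d} → d ∣ m → d ∣ δ a k → d ∣ gap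
  from {d} d∣m d∣δ = ∣m+n∣m⇒∣n (subst (d ∣_) (trans (sym shift) (+-comm gap _)) (∣m∣n⇒∣m+n d∣δ (∣m∣n⇒∣m+n d∣m (∣n⇒∣m*n (v / m) d∣m))))
    (∣n⇒∣m*n (u / m) d∣m)

module Tested (M x k a : ℕ) where
  G H′ F H : ℕ
  G  = gcd (δ a k) M
  H′ = gcd (δ a (suc k)) (G * x)
  F  = gcd H′ G
  H  = div0 H′ F

mtp<m : ∀ a k {m} → 1 ≤ m → mtp a k m < m
mtp<m a k {suc m} _ = m%n<n (tet a k) (suc m)

up-to-suc : ∀ {n} (A : ℕ → Set) → (∀ d → 1 ≤ d → d ≤ n → A d) → A (suc n) → ∀ d → 1 ≤ d → d ≤ suc n → A d
up-to-suc {n} A below at d 1≤d d≤ with d ≟ suc n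
... | yes refl = at
... | no  d≢   = below d 1≤d (s≤s⁻¹ (≤∧≢⇒< d≤ d≢))

module Phases (S : ℕ) (2≤S : 2 ≤ S) where
  open Bounded S 2≤S
  open Subroutines S 2≤S

  increment-spec : ∀ d {ρ} → (d ≡ᵇ rZero) ≡ false → suc (ρ d) < 2 ^ S → ρ ⊨ increment d ⟶ λ ρ′ → ρ′ d ≡ suc (ρ d)
  increment-spec d {ρ} d≢ d< = runs (tt , subst (_< 2 ^ S) (sym value) d<) (trans (set-≡ (set ρ rZero 1) d _) value)
    where
    value : set ρ rZero 1 d + set ρ rZero 1 rZero ≡ suc (ρ d)
    value = trans (cong (_+ 1) (set-≢ ρ rZero 1 {d} d≢)) (+-comm (ρ d) 1)

  record Sieving (N D n : ℕ) (ρ : Regs) : Set where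
    field
      len     : bitlen (ρ rLoop) ≡ n
      d+n     : ρ rD + n ≡ D
      N≡      : ρ rN ≡ N
      sp      : Split N (ρ rRest) (ρ rPart)
      coprime : ∀ i → 2 ≤ i → i ≤ ρ rD → Coprime (ρ rRest) i

  sieve-spec : ∀ {N ρ} → 1 ≤ N → N < 2 ^ S → bitlen (ρ rZ) < 2 ^ S → ρ rN ≡ N → Split N (ρ rRest) (ρ rPart) →
    ρ ⊨ sieve ⟶ λ ρ′ → Split N (ρ′ rRest) (ρ′ rPart) × (∀ i → 2 ≤ i → i ≤ bitlen (ρ rZ) → Coprime (ρ′ rRest) i)
  sieve-spec {N} {ρ} 1≤N N< D< n≡ sp₀ =
    call {R = λ ρ′ → ρ′ rD ≡ 0 × ρ′ rLoop ≡ ρ rZ} (runs (tt , tt , tt) (refl , refl)) λ ρ₁ (d≡0 , loop≡) frame₁ →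
    conclude (⊨-loop (Sieving N D) body (record
      { len = refl ; d+n = trans (cong (_+ bitlen (ρ₁ rLoop)) d≡0) (cong bitlen loop≡)
      ; N≡ = trans (frame₁ rN refl) n≡
      ; sp = subst₂ (Split N) (sym (frame₁ rRest refl)) (sym (frame₁ rPart refl)) sp₀
      ; coprime = λ i 2≤i i≤ → contradiction (≤-trans 2≤i (≤-trans i≤ (≤-reflexive d≡0))) λ () }))
    λ ρ₂ inv _ → let open Sieving inv in
      sp , λ i 2≤i i≤D → coprime i 2≤i (≤-trans i≤D (≤-reflexive (trans (sym d+n) (+-identityʳ (ρ₂ rD)))))
    where
    D = bitlen (ρ rZ)
    body : ∀ n ρ → Sieving N D (suc n) ρ → enter rLoop ρ ⊨ increment rD ⨾ move rQ rD ⨾ extractAll ⟶ Sieving N D n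
    body n ρ inv =
      call (increment-spec rD refl (≤-<-trans d<D D<)) λ ρ₁ d₁ frame₁ →
      call (move-spec rQ rD refl) λ ρ₂ q₂ frame₂ →
      let q≡ = trans q₂ d₁ in
      conclude (extractAll-spec 1≤N N< sp square (trans (frame₂ rN refl) (trans (frame₁ rN refl) N≡))
          (trans (frame₂ rRest refl) (frame₁ rRest refl)) (trans (frame₂ rPart refl) (frame₁ rPart refl)) q≡ (≤-<-trans d<D D<))
      λ ρ₃ (sp₃ , rest∣ , gcd≡1) frame₃ →
      let d≡ = trans (frame₃ rD refl) (trans (frame₂ rD refl) d₁) in record
      { len = bitlen-halve (ρ rLoop) (trans (frame₃ rLoop refl) (trans (frame₂ rLoop refl) (frame₁ rLoop refl))) len
      ; d+n = trans (cong (_+ n) d≡) (trans (sym (+-suc (ρ rD) n)) d+n)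
      ; N≡ = trans (frame₃ rN refl) (trans (frame₂ rN refl) (trans (frame₁ rN refl) N≡))
      ; sp = sp₃
      ; coprime = λ i 2≤i i≤ → extend (≤-trans i≤ (≤-reflexive d≡)) (λ i≤d → coprime i 2≤i i≤d) rest∣ gcd≡1 }
      where
      open Sieving inv
      d<D : suc (ρ rD) ≤ D
      d<D = subst (suc (ρ rD) ≤_) (trans (sym (+-suc (ρ rD) n)) d+n) (m≤m+n (suc (ρ rD)) n)
      -- Composite trial divisors do no harm: if p² divides one, then p is smaller and has already
      -- been removed from the rest.
      square : Squarefree (gcd (ρ rRest) (suc (ρ rD)))
      square p pr p²∣ = <⇒≢ (prime≥2 pr) (sym (coprime p (prime≥2 pr) p≤d (∣-trans (m∣m*n p) (∣-trans p²∣ (gcd[m,n]∣m (ρ rRest) _)) , ∣-refl)))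
        where
        p≤d : p ≤ ρ rD
        p≤d = s≤s⁻¹ (≤-trans (m<m*n p p {{prime⇒nonZero pr}} (prime≥2 pr)) (∣⇒≤ (∣-trans p²∣ (gcd[m,n]∣n (ρ rRest) _))))
      extend : ∀ {i x′} → i ≤ suc (ρ rD) → (i ≤ ρ rD → Coprime (ρ rRest) i) → x′ ∣ ρ rRest → gcd x′ (suc (ρ rD)) ≡ 1 → Coprime x′ i
      extend {i} i≤ old x′∣ g≡1 with i ≟ suc (ρ rD)
      ... | yes refl = Coprimality.gcd≡1⇒coprime g≡1
      ... | no  i≢   = λ (d∣x′ , d∣i) → old (s≤s⁻¹ (≤∧≢⇒< i≤ i≢)) (∣-trans d∣x′ x′∣ , d∣i)

  gapGcd-spec : ∀ lo hi {ρ a k m} → (lo ≡ᵇ rHigh) ≡ false → 2 ≤ a → 1 ≤ m → m + m ≤ 2 ^ S →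
    ρ rBase ≡ a → ρ lo ≡ k → ρ hi ≡ suc k → ρ rMod ≡ m → ρ ⊨ gapGcd lo hi ⟶ λ ρ′ → ρ′ rA ≡ gcd (δ a k) m
  gapGcd-spec lo hi {ρ} {a} {k} {m} lo≢ 2≤a 1≤m 2m≤ refl k≡ k+1≡ refl =
    call {R = λ ρ′ → ρ′ rHigh ≡ mtp a (suc k) m + m ∸ mtp a k m}
      (runs (tt , tt , sum< , tt)
        (cong₂ (λ h l → mtp a h m + m ∸ mtp a l m) k+1≡ (trans (set-≢ ρ rHigh _ {lo} lo≢) k≡)))
    λ ρ₁ high≡ frame₁ →
    conclude (gcdInto-spec rHigh rMod refl refl refl
      (subst (_< 2 ^ S) (sym high≡) (≤-<-trans (m∸n≤m _ (mtp a k m)) (subst (λ h → mtp a h m + m < 2 ^ S) k+1≡ sum<)))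
      (subst (_< 2 ^ S) (sym (frame₁ rMod refl)) (<-≤-trans (m<m+n m 1≤m) 2m≤)))
    λ ρ₂ A≡ _ → trans A≡ (trans (cong₂ gcd high≡ (frame₁ rMod refl)) (gap-gcd 2≤a 1≤m))
    where
    sum< : mtp a (ρ hi) m + m < 2 ^ S
    sum< = <-≤-trans (+-monoˡ-< m (mtp<m a (ρ hi) 1≤m)) 2m≤

  -- `square` collects evidence instead of naming a good base: as long as p² survives in q, p is
  -- Wieferich to every base tested so far.
  record Bases (x M k D : ℕ) (ρ₀ : Regs) (n : ℕ) (ρ : Regs) : Set where
    field
      len    : bitlen (ρ rLoop) ≡ n
      d+n    : ρ rD + n ≡ D
      rest≡  : ρ rRest ≡ x
      M≡     : ρ rM ≡ M
      k≡     : ρ rK ≡ k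
      mid≡   : ρ rMid ≡ suc k
      v≡     : ρ rV ≡ suc (suc k)
      q∣     : ρ rQ ∣ x
      covers : ∀ p → Prime p → p ∣ x → p ∣ ρ rQ
      square : ∀ p → Prime p → p * p ∣ ρ rQ → ∀ d → 1 ≤ d → d ≤ ρ rD → W p (d + d)

  base-spec : ∀ {x M k d ρ} → 1 ≤ x → 1 ≤ M → M + M ≤ 2 ^ S → M * x + M * x ≤ 2 ^ S → suc d + suc d < 2 ^ S → x < 2 ^ S →
    ρ rD ≡ d → ρ rRest ≡ x → ρ rM ≡ M → ρ rK ≡ k → ρ rMid ≡ suc k → ρ rV ≡ suc (suc k) → 1 ≤ ρ rQ → ρ rQ < 2 ^ S →
    ρ ⊨ collectBase ⟶ λ ρ′ → ρ′ rD ≡ suc d × ρ′ rQ ≡ gcd (ρ rQ) (Tested.H M x k (suc d + suc d))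
  base-spec {x} {M} {k} {d} {ρ} 1≤x 1≤M 2M≤ 2Mx≤ 2d< x< refl refl refl refl mid≡ v≡ 1≤q q< =
    call (increment-spec rD refl (≤-<-trans (m≤m+n (suc d) (suc d)) 2d<)) λ ρ₁ d₁ frame₁ →
    call {R = λ ρ′ → ρ′ rBase ≡ a × ρ′ rMod ≡ M}
      (runs (subst (_< 2 ^ S) (sym (cong₂ _+_ d₁ d₁)) 2d< , tt , tt) (cong₂ _+_ d₁ d₁ , frame₁ rM refl)) λ ρ₂ (base₂ , mod₂) frame₂ →
    let via₂ : ∀ i → writes (increment rD) i ≡ false → writes (rBase ≔ rD ⊕ rD ⨾ move rMod rM) i ≡ false → ρ₂ i ≡ ρ i
        via₂ i w₁ w₂ = trans (frame₂ i w₂) (frame₁ i w₁)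
    in
    call (gapGcd-spec rK rMid refl 2≤a 1≤M 2M≤ base₂ (via₂ rK refl refl) (trans (via₂ rMid refl refl) mid≡) mod₂) λ ρ₃ A₃ frame₃ →
    let via₃ : ∀ i → writes (gapGcd rK rMid) i ≡ false → ρ₃ i ≡ ρ₂ i
        via₃ i = frame₃ i
        rest₃ : ρ₃ rRest ≡ x
        rest₃ = trans (frame₃ rRest refl) (via₂ rRest refl refl)
    in
    call {R = λ ρ′ → ρ′ rG ≡ G × ρ′ rMod ≡ G * x}
      (runs ((tt , tt) , subst (_< 2 ^ S) (sym (cong₂ _*_ A₃ rest₃)) (<-≤-trans (m<m+n (G * x) 1≤Gx) 2Gx≤))
            (A₃ , cong₂ _*_ A₃ rest₃)) λ ρ₄ (G₄ , mod₄) frame₄ →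
    let base₄ = trans (frame₄ rBase refl) (trans (frame₃ rBase refl) base₂)
        mid₄ = trans (frame₄ rMid refl) (trans (frame₃ rMid refl) (trans (via₂ rMid refl refl) mid≡))
        v₄ = trans (frame₄ rV refl) (trans (frame₃ rV refl) (trans (via₂ rV refl refl) v≡))
    in
    call (gapGcd-spec rMid rV refl 2≤a 1≤Gx 2Gx≤ base₄ mid₄ v₄ mod₄) λ ρ₅ A₅ frame₅ →
    call (move-spec rH rA refl) λ ρ₆ H₆ frame₆ →
    let H₆≡ = trans H₆ A₅
        G₆≡ = trans (frame₆ rG refl) (trans (frame₅ rG refl) G₄)
    in
    call (gcdInto-spec rH rG refl refl refl (subst (_< 2 ^ S) (sym H₆≡) H′<) (subst (_< 2 ^ S) (sym G₆≡) G<)) λ ρ₇ A₇ frame₇ →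
    let F₇≡ = trans A₇ (cong₂ gcd H₆≡ G₆≡)
        H₇≡ = trans (frame₇ rH refl) H₆≡
    in
    call (assign rH (rH ⊘ rA) tt) λ ρ₈ H₈ frame₈ →
    let H₈≡ = trans H₈ (cong₂ div0 H₇≡ F₇≡)
        q₈ : ρ₈ rQ ≡ ρ rQ
        q₈ = trans (frame₈ rQ refl) (trans (frame₇ rQ refl) (trans (frame₆ rQ refl) (trans (frame₅ rQ refl)
               (trans (frame₄ rQ refl) (trans (frame₃ rQ refl) (via₂ rQ refl refl))))))
    in
    call (gcdInto-spec rQ rH refl refl refl (subst (_< 2 ^ S) (sym q₈) q<) (subst (_< 2 ^ S) (sym H₈≡) (≤-<-trans (div0-≤ H′ F) H′<)))
      λ ρ₉ A₉ frame₉ →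
    conclude (move-spec rQ rA refl) λ ρ₁₀ q₁₀ frame₁₀ →
      trans (frame₁₀ rD refl) (trans (frame₉ rD refl) (trans (frame₈ rD refl) (trans (frame₇ rD refl) (trans (frame₆ rD refl)
        (trans (frame₅ rD refl) (trans (frame₄ rD refl) (trans (frame₃ rD refl) (trans (frame₂ rD refl) d₁))))))))
    , trans q₁₀ (trans A₉ (cong₂ gcd q₈ H₈≡))
    where
    a : ℕ
    a = suc d + suc d
    open Tested M x k a
    2≤a : 2 ≤ a
    2≤a = s≤s (subst (1 ≤_) (sym (+-suc d d)) (s≤s z≤n))
    G∣M : G ∣ M
    G∣M = gcd[m,n]∣n (δ a k) M
    G≤M : G ≤ M
    G≤M = ∣⇒≤ {{>-nonZero 1≤M}} G∣M
    1≤G : 1 ≤ G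
    1≤G = subst (1 ≤_) (gcd-comm M (δ a k)) (gcd-pos {M} {δ a k} 1≤M)
    1≤Gx : 1 ≤ G * x
    1≤Gx = *-mono-≤ 1≤G 1≤x
    2Gx≤ : G * x + G * x ≤ 2 ^ S
    2Gx≤ = ≤-trans (+-mono-≤ (*-monoˡ-≤ x G≤M) (*-monoˡ-≤ x G≤M)) 2Mx≤
    Gx< : G * x < 2 ^ S
    Gx< = <-≤-trans (m<m+n (G * x) 1≤Gx) 2Gx≤
    H′< : H′ < 2 ^ S
    H′< = ≤-<-trans (∣⇒≤ {{>-nonZero 1≤Gx}} (gcd[m,n]∣n (δ a (suc k)) (G * x))) Gx<
    G< : G < 2 ^ S
    G< = ≤-<-trans G≤M (<-≤-trans (m<m+n M 1≤M) 2M≤)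

  collect-spec : ∀ {x M k D ρ} → 1 ≤ x → 1 ≤ M → M + M ≤ 2 ^ S → M * x + M * x ≤ 2 ^ S → D + D < 2 ^ S → x < 2 ^ S →
    ρ rRest ≡ x → ρ rM ≡ M → ρ rK ≡ k → ρ rMid ≡ suc k → ρ rV ≡ suc (suc k) → bitlen (ρ rZ) ≡ D →
    (∀ p → Prime p → p ∣ x → ∀ d → 1 ≤ d → d ≤ D → p ∣ Tested.H M x k (d + d)) →
    (∀ p → Prime p → p ∣ x → ∀ d → 1 ≤ d → d ≤ D → p * p ∣ Tested.H M x k (d + d) → W p (d + d)) →
    ρ ⊨ collect ⟶ λ ρ′ → ρ′ rQ ∣ x × (∀ p → Prime p → p ∣ x → p ∣ ρ′ rQ) ×
                          (∀ p → Prime p → p * p ∣ ρ′ rQ → ∀ d → 1 ≤ d → d ≤ D → W p (d + d))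
  collect-spec {x} {M} {k} {D} {ρ} 1≤x 1≤M 2M≤ 2Mx≤ 2D< x< refl refl refl mid v refl gain bounded =
    call {R = λ ρ′ → ρ′ rQ ≡ x × ρ′ rD ≡ 0 × ρ′ rLoop ≡ ρ rZ} (runs ((tt , tt) , tt , tt , tt) (refl , refl , refl)) λ ρ₁ (q≡ , d≡0 , loop≡) frame₁ →
    conclude (⊨-loop (Bases x M k D ρ) body (record
      { len = refl ; d+n = trans (cong (_+ bitlen (ρ₁ rLoop)) d≡0) (cong bitlen loop≡)
      ; rest≡ = frame₁ rRest refl ; M≡ = frame₁ rM refl ; k≡ = frame₁ rK refl
      ; mid≡ = trans (frame₁ rMid refl) mid ; v≡ = trans (frame₁ rV refl) v
      ; q∣ = subst (_∣ x) (sym q≡) ∣-refl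
      ; covers = λ p _ p∣x → subst (p ∣_) (sym q≡) p∣x
      ; square = λ p _ _ d 1≤d d≤ → contradiction (≤-trans 1≤d (≤-trans d≤ (≤-reflexive d≡0))) λ () }))
    λ ρ₂ inv _ → let open Bases inv in
      q∣ , covers , λ p pr p²∣ d 1≤d d≤D → square p pr p²∣ d 1≤d (≤-trans d≤D (≤-reflexive (trans (sym d+n) (+-identityʳ (ρ₂ rD)))))
    where
    body : ∀ n ρ′ → Bases x M k D ρ (suc n) ρ′ → enter rLoop ρ′ ⊨ collectBase ⟶ Bases x M k D ρ n
    body n ρ′ inv =
      conclude (base-spec 1≤x 1≤M 2M≤ 2Mx≤ (≤-<-trans (+-mono-≤ d<D d<D) 2D<) x< refl rest≡ M≡ k≡ mid≡ v≡
                 (n≢0⇒n>0 λ q≡0 → contradiction (0∣⇒≡0 (subst (_∣ x) q≡0 q∣)) (m<n⇒n≢0 1≤x))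
                 (≤-<-trans (∣⇒≤ {{>-nonZero 1≤x}} q∣) x<))
      λ ρ₁ (d₁ , q₁) frame₁ → record
        { len = bitlen-halve (ρ′ rLoop) (frame₁ rLoop refl) len
        ; d+n = trans (cong (_+ n) d₁) (trans (sym (+-suc (ρ′ rD) n)) d+n)
        ; rest≡ = trans (frame₁ rRest refl) rest≡ ; M≡ = trans (frame₁ rM refl) M≡ ; k≡ = trans (frame₁ rK refl) k≡
        ; mid≡ = trans (frame₁ rMid refl) mid≡ ; v≡ = trans (frame₁ rV refl) v≡
        ; q∣ = ∣-trans (subst (_∣ ρ′ rQ) (sym q₁) (gcd[m,n]∣m (ρ′ rQ) h)) q∣
        ; covers = λ p pr p∣x → subst (p ∣_) (sym q₁) (gcd-greatest (covers p pr p∣x) (gain p pr p∣x (suc (ρ′ rD)) (s≤s z≤n) d<D))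
        ; square = λ p pr p²∣ d 1≤d d≤ →
            let p²∣gcd = subst (p * p ∣_) q₁ p²∣
                p²∣q = ∣-trans p²∣gcd (gcd[m,n]∣m (ρ′ rQ) h)
                p∣x = ∣-trans (m∣m*n p) (∣-trans p²∣q q∣)
            in up-to-suc (λ d → W p (d + d)) (square p pr p²∣q)
                 (bounded p pr p∣x (suc (ρ′ rD)) (s≤s z≤n) d<D (∣-trans p²∣gcd (gcd[m,n]∣n (ρ′ rQ) h))) d 1≤d (subst (d ≤_) d₁ d≤) }
      where
      open Bases inv
      d<D : suc (ρ′ rD) ≤ D
      d<D = subst (suc (ρ′ rD) ≤_) (trans (sym (+-suc (ρ′ rD) n)) d+n) (m≤m+n (suc (ρ′ rD)) n)
      h : ℕ
      h = Tested.H M x k (suc (ρ′ rD) + suc (ρ′ rD))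

-- For N of L bits, powerX N ≥ 2 ^ (4L); raising a number to its own bit length squares the number of
-- bits. Thus K = bitlen (powerX N) ≥ 4L is a sufficient tower height and D = bitlen (powerZ N) ≥ (4L)⁴
-- is a sufficient number of bases, while powerM N is divisible by p ^ (2K) for every prime p ∣ N.
powerX powerM powerZ : ℕ → ℕ
powerX N = (N + N) * (N + N) * ((N + N) * (N + N))
powerM N = powerX N ^ bitlen (powerX N)
powerZ N = powerM N ^ bitlen (powerM N)

setup : Cmd
setup = (rX ≔ rN ⊕ rN ⨾ rX ≔ rX ⊗ rX ⨾ rX ≔ rX ⊗ rX ⨾ rM ≔ num 1 ⨾ rK ≔ num 0 ⨾ move rLoop rX) ⨾
        loop rLoop (rM ≔ rM ⊗ rX ⨾ increment rK) ⨾
        (rZ ≔ num 1 ⨾ move rLoop rM) ⨾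
        loop rLoop (rZ ≔ rZ ⊗ rM) ⨾
        move rMid rK ⨾ increment rMid ⨾ move rV rMid ⨾ increment rV ⨾
        move rRest rN ⨾ rPart ≔ num 1

program : Cmd
program = setup ⨾ sieve ⨾ collect ⨾ extractAll ⨾ move rN rPart

-- Binary exponents bounding `powerX`, `powerM` and `powerZ` for N of L bits. Their sum bounds all
-- products formed, and the 4 leaves room for doublings and small increments.
widthX widthM widthZ width : ℕ → ℕ
widthX L = 4 * suc L
widthM L = widthX L * widthX L
widthZ L = suc (widthM L) * suc (widthM L)
width  L = widthZ L + widthM L + widthX L + 4

poly-width : Poly width
poly-width = poly-+ (poly-+ (poly-+ pZ pM) pX) (poly-const 4)
  where
  pX : Poly widthX
  pX = poly-* (poly-const 4) (poly-+ (poly-const 1) poly-id)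
  pM : Poly widthM
  pM = poly-* pX pX
  pZ : Poly widthZ
  pZ = poly-* (poly-+ (poly-const 1) pM) (poly-+ (poly-const 1) pM)

^-self-≤ : ∀ {x e} → 1 ≤ e → x < 2 ^ e → x ^ bitlen x ≤ 2 ^ (e * e)
^-self-≤ {x} {e} 1≤e x< = begin
  x ^ bitlen x      ≤⟨ ^-monoˡ-≤ (bitlen x) (<⇒≤ x<) ⟩
  (2 ^ e) ^ bitlen x ≤⟨ ^-monoʳ-≤ (2 ^ e) {{m^n≢0 2 e}} (bitlen-upper {x} {e} x<) ⟩
  (2 ^ e) ^ e       ≡⟨ ^-*-assoc 2 e e ⟩
  2 ^ (e * e)       ∎
  where open ≤-Reasoning

^-self-≥ : ∀ {x e} → 2 ^ e ≤ x → 2 ^ (e * e) ≤ x ^ bitlen x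
^-self-≥ {x} {e} ≤x = begin
  2 ^ (e * e)       ≡⟨ sym (^-*-assoc 2 e e) ⟩
  (2 ^ e) ^ e       ≤⟨ ^-monoˡ-≤ e ≤x ⟩
  x ^ e             ≤⟨ ^-monoʳ-≤ x {{>-nonZero (≤-trans (m^n>0 2 e) ≤x)}} (<⇒≤ (bitlen-lower {x} {e} ≤x)) ⟩
  x ^ bitlen x      ∎
  where open ≤-Reasoning

double-< : ∀ {x e} → x < 2 ^ e → x + x < 2 ^ suc e
double-< {x} {e} x< = subst (x + x <_) (cong (2 ^ e +_) (sym (+-identityʳ (2 ^ e)))) (+-mono-< x< x<)

double-≤ : ∀ {x e} → x ≤ 2 ^ e → x + x ≤ 2 ^ suc e
double-≤ {x} {e} x≤ = subst (x + x ≤_) (cong (2 ^ e +_) (sym (+-identityʳ (2 ^ e)))) (+-mono-≤ x≤ x≤)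

fourth-power : ∀ x e → x ^ e * x ^ e * (x ^ e * x ^ e) ≡ x ^ (4 * e)
fourth-power x e = begin
  x ^ e * x ^ e * (x ^ e * x ^ e)   ≡⟨ cong₂ _*_ (sym (^-distribˡ-+-* x e e)) (sym (^-distribˡ-+-* x e e)) ⟩
  x ^ (e + e) * x ^ (e + e)         ≡⟨ sym (^-distribˡ-+-* x (e + e) (e + e)) ⟩
  x ^ (e + e + (e + e))             ≡⟨ cong (x ^_) (lemma e) ⟩
  x ^ (4 * e)                       ∎
  where
  open ≡-Reasoning
  lemma : ∀ e → e + e + (e + e) ≡ 4 * e
  lemma = solve-∀

module Sizes (N : ℕ) (1≤N : 1 ≤ N) where
  L S X M Z K D : ℕ
  L = bitlen N
  S = width L
  X = powerX N
  M = powerM N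
  Z = powerZ N
  K = bitlen X
  D = bitlen Z

  N<2^L : N < 2 ^ L
  N<2^L = n<2^bitlen N

  1≤L : 1 ≤ L
  1≤L = bitlen-lower {N} {0} 1≤N

  2^L≤2N : 2 ^ L ≤ N + N
  2^L≤2N with 2 ^ pred L ≤? N
  ... | yes le = subst (λ l → 2 ^ l ≤ N + N) (suc-pred L {{>-nonZero 1≤L}})
                   (subst (_≤ N + N) (cong (2 ^ pred L +_) (sym (+-identityʳ _))) (+-mono-≤ le le))
  ... | no  gt = contradiction (bitlen-upper {N} {pred L} (≰⇒> gt)) (<⇒≱ (≤-reflexive (suc-pred L {{>-nonZero 1≤L}})))

  1≤2N : 1 ≤ N + N
  1≤2N = ≤-trans 1≤N (m≤m+n N N)

  1≤X : 1 ≤ X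
  1≤X = *-mono-≤ (*-mono-≤ 1≤2N 1≤2N) (*-mono-≤ 1≤2N 1≤2N)

  1≤M : 1 ≤ M
  1≤M = m^n>0 X {{>-nonZero 1≤X}} K

  X< : X < 2 ^ widthX L
  X< = subst (X <_) (fourth-power 2 (suc L)) (*-mono-< (*-mono-< 2N< 2N<) (*-mono-< 2N< 2N<))
    where 2N< = double-< {N} {L} N<2^L

  M≤ : M ≤ 2 ^ widthM L
  M≤ = ^-self-≤ {X} {widthX L} (s≤s z≤n) X<

  Z≤ : Z ≤ 2 ^ widthZ L
  Z≤ = ^-self-≤ {M} {suc (widthM L)} (s≤s z≤n) (≤-<-trans M≤ (^-monoʳ-< 2 ≤-refl (n<1+n (widthM L))))

  X≥ : 2 ^ (4 * L) ≤ X
  X≥ = subst (_≤ X) (fourth-power 2 L) (*-mono-≤ (*-mono-≤ 2^L≤2N 2^L≤2N) (*-mono-≤ 2^L≤2N 2^L≤2N))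

  K≥ : 4 * L ≤ K
  K≥ = <⇒≤ (bitlen-lower {X} {4 * L} X≥)

  D≥ : 4 * L * (4 * L) * (4 * L * (4 * L)) ≤ D
  D≥ = <⇒≤ (bitlen-lower {Z} {4 * L * (4 * L) * (4 * L * (4 * L))} (^-self-≥ {M} {4 * L * (4 * L)} (^-self-≥ {X} {4 * L} X≥)))

  K≤ : K ≤ widthX L
  K≤ = bitlen-upper {X} {widthX L} X<

  D≤ : D ≤ suc (widthZ L)
  D≤ = bitlen-upper {Z} {suc (widthZ L)} (≤-<-trans Z≤ (^-monoʳ-< 2 ≤-refl (n<1+n (widthZ L))))

  2≤S : 2 ≤ S
  2≤S = ≤-trans (s≤s (s≤s z≤n)) (m≤n+m 4 (widthZ L + widthM L + widthX L))

  to-S< : ∀ x e → x < 2 ^ e → e ≤ S → x < 2 ^ S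
  to-S< x e x< e≤ = <-≤-trans x< (^-monoʳ-≤ 2 e≤)

  wX wM wZ : ℕ
  wX = widthX L
  wM = widthM L
  wZ = widthZ L

  wX≤S : wX + 3 ≤ S
  wX≤S = +-mono-≤ (m≤n+m wX (wZ + wM)) (n≤1+n 3)

  wZ≤S : wZ + 4 ≤ S
  wZ≤S = +-monoˡ-≤ 4 (≤-trans (m≤m+n wZ wM) (m≤m+n (wZ + wM) wX))

  wMX≤S : suc (wM + wX) ≤ S
  wMX≤S = begin
    suc (wM + wX)        ≤⟨ s≤s (m≤n+m (wM + wX) wZ) ⟩
    suc (wZ + (wM + wX)) ≡⟨ cong suc (sym (+-assoc wZ wM wX)) ⟩
    suc (wZ + wM + wX)   ≡⟨ +-comm 1 _ ⟩
    wZ + wM + wX + 1     ≤⟨ +-monoʳ-≤ (wZ + wM + wX) (s≤s z≤n) ⟩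
    S                    ∎
    where open ≤-Reasoning

  X<S : X < 2 ^ S
  X<S = to-S< X wX X< (≤-trans (m≤m+n wX 3) wX≤S)

  N<S : N < 2 ^ S
  N<S = to-S< N L N<2^L (≤-trans (≤-trans (n≤1+n L) (m≤n*m (suc L) 4)) (≤-trans (m≤m+n wX 3) wX≤S))

  M<S : M < 2 ^ S
  M<S = ≤-<-trans M≤ (^-monoʳ-< 2 ≤-refl (≤-trans (s≤s (m≤m+n wM wX)) wMX≤S))

  Z<S : Z < 2 ^ S
  Z<S = ≤-<-trans Z≤ (^-monoʳ-< 2 ≤-refl (<-≤-trans (m<m+n wZ (s≤s z≤n)) wZ≤S))

  K+2<S : suc (suc K) < 2 ^ S
  K+2<S = ≤-<-trans (s≤s (s≤s K≤)) (<-trans (n<1+n (2 + wX)) (to-S< (3 + wX) (3 + wX) (n<m^n ≤-refl (3 + wX)) (subst (_≤ S) (+-comm wX 3) wX≤S)))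

  2D<S : D + D < 2 ^ S
  2D<S = to-S< (D + D) (suc D) (double-< {D} {D} (n<m^n ≤-refl D)) (≤-trans (s≤s D≤) (subst (_≤ S) (+-comm wZ 2) (≤-trans (+-monoʳ-≤ wZ (s≤s (s≤s z≤n))) wZ≤S)))

  2M≤S : M + M ≤ 2 ^ S
  2M≤S = ≤-trans (double-≤ {M} {wM} M≤) (^-monoʳ-≤ 2 (≤-trans (s≤s (m≤m+n wM wX)) wMX≤S))

  2Mx≤S : ∀ {x} → x ≤ N → M * x + M * x ≤ 2 ^ S
  2Mx≤S {x} x≤N = ≤-trans (double-≤ {M * x} {wM + wX} (subst (M * x ≤_) (sym (^-distribˡ-+-* 2 wM wX))
      (*-mono-≤ M≤ (≤-trans x≤N (≤-trans (<⇒≤ N<2^L) (^-monoʳ-≤ 2 (≤-trans (n≤1+n L) (m≤n*m (suc L) 4))))))))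
    (^-monoʳ-≤ 2 wMX≤S)

  open Bounded S 2≤S
  open Subroutines S 2≤S
  open Phases S 2≤S

  record PowersX (n : ℕ) (ρ : Regs) : Set where
    field
      len : bitlen (ρ rLoop) ≡ n
      k+n : ρ rK + n ≡ K
      M≡  : ρ rM ≡ X ^ ρ rK
      X≡  : ρ rX ≡ X
      N≡  : ρ rN ≡ N

  powersX-body : ∀ n ρ → PowersX (suc n) ρ → enter rLoop ρ ⊨ rM ≔ rM ⊗ rX ⨾ increment rK ⟶ PowersX n
  powersX-body n ρ inv =
    call (assign rM (rM ⊗ rX) (subst (_< 2 ^ S) (sym next≡) next<)) λ ρ₁ M₁ frame₁ →
    conclude (increment-spec rK refl (subst (λ k → suc k < 2 ^ S) (sym (frame₁ rK refl))
               (≤-<-trans k<K (<-trans (n<1+n K) (<-trans (n<1+n (suc K)) K+2<S))))) λ ρ₂ K₂ frame₂ →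
    let K₂≡ = trans K₂ (cong suc (frame₁ rK refl)) in record
    { len = bitlen-halve (ρ rLoop) (trans (frame₂ rLoop refl) (frame₁ rLoop refl)) len
    ; k+n = trans (cong (_+ n) K₂≡) (trans (sym (+-suc (ρ rK) n)) k+n)
    ; M≡ = trans (frame₂ rM refl) (trans M₁ (trans next≡ (cong (X ^_) (sym K₂≡))))
    ; X≡ = trans (frame₂ rX refl) (trans (frame₁ rX refl) X≡)
    ; N≡ = trans (frame₂ rN refl) (trans (frame₁ rN refl) N≡) }
    where
    open PowersX inv
    k<K : suc (ρ rK) ≤ K
    k<K = subst (suc (ρ rK) ≤_) (trans (sym (+-suc (ρ rK) n)) k+n) (m≤m+n (suc (ρ rK)) n)
    next≡ : ρ rM * ρ rX ≡ X ^ suc (ρ rK)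
    next≡ = trans (cong₂ _*_ M≡ X≡) (*-comm (X ^ ρ rK) X)
    next< : X ^ suc (ρ rK) < 2 ^ S
    next< = ≤-<-trans (^-monoʳ-≤ X {{>-nonZero 1≤X}} k<K) M<S

  -- The exponent is a field rather than a register: only the bit length of the final power is used
  -- later, unlike K, which is also a tower height.
  record PowersM (n : ℕ) (ρ : Regs) : Set where
    field
      len : bitlen (ρ rLoop) ≡ n
      exponent : ℕ
      j+n : exponent + n ≡ bitlen M
      Z≡  : ρ rZ ≡ M ^ exponent
      M≡  : ρ rM ≡ M

  powersM-body : ∀ n ρ → PowersM (suc n) ρ → enter rLoop ρ ⊨ rZ ≔ rZ ⊗ rM ⟶ PowersM n
  powersM-body n ρ inv =
    conclude (assign rZ (rZ ⊗ rM) (subst (_< 2 ^ S) (sym next≡) next<)) λ ρ₁ Z₁ frame₁ → record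
    { len = bitlen-halve (ρ rLoop) (frame₁ rLoop refl) len
    ; exponent = suc exponent
    ; j+n = trans (sym (+-suc exponent n)) j+n
    ; Z≡ = trans Z₁ next≡
    ; M≡ = trans (frame₁ rM refl) M≡ }
    where
    open PowersM inv
    next≡ : ρ rZ * ρ rM ≡ M ^ suc exponent
    next≡ = trans (cong₂ _*_ Z≡ M≡) (*-comm (M ^ exponent) M)
    next< : M ^ suc exponent < 2 ^ S
    next< = ≤-<-trans (^-monoʳ-≤ M {{>-nonZero 1≤M}} (subst (suc exponent ≤_) (trans (sym (+-suc exponent n)) j+n) (m≤m+n (suc exponent) n))) Z<S

  record Ready (ρ : Regs) : Set where
    field
      N≡    : ρ rN ≡ N
      M≡    : ρ rM ≡ M
      K≡    : ρ rK ≡ K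
      mid≡  : ρ rMid ≡ suc K
      v≡    : ρ rV ≡ suc (suc K)
      Z≡    : ρ rZ ≡ Z
      rest≡ : ρ rRest ≡ N
      part≡ : ρ rPart ≡ 1

  setup-spec : ∀ {ρ} → ρ rN ≡ N → ρ ⊨ setup ⟶ Ready
  setup-spec {ρ} refl =
    call {R = λ ρ′ → ρ′ rX ≡ X × ρ′ rM ≡ 1 × ρ′ rK ≡ 0 × ρ′ rLoop ≡ X}
      (runs (≤-<-trans (≤-trans (m≤m*n y y {{>-nonZero 1≤2N}}) y²≤X) X<S , ≤-<-trans y²≤X X<S , X<S , tt , tt , tt , tt)
            (refl , refl , refl , refl)) λ ρ₁ (X₁ , M₁ , K₁ , loop₁) frame₁ →
    call (⊨-loop PowersX powersX-body (record
      { len = refl ; k+n = trans (cong (_+ bitlen (ρ₁ rLoop)) K₁) (cong bitlen loop₁)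
      ; M≡ = trans M₁ (cong (X ^_) (sym K₁)) ; X≡ = X₁ ; N≡ = frame₁ rN refl })) λ ρ₂ inv₂ frame₂ →
    let module I₂ = PowersX inv₂
        K₂ = trans (sym (+-identityʳ (ρ₂ rK))) I₂.k+n
        M₂ = trans I₂.M≡ (cong (X ^_) K₂)
    in
    call {R = λ ρ′ → ρ′ rZ ≡ 1 × ρ′ rLoop ≡ ρ₂ rM} (runs (tt , tt , tt) (refl , refl)) λ ρ₃ (Z₃ , loop₃) frame₃ →
    call (⊨-loop PowersM powersM-body (record
      { len = refl ; exponent = 0 ; j+n = cong bitlen (trans loop₃ M₂) ; Z≡ = Z₃ ; M≡ = trans (frame₃ rM refl) M₂ })) λ ρ₄ inv₄ frame₄ →
    let module I₄ = PowersM inv₄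
        Z₄ = trans I₄.Z≡ (cong (M ^_) (trans (sym (+-identityʳ I₄.exponent)) I₄.j+n))
        K₄ = trans (frame₄ rK refl) (trans (frame₃ rK refl) K₂)
        N₄ = trans (frame₄ rN refl) (trans (frame₃ rN refl) I₂.N≡)
    in
    call (move-spec rMid rK refl) λ ρ₅ mid₅ frame₅ →
    let mid₅≡ = trans mid₅ K₄ in
    call (increment-spec rMid refl (subst (λ k → suc k < 2 ^ S) (sym mid₅≡) (<-trans (n<1+n (suc K)) K+2<S))) λ ρ₆ mid₆ frame₆ →
    let mid₆≡ = trans mid₆ (cong suc mid₅≡) in
    call (move-spec rV rMid refl) λ ρ₇ v₇ frame₇ →
    let v₇≡ = trans v₇ mid₆≡ in
    call (increment-spec rV refl (subst (λ k → suc k < 2 ^ S) (sym v₇≡) K+2<S)) λ ρ₈ v₈ frame₈ →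
    conclude {R = λ ρ′ → ρ′ rRest ≡ ρ₈ rN × ρ′ rPart ≡ 1} (runs ((tt , tt) , tt) (refl , refl)) λ ρ₉ (rest₉ , part₉) frame₉ →
    let back : ∀ i → writes (move rRest rN ⨾ rPart ≔ num 1) i ≡ false → writes (increment rV) i ≡ false →
                     writes (move rV rMid) i ≡ false → writes (increment rMid) i ≡ false → writes (move rMid rK) i ≡ false → ρ₉ i ≡ ρ₄ i
        back i w₉ w₈ w₇ w₆ w₅ = trans (frame₉ i w₉) (trans (frame₈ i w₈) (trans (frame₇ i w₇) (trans (frame₆ i w₆) (frame₅ i w₅))))
        N₉ = trans (back rN refl refl refl refl refl) N₄
    in record
    { N≡ = N₉
    ; M≡ = trans (back rM refl refl refl refl refl) I₄.M≡
    ; K≡ = trans (back rK refl refl refl refl refl) K₄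
    ; mid≡ = trans (frame₉ rMid refl) (trans (frame₈ rMid refl) (trans (frame₇ rMid refl) mid₆≡))
    ; v≡ = trans (frame₉ rV refl) (trans v₈ (cong suc v₇≡))
    ; Z≡ = trans (back rZ refl refl refl refl refl) Z₄
    ; rest≡ = trans rest₉ (trans (sym (frame₉ rN refl)) N₉)
    ; part≡ = part₉ }
    where
    y : ℕ
    y = N + N
    y²≤X : y * y ≤ X
    y²≤X = m≤m*n (y * y) (y * y) {{>-nonZero (*-mono-≤ 1≤2N 1≤2N)}}

-- From a squarefree factor to the least one

square-free-root : ∀ {r v} → Squarefree r → 1 ≤ v → v * v ∣ r → v ≡ 1
square-free-root {v = suc zero}    sq 1≤v v²∣r = refl
square-free-root {v = suc (suc w)} sq 1≤v v²∣r with p , pr , p∣v ← prime-factor {suc (suc w)} (s≤s (s≤s z≤n)) =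
  contradiction (∣-trans (*-pres-∣ p∣v p∣v) v²∣r) (sq p pr)

-- Divide m and n by their gcd: the square of n / g is coprime to that of m / g, so it divides r and
-- is 1.
square-divisor : ∀ {r m n} → Squarefree r → 1 ≤ m → 1 ≤ n → n * n ∣ r * (m * m) → n ∣ m
square-divisor {r} {m} {n} sq 1≤m 1≤n n²∣
  with divides v n≡ ← gcd[m,n]∣n m n
     | divides u m≡ ← gcd[m,n]∣m m n = subst (_∣ m) (sym n≡g) (gcd[m,n]∣m m n)
  where
  g = gcd m n
  1≤g : 1 ≤ g
  1≤g = gcd-pos {m} {n} 1≤m
  v²∣ : v * v ∣ u * u * r
  v²∣ = *-cancelʳ-∣ (g * g) {{m*n≢0 g g {{>-nonZero 1≤g}} {{>-nonZero 1≤g}}}}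
          (subst₂ _∣_ (trans (cong₂ _*_ n≡ n≡) (lemma v g)) (trans (cong (λ z → r * (z * z)) m≡) (lemma′ r u g)) n²∣)
    where
    lemma : ∀ v g → v * g * (v * g) ≡ v * v * (g * g)
    lemma = solve-∀
    lemma′ : ∀ r u g → r * (u * g * (u * g)) ≡ u * u * r * (g * g)
    lemma′ = solve-∀
  coprime-uv : Coprime v u
  coprime-uv = Coprimality.sym (cofactors-coprime {m} {n} {u} {v} 1≤m (sym m≡) (sym n≡))
  v∣ : v * v ∣ r
  v∣ = coprime-divisor (coprime-square (coprime-square coprime-uv)) v²∣
    where
    coprime-square : ∀ {x y} → Coprime x y → Coprime (y * y) x
    coprime-square {x} {y} c = Coprimality.sym (subst (Coprime x) (cong (y *_) (*-identityʳ y)) (coprime-^ʳ 2 c))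
  v≡1 : v ≡ 1
  v≡1 = square-free-root sq (factor-pos {v} {g} 1≤n (sym n≡)) v∣
  n≡g : n ≡ g
  n≡g = trans n≡ (trans (cong (_* g) v≡1) (*-identityˡ g))

-- In any other representation N = r′ m′² the root m′ divides m, so r′ is r times a nonzero square.
isSquarefreePart : ∀ {N r m} → 1 ≤ N → 1 ≤ r → Squarefree r → N ≡ r * (m * m) → IsSquarefreePart N r
isSquarefreePart {N} {r} {m} 1≤N 1≤r sq N≡ = 1≤r , (m , N≡) , minimal
  where
  positive : ∀ r m → N ≡ r * (m * m) → 1 ≤ m
  positive r zero    eq = contradiction (trans eq (*-zeroʳ r)) (m<n⇒n≢0 1≤N)
  positive r (suc m) eq = s≤s z≤n
  minimal : ∀ r′ → 1 ≤ r′ → IsSquareQuot N r′ → r ≤ r′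
  minimal r′ _ (m′ , N≡′) = bounded-by (square-divisor {r} {m} {m′} sq (positive r m N≡) 1≤m′ (subst (m′ * m′ ∣_) (trans (sym N≡′) N≡) (n∣m*n r′)))
    where
    1≤m′ = positive r′ m′ N≡′
    lemma : ∀ r w m → r * (w * w) * (m * m) ≡ r * (w * m * (w * m))
    lemma = solve-∀
    bounded-by : m′ ∣ m → r ≤ r′
    bounded-by (divides w m≡) = ≤-trans (m≤m*n r (w * w) {{>-nonZero (*-mono-≤ 1≤w 1≤w)}}) (≤-reflexive rw²≡r′)
      where
      N≡w : N ≡ r * (w * m′ * (w * m′))
      N≡w = trans N≡ (cong (λ z → r * (z * z)) m≡)
      1≤w : 1 ≤ w
      1≤w = factor-pos {w} {m′} (positive r (w * m′) N≡w) refl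
      rw²≡r′ : r * (w * w) ≡ r′
      rw²≡r′ = *-cancelʳ-≡ (r * (w * w)) r′ (m′ * m′) {{>-nonZero (*-mono-≤ 1≤m′ 1≤m′)}}
                 (trans (lemma r w m′) (trans (sym N≡w) N≡′))

-- Correctness of the reduction

module Correct (N : ℕ) (1≤N : 1 ≤ N) where
  open Sizes N 1≤N
  open Bounded S 2≤S
  open Subroutines S 2≤S
  open Phases S 2≤S

  4L≤4L² : 4 * L ≤ 4 * L * (4 * L)
  4L≤4L² = m≤m*n (4 * L) (4 * L) {{>-nonZero (≤-trans (s≤s z≤n) (*-monoʳ-≤ 4 1≤L))}}

  4≤D : 4 ≤ D
  4≤D = ≤-trans (≤-trans (*-monoʳ-≤ 4 1≤L) 4L≤4L²) (≤-trans (m≤m*n _ _ {{>-nonZero (≤-trans (s≤s z≤n) (≤-trans (*-monoʳ-≤ 4 1≤L) 4L≤4L²))}}) D≥)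

  module Rough {x p : ℕ} (x∣N : x ∣ N) (rough : ∀ i → 2 ≤ i → i ≤ D → Coprime x i) (pr : Prime p) (p∣x : p ∣ x) where

    p>D : D < p
    p>D with D <? p
    ... | yes lt = lt
    ... | no  ge = contradiction (sym (rough p (prime≥2 pr) (≮⇒≥ ge) (p∣x , ∣-refl))) (<⇒≢ (prime≥2 pr))

    p∤small : ∀ d → 1 ≤ d → d ≤ D → p ∤ d
    p∤small d 1≤d d≤D = >⇒∤ {{>-nonZero 1≤d}} (≤-<-trans d≤D p>D)

    coprime-double : ∀ d → 1 ≤ d → d ≤ D → Coprime p (d + d)
    coprime-double d 1≤d d≤D = prime∤⇒coprime pr λ p∣2d →
      [ p∤small 2 (s≤s z≤n) (≤-trans (s≤s (s≤s z≤n)) 4≤D) , p∤small d 1≤d d≤D ]′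
        (euclidsLemma 2 d pr (subst (p ∣_) (cong (d +_) (sym (+-identityʳ d))) p∣2d))

    p-odd : ∃[ h ] p ≡ suc (h + h)
    p-odd = Tower.Even.odd-coprime 2 ≤-refl ∣-refl (coprime-double 1 ≤-refl (≤-trans (s≤s z≤n) 4≤D))

    p≤N : p ≤ N
    p≤N = ∣⇒≤ {{>-nonZero 1≤N}} (∣-trans p∣x x∣N)

    p< : p < 2 ^ suc L
    p< = ≤-<-trans p≤N (<-trans N<2^L (^-monoʳ-< 2 ≤-refl (n<1+n L)))

    L≤K : L ≤ K
    L≤K = ≤-trans (m≤n*m L 4) K≥

    pᴷ⁺¹∣M : p ^ suc K ∣ M
    pᴷ⁺¹∣M = ∣-trans (^-mono-∣ p (≤-trans (≤-reflexive (+-comm 1 K)) (+-monoʳ-≤ K (≤-trans 1≤L L≤K))))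
               (subst (_∣ M) (sym (trans (^-distribˡ-+-* p K K) (sym (^-distribʳ-* K p p)))) (^-monoˡ-∣ K p²∣X))
      where
      ^-monoˡ-∣ : ∀ {a b} n → a ∣ b → a ^ n ∣ b ^ n
      ^-monoˡ-∣ zero    a∣b = ∣-refl
      ^-monoˡ-∣ (suc n) a∣b = *-pres-∣ a∣b (^-monoˡ-∣ n a∣b)
      p∣2N : p ∣ N + N
      p∣2N = ∣m∣n⇒∣m+n (∣-trans p∣x x∣N) (∣-trans p∣x x∣N)
      p²∣X : p * p ∣ X
      p²∣X = ∣m⇒∣m*n ((N + N) * (N + N)) (*-pres-∣ p∣2N p∣2N)

    module At (d : ℕ) (1≤d : 1 ≤ d) (d≤D : d ≤ D) where
      open Tested M x K (d + d)

      2≤2d : 2 ≤ d + d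
      2≤2d = +-mono-≤ 1≤d 1≤d
      2∣2d : 2 ∣ d + d
      2∣2d = divides d (trans (cong (d +_) (sym (+-identityʳ d))) (*-comm 2 d))
      1≤G : 1 ≤ G
      1≤G = subst (1 ≤_) (gcd-comm M (δ (d + d) K)) (gcd-pos {M} {δ (d + d) K} 1≤M)
      1≤F : 1 ≤ F
      1≤F = subst (1 ≤_) (gcd-comm G H′) (gcd-pos {G} {H′} 1≤G)
      open OddPrime.Base.Ratio {p} pr {proj₁ p-odd} (proj₂ p-odd) {d + d} 2≤2d 2∣2d (coprime-double d 1≤d d≤D)
             {x} {M} {K} {G} {H′} {F} {H} {L} p∣x p< L≤K 1≤G 1≤F refl refl refl (div0-exact {H′} {F} 1≤F (gcd[m,n]∣m H′ G))

      p∣H : p ∣ H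
      p∣H = ratio-∣

      p²∣H⇒W : p * p ∣ H → W p (d + d)
      -- Membership in W is a divisibility test, hence decidable, so it may be proved by
      -- contradiction.
      p²∣H⇒W p²∣H = decidable-stable (1-mod? (p * p) ((d + d) ^ (pred p !))) λ ¬w → ratio-squarefree ¬w pᴷ⁺¹∣M p²∣H

    not-all-double-W : p * p ∣ N → ¬ (∀ d → 1 ≤ d → d ≤ D → W p (d + d))
    not-all-double-W p²∣N all =
      not-all-W {p} {proj₁ p-odd} {L} {s} pr (proj₂ p-odd) (≤-<-trans (∣⇒≤ {{>-nonZero 1≤N}} p²∣N) N<2^L) 1≤s 2L≤2ˢ (≤-<-trans B≤D p>D)
        λ d 1≤d d≤B → W-cancel {p} {2} {d} (all 1 ≤-refl (≤-trans (s≤s z≤n) 4≤D))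
          (subst (W p) (cong (d +_) (sym (+-identityʳ d))) (all d 1≤d (≤-trans d≤B B≤D)))
      where
      -- Rounding 4L down to a power of two still leaves 2L ≤ 2ˢ, which the counting needs, while
      -- 2^(4s) ≤ (4L)⁴ ≤ D keeps its bases among those tested.
      log : ∃[ s ] 2 ^ s ≤ 4 * L × 4 * L < 2 ^ suc s
      log = floor-log 2 (4 * L) ≤-refl (≤-trans 1≤L (m≤n*m L 4))
      s = proj₁ log
      2L≤2ˢ : 2 * L ≤ 2 ^ s
      2L≤2ˢ = <⇒≤ (*-cancelˡ-< 2 (2 * L) (2 ^ s) (subst (_< 2 ^ suc s) (*-assoc 2 2 L) (proj₂ (proj₂ log))))
      1≤s : 1 ≤ s
      1≤s = n≢0⇒n>0 λ s≡0 → contradiction (subst (λ s → 2 * L ≤ 2 ^ s) s≡0 2L≤2ˢ) (<⇒≱ (*-monoʳ-≤ 2 1≤L))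
      B≤D : 2 ^ (4 * s) ≤ D
      B≤D = ≤-trans (≤-reflexive (sym (fourth-power 2 s)))
              (≤-trans (*-mono-≤ (*-mono-≤ 2ˢ≤ 2ˢ≤) (*-mono-≤ 2ˢ≤ 2ˢ≤)) D≥)
        where 2ˢ≤ = proj₁ (proj₂ log)

  trivial-split : Split N N 1
  trivial-split = record
    { root = 1 ; eq = trans (sym (*-identityʳ N)) (cong (_* 1) (sym (*-identityˡ N)))
    ; sqf = λ p pr p²∣1 → <⇒≢ (prime≥2 pr) (sym (∣1⇒≡1 (∣-trans (m∣m*n {p} p) p²∣1)))
    ; pos-x = 1≤N ; pos-r = ≤-refl }

  program-spec : ∀ {ρ} → ρ rN ≡ N → ρ ⊨ program ⟶ λ ρ′ → IsSquarefreePart N (ρ′ rN)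
  program-spec {ρ} N≡ =
    call (setup-spec N≡) λ ρ₁ ready frame₁ →
    let module R = Ready ready in
    call (sieve-spec 1≤N N<S (subst (λ z → bitlen z < 2 ^ S) (sym R.Z≡) (≤-<-trans (m≤m+n D D) 2D<S)) R.N≡
           (subst₂ (Split N) (sym R.rest≡) (sym R.part≡) trivial-split)) λ ρ₂ (sp₂ , rough) frame₂ →
    let x∣N = split-∣ sp₂
        x≤N = ∣⇒≤ {{>-nonZero 1≤N}} x∣N
        x<S = ≤-<-trans x≤N N<S
        rough′ : ∀ i → 2 ≤ i → i ≤ D → Coprime (ρ₂ rRest) i
        rough′ = λ i 2≤i i≤D → rough i 2≤i (≤-trans i≤D (≤-reflexive (sym (cong bitlen R.Z≡))))
    in
    call (collect-spec (Split.pos-x sp₂) 1≤M 2M≤S (2Mx≤S x≤N) 2D<S x<S refl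
           (trans (frame₂ rM refl) R.M≡) (trans (frame₂ rK refl) R.K≡) (trans (frame₂ rMid refl) R.mid≡) (trans (frame₂ rV refl) R.v≡)
           (cong bitlen (trans (frame₂ rZ refl) R.Z≡)) (λ p → Rough.At.p∣H x∣N rough′) (λ p → Rough.At.p²∣H⇒W x∣N rough′)) λ ρ₃ (q∣x , covers , square) frame₃ →
    let sq : Squarefree (ρ₃ rQ)
        sq = λ p pr p²∣q → Rough.not-all-double-W x∣N rough′ pr (∣-trans (m∣m*n p) (∣-trans p²∣q q∣x))
               (∣-trans p²∣q (∣-trans q∣x x∣N)) (square p pr p²∣q)
    in
    call (extractAll-spec 1≤N N<S sp₂ (squarefree-∣ (gcd[m,n]∣n (ρ₂ rRest) (ρ₃ rQ)) sq)
           (trans (frame₃ rN refl) (trans (frame₂ rN refl) R.N≡)) (frame₃ rRest refl) (frame₃ rPart refl) refl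
           (≤-<-trans (∣⇒≤ {{>-nonZero (Split.pos-x sp₂)}} q∣x) x<S)) λ ρ₄ (sp₄ , rest∣ , gcd≡1) frame₄ →
    conclude (move-spec rN rPart refl) λ ρ₅ N₅ frame₅ →
    -- The rest is coprime to q, yet every prime of x divides q.
    let rest≡1 = exhausted (Split.pos-x sp₄) rest∣ gcd≡1 covers in
    subst (IsSquarefreePart N) (sym N₅) (isSquarefreePart {m = Split.root sp₄} 1≤N (Split.pos-r sp₄) (Split.sqf sp₄)
      (trans (Split.eq sp₄) (cong (_* (Split.root sp₄ * Split.root sp₄)) (trans (cong (ρ₄ rPart *_) rest≡1) (*-identityʳ (ρ₄ rPart))))))
    where
    exhausted : ∀ {x x′ q} → 1 ≤ x′ → x′ ∣ x → gcd x′ q ≡ 1 → (∀ p → Prime p → p ∣ x → p ∣ q) → x′ ≡ 1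
    exhausted {x′ = suc zero}    _ _    _     _      = refl
    exhausted {x′ = suc (suc w)} {q} _ x′∣x gcd≡1 covers with p , pr , p∣x′ ← prime-factor {suc (suc w)} (s≤s (s≤s z≤n)) =
      contradiction (sym (Coprimality.gcd≡1⇒coprime {suc (suc w)} {q} gcd≡1 (p∣x′ , covers p pr (∣-trans p∣x′ x′∣x)))) (<⇒≢ (prime≥2 pr))

  computes : ∃[ t ] ∃[ s ] ∃[ cost ] (run t (compile program 0) (init N) ≡ just (s , cost)
                                      × cost ≤ bound S program × IsSquarefreePart N (regs s 0))
  computes = realize {N} {IsSquarefreePart N} program refl N<S (program-spec refl)

theorem6p3 : ∃[ P ] ∃[ c ] (∀ N → 1 ≤ N →
    ∃[ t ] ∃[ s ] ∃[ cost ]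
    (run t P (init N) ≡ just (s , cost)
    × cost ≤ c * (suc (bitlen N)) ^ c
    × IsSquarefreePart N (regs s 0)))
theorem6p3 = compile program 0 , proj₁ poly , λ N 1≤N →
  let t , s , cost , run≡ , cost≤ , part = Correct.computes N 1≤N in
  t , s , cost , run≡ , ≤-trans cost≤ (proj₂ poly (bitlen N)) , part
  where
  poly : Poly (λ L → bound (width L) program)
  poly = poly-∘ {λ S → bound S program} {width} (poly-bound program) poly-width
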